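{- There is an algorithm that, given a graph $G$ with $n$ vertices and $m$ edges, a vertex $s \in V(G)$, and a set $X \subseteq V(G)$ with $|X| = k$ such that $G \setminus X$ is a threshold graph, solves the Firefighting problem on $(G,s)$ (i.e. finds a strategy that maximizes the number of saved vertices when the fire starts at $s$) in time $O\big((2^{k+1}+k)^{2k+2}(n+m)\big)$.
   Context: All graphs are undirected, connected, finite and simple. $G\setminus X$ denotes the graph obtained from $G$ by deleting the vertices of $X$. A graph is a threshold graph if it can be constructed from the empty graph by repeatedly adding an isolated vertex or a universal vertex. Firefighting process on $(G,s)$: at time $0$ a fire starts at $s$. At each subsequent time step $i=1,2,\ldots$, the firefighter permanently defends one vertex that is not burning, and then the fire spreads from every burning vertex to all its undefended neighbors. The process stops when the fire can no longer spread. A vertex is saved if it is not burned at the end (defended vertices count as saved). A strategy is a sequence $S=(v_1,\ldots,v_t)$, where $v_i$ is the vertex defended at time step $i$; it is valid if $v_i$ is not burning at the start of time step $i$ for every $i$ and the process stops at time step $t$. The Firefighting problem asks for a valid strategy saving the maximum number of vertices. The modulator $X$ is given as part of the input. -}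

module Defs where

open import Level using (0ℓ)
open import Data.Bool using (if_then_else_)
open import Data.Nat using (ℕ; zero; suc; _+_; _*_; _∸_; _<_; _≤_; _<ᵇ_; _≡ᵇ_)
open import Data.Fin using (Fin; toℕ) renaming (_<?_ to _<ᶠ?_)
open import Data.Fin.Properties using (any?)
open import Data.Fin.Subset using (Subset; _∪_; _─_; ∁; ⁅_⁆; ∣_∣; _∈_; _∉_; ⊥)
open import Data.Fin.Subset.Properties using (_∈?_)
open import Data.List using (List; []; _∷_; allFin; cartesianProduct; concat; filter; length; map; take; upTo)
open import Data.List.Membership.Propositional using () renaming (_∈_ to _∈ˡ_)
open import Data.List.Relation.Unary.Unique.Propositional using (Unique)
open import Data.Product using (_×_; _,_)
open import Data.Vec using (tabulate)
open import Function.Bundles using (_⇔_)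
open import Relation.Binary.Core using (Rel)
open import Relation.Binary.Construct.Closure.ReflexiveTransitive using (Star)
open import Relation.Binary.Definitions using (Decidable; Irreflexive; Symmetric)
open import Relation.Binary.PropositionalEquality using (_≡_; _≢_)
open import Relation.Nullary using (¬_)
open import Relation.Nullary.Decidable using (⌊_⌋; _×-dec_)

record Graph (n : ℕ) : Set₁ where
  infix 4 _~_ _~?_
  field
    _~_    : Rel (Fin n) 0ℓ
    _~?_   : Decidable _~_
    sym    : Symmetric _~_
    irrefl : Irreflexive _≡_ _~_

module _ {n : ℕ} (G : Graph n) where
  open Graph G

  Connected : Set
  Connected = ∀ u v → Star _~_ u v

  edges : ℕ
  edges = length (filter (λ (u , v) → (u <ᶠ? v) ×-dec (u ~? v))
                         (cartesianProduct (allFin n) (allFin n)))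

  -- Threshold U: the subgraph of G induced by U is a threshold graph.
  data Threshold : Subset n → Set where
    empty     : Threshold ⊥
    isolated  : ∀ {U} v → v ∉ U → (∀ {u} → u ∈ U → ¬ (u ~ v)) →
                Threshold U → Threshold (U ∪ ⁅ v ⁆)
    universal : ∀ {U} v → v ∉ U → (∀ {u} → u ∈ U → u ~ v) →
                Threshold U → Threshold (U ∪ ⁅ v ⁆)

  neighbours : Subset n → Subset n
  neighbours B = tabulate λ v → ⌊ any? (λ u → (u ∈? B) ×-dec (u ~? v)) ⌋

  -- In all that follows, D is the set of defended and B of burning vertices.
  spread : (D B : Subset n) → Subset n
  spread D B = B ∪ (neighbours B ─ D)

  -- Validity of a strategy for the process continued from (D , B).  It ends
  -- exactly when the fire can no longer spread.
  data ValidFrom (D B : Subset n) : List (Fin n) → Set where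
    stop   : spread D B ≡ B → ValidFrom D B []
    defend : ∀ {v vs} → spread D B ≢ B → v ∉ B →
             ValidFrom (D ∪ ⁅ v ⁆) (spread (D ∪ ⁅ v ⁆) B) vs →
             ValidFrom D B (v ∷ vs)

  burnedFrom : (D B : Subset n) → List (Fin n) → Subset n
  burnedFrom D B []       = B
  burnedFrom D B (v ∷ vs) = burnedFrom (D ∪ ⁅ v ⁆) (spread (D ∪ ⁅ v ⁆) B) vs

  Valid : Fin n → List (Fin n) → Set
  Valid s = ValidFrom ⊥ ⁅ s ⁆

  saved : Fin n → List (Fin n) → ℕ
  saved s vs = ∣ ∁ (burnedFrom ⊥ ⁅ s ⁆ vs) ∣

  Optimal : Fin n → List (Fin n) → Set
  Optimal s vs = Valid s vs × (∀ ws → Valid s ws → saved s ws ≤ saved s vs)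

-- Word RAM.  A program uses finitely many registers and finitely many arrays,
-- each named by a number.

data Expr : Set where
  lit             : ℕ → Expr
  reg             : ℕ → Expr
  arr             : ℕ → Expr → Expr
  _⊕_ _⊖_ _⊗_ _⊏_ : Expr → Expr → Expr

infix  6 _≔_ _⟦_⟧≔_ cond_then_else_ while_loop_
infixr 5 _⨾_

data Program : Set where
  skip            : Program
  _≔_             : ℕ → Expr → Program
  _⟦_⟧≔_          : ℕ → Expr → Expr → Program
  _⨾_             : Program → Program → Program
  cond_then_else_ : Expr → Program → Program → Program
  while_loop_     : Expr → Program → Program

record Store : Set where
  constructor store
  field
    regs : ℕ → ℕ
    arrs : ℕ → ℕ → ℕ

open Store public

update : {A : Set} → (ℕ → A) → ℕ → A → ℕ → A
update f i a j = if i ≡ᵇ j then a else f j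

eval : Store → Expr → ℕ
eval σ (lit x)   = x
eval σ (reg r)   = regs σ r
eval σ (arr a e) = arrs σ a (eval σ e)
eval σ (e ⊕ f)   = eval σ e + eval σ f
eval σ (e ⊖ f)   = eval σ e ∸ eval σ f
eval σ (e ⊗ f)   = eval σ e * eval σ f
eval σ (e ⊏ f)   = if eval σ e <ᵇ eval σ f then 1 else 0

setReg : Store → ℕ → ℕ → Store
setReg σ r x = store (update (regs σ) r x) (arrs σ)

setArr : Store → ℕ → ℕ → ℕ → Store
setArr σ a i x = store (regs σ) (update (arrs σ) a (update (arrs σ a) i x))

-- Every operation and memory access costs one unit.
cost : Expr → ℕ
cost (lit x)   = 1
cost (reg r)   = 1
cost (arr a e) = suc (cost e)
cost (e ⊕ f)   = suc (cost e + cost f)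
cost (e ⊖ f)   = suc (cost e + cost f)
cost (e ⊗ f)   = suc (cost e + cost f)
cost (e ⊏ f)   = suc (cost e + cost f)

-- W ⊢ p , σ ⇓ τ , t: from store σ, program p halts in store τ after t units of
-- time, all values written and all addresses written to being below W.  A write
-- violating the bound leaves the program stuck.  Intermediate values of an
-- expression are not checked, since they are polynomially bounded in W with an
-- exponent depending only on the program, i.e. they fit in O(1) words.
infix 3 _⊢_,_⇓_,_

data _⊢_,_⇓_,_ (W : ℕ) : Program → Store → Store → ℕ → Set where
  skip : ∀ {σ} → W ⊢ skip , σ ⇓ σ , 1

  assign : ∀ {σ r e} → eval σ e < W →
           W ⊢ r ≔ e , σ ⇓ setReg σ r (eval σ e) , suc (cost e)

  write : ∀ {σ a e f} → eval σ e < W → eval σ f < W →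
          W ⊢ a ⟦ e ⟧≔ f , σ ⇓ setArr σ a (eval σ e) (eval σ f) , suc (cost e + cost f)

  seq : ∀ {p q σ τ υ t u} → W ⊢ p , σ ⇓ τ , t → W ⊢ q , τ ⇓ υ , u →
        W ⊢ p ⨾ q , σ ⇓ υ , t + u

  if-true : ∀ {e p q σ τ t} → eval σ e ≢ 0 → W ⊢ p , σ ⇓ τ , t →
            W ⊢ cond e then p else q , σ ⇓ τ , suc (cost e + t)

  if-false : ∀ {e p q σ τ t} → eval σ e ≡ 0 → W ⊢ q , σ ⇓ τ , t →
             W ⊢ cond e then p else q , σ ⇓ τ , suc (cost e + t)

  while-true : ∀ {e p σ τ υ t u} → eval σ e ≢ 0 →
               W ⊢ p , σ ⇓ τ , t → W ⊢ while e loop p , τ ⇓ υ , u →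
               W ⊢ while e loop p , σ ⇓ υ , suc (cost e + t + u)

  while-false : ∀ {e p σ} → eval σ e ≡ 0 →
                W ⊢ while e loop p , σ ⇓ σ , suc (cost e)

-- xs lists, in arbitrary order and without repetition, the vertices satisfying P.
Lists : ∀ {n} → List (Fin n) → (Fin n → Set) → Set
Lists xs P = Unique xs × (∀ v → (v ∈ˡ xs) ⇔ P v)

AdjacencyLists : ∀ {n} → Graph n → (Fin n → List (Fin n)) → Set
AdjacencyLists G nbrs = ∀ u → Lists (nbrs u) (u ~_)
  where open Graph G

at : {A : Set} → A → List A → ℕ → A
at d []       i       = d
at d (x ∷ xs) zero    = x
at d (x ∷ xs) (suc i) = at d xs i

-- Registers 0, 1, 2 hold n, s and k.  Array 1 is the concatenation of the
-- adjacency lists; that of vertex u occupies the positions from entry u of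
-- array 0 up to, but excluding, entry u + 1.  Array 2 lists the modulator.
-- All other memory is zero.
input : ∀ {n} → (Fin n → List (Fin n)) → Fin n → List (Fin n) → Store
input {n} nbrs s xs = store
  (at 0 (n ∷ toℕ s ∷ length xs ∷ []))
  (λ a → at 0 (at [] (offsets ∷ map toℕ (concat rows) ∷ map toℕ xs ∷ []) a))
  where
  rows : List (List (Fin n))
  rows = map nbrs (allFin n)

  offsets : List ℕ
  offsets = map (λ i → length (concat (take i rows))) (upTo (suc n))

-- Register 0 holds the length of vs and array 0 starts with its entries.
Outputs : ∀ {n} → Store → List (Fin n) → Set
Outputs σ vs = map (arrs σ 0) (upTo (regs σ 0)) ≡ map toℕ vs

{-# OPTIONS --safe #-}
module Submission where

-- The fire burns along induced paths, and a graph that is k vertices away from a threshold graph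
-- has no induced path on more than 2 k + 3 vertices: X cuts the path into pieces, and a threshold
-- graph contains neither 2K₂ nor P₄.  Hence every strategy ends within 2 k + 2 rounds.
--
-- Two vertices outside X with the same neighbours in X are comparable in the vicinal preorder of the
-- threshold graph, where the one of larger degree dominates.  Swapping them in the rest of a
-- strategy shows that defending the dominating one is at least as good.  So in each round only the
-- class of the defended vertex has to be guessed: one of 2 ^ k neighbourhoods in X or one of the k
-- vertices of X.  The algorithm tries all sequences of 2 k + 2 classes, simulating each of
-- them in time O((k + 1) (n + m)).

open import Defs
open import Data.Bool using (Bool; true; false; if_then_else_; T; not; _∨_)
open import Data.Bool.Properties using () renaming (_≟_ to _≟ᵇ_)
open import Data.Empty using (⊥-elim) renaming (⊥ to ⊥′)
open import Data.Nat using (ℕ; zero; suc; _+_; _*_; _∸_; _^_; _≤_; _<_; z≤n; s≤s; s≤s⁻¹; _<?_; _≡ᵇ_; _<ᵇ_; _≤ᵇ_; NonZero)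
open import Data.Nat.DivMod using (_%_; [m+kn]%n≡m%n; m<n⇒m%n≡m)
open import Data.Nat.Properties
open import Data.Nat.Solver using (module +-*-Solver)
open import Data.Fin using (Fin; zero; suc; toℕ; fromℕ<) renaming (_<?_ to _<ᶠ?_)
open import Data.Fin.Permutation.Components using (transpose)
open import Data.Fin.Properties as Fin using (any?; toℕ<n; toℕ-injective; toℕ-fromℕ<) renaming (_≟_ to _≟ᶠ_)
open import Data.Fin.Subset using (Subset; inside; outside; _∪_; _─_; ∁; ⁅_⁆; ∣_∣; _∈_; _∉_; ⊥; _⊆_)
open import Data.Fin.Subset.Properties
  using (_∈?_; x∈⁅x⁆; x∈⁅y⁆⇒x≡y; x∈p∪q⁺; x∈p∪q⁻; p⊆p∪q; ∉⊥; x∈p∧x∉q⇒x∈p─q; p─q⊆p; x∉p⇒x∈∁p; ∣p∣≤n; ∣∁p∣≡n∸∣p∣; p⊆q⇒∣p∣≤∣q∣; ⊆-antisym)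
open import Data.List using (List; []; _∷_; _++_; allFin; applyUpTo; cartesianProduct; concat; filter; length; map; replicate; tabulate; take; upTo)
open import Data.List.Properties
  using (++-assoc; ++-identityʳ; length-++; length-map; length-replicate; length-tabulate; filter-accept; filter-reject; map-tabulate; map-upTo; take-all)
open import Data.List.Membership.Propositional using () renaming (_∈_ to _∈ˡ_; _∉_ to _∉ˡ_)
open import Data.List.Membership.Propositional.Properties
  using (∈-∃++; ∈-++⁻; ∈-++⁺ˡ; ∈-++⁺ʳ; ∈-map⁺; ∈-map⁻; ∈-allFin; ∈-filter⁺; ∈-filter⁻; ∈-cartesianProduct⁺)
open import Data.List.Relation.Unary.Any using (here; there)
open import Data.List.Relation.Unary.All as All using ([]; _∷_)
open import Data.List.Relation.Unary.All.Properties using (¬Any⇒All¬)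
open import Data.List.Relation.Unary.AllPairs using ([]; _∷_)
open import Data.List.Relation.Unary.Unique.Propositional using (Unique)
open import Data.List.Relation.Unary.Unique.Propositional.Properties as Unique using (Unique[x∷xs]⇒x∉xs; allFin⁺)
open import Data.Product using (∃; ∃-syntax; _×_; _,_; proj₁; proj₂; swap)
open import Data.Sum using (_⊎_; inj₁; inj₂; [_,_]′)
open import Data.Unit using (⊤; tt)
import Data.Vec as Vec
open import Data.Vec.Properties using (≡-dec; lookup∘tabulate; []=⇒lookup; lookup⇒[]=)
open import Function using (_∘_; id; case_of_)
open import Function.Bundles using (module Equivalence)
open import Relation.Binary.Definitions using (tri<; tri≈; tri>)
open import Relation.Binary.PropositionalEquality hiding ([_])
open import Relation.Nullary using (¬_; Dec; yes; no; contradiction)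
open import Relation.Nullary.Decidable using (_×-dec_; ¬?; dec-true; decidable-stable; isYes≗does; toSum; toWitness)
open Equivalence using (to; from)
open +-*-Solver using (solve; _:+_; _:*_; _:=_; con)

-- Two obstacles shape the exchange. Transposing a dominated vertex `v` with a dominating `p` is no
-- automorphism: edges at `p` may be lost. They carry no fire, however, since `p` is defended from
-- then on. Moreover, the transposed rest of a strategy may defend vertices that already burn or are
-- already defended. Validity is therefore dropped during the exchange: `burnedFrom` makes sense for
-- every list of vertices, strategies are padded to a common length, and a wasted move may be
-- replaced by any other. Validity returns at the end, because a play of any sequence of classes is
-- valid.
--
-- The sequence of classes is guessed, but the vertex within a class is determined: largest degree
-- first, then least index. Hence the play that the program simulates is the very one about which
-- the exchange argument speaks, and it is enough to minimise the number of burned vertices over all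
-- sequences.
--
-- On the machine a class number has to fit in a word, although `2 ^ k` need not; the numbering of
-- classes is arranged so that there are never more than `3 n` of them.

private variable
  A : Set
  n : ℕ

-- Lists, finite sets and transpositions

length-mono : {xs ys : List A} → Unique xs → (∀ {x} → x ∈ˡ xs → x ∈ˡ ys) → length xs ≤ length ys
length-mono {xs = []} _ _ = z≤n
length-mono {xs = x ∷ xs} {ys} (x≢ ∷ u) sub with ∈-∃++ (sub (here refl))
... | as , bs , refl = begin
  suc (length xs)              ≤⟨ s≤s (length-mono u sub′) ⟩
  suc (length (as ++ bs))      ≡⟨ cong suc (length-++ as) ⟩
  suc (length as + length bs)  ≡⟨ +-suc (length as) (length bs) ⟨
  length as + suc (length bs)  ≡⟨ length-++ as ⟨
  length (as ++ x ∷ bs)        ∎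
  where
  open ≤-Reasoning
  sub′ : ∀ {y} → y ∈ˡ xs → y ∈ˡ as ++ bs
  sub′ y∈ with ∈-++⁻ as (sub (there y∈))
  ... | inj₁ y∈as         = ∈-++⁺ˡ y∈as
  ... | inj₂ (here refl)  = contradiction refl (All.lookup x≢ y∈)
  ... | inj₂ (there y∈bs) = ∈-++⁺ʳ as y∈bs

Unique⇒length≤n : {xs : List (Fin n)} → Unique xs → length xs ≤ n
Unique⇒length≤n {n} {xs} u =
  subst (length xs ≤_) (length-tabulate {n = n} id) (length-mono u (λ {x} _ → ∈-allFin x))

elements : Subset n → List (Fin n)
elements Vec.[]              = []
elements (inside Vec.∷ S)    = zero ∷ map suc (elements S)
elements (outside Vec.∷ S)   = map suc (elements S)

length-elements : (S : Subset n) → length (elements S) ≡ ∣ S ∣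
length-elements Vec.[]            = refl
length-elements (inside Vec.∷ S)  = cong suc (trans (length-map suc (elements S)) (length-elements S))
length-elements (outside Vec.∷ S) = trans (length-map suc (elements S)) (length-elements S)

∈-elements⁺ : {S : Subset n} {x : Fin n} → x ∈ S → x ∈ˡ elements S
∈-elements⁺ Vec.here = here refl
∈-elements⁺ {S = inside Vec.∷ _}  (Vec.there x∈) = there (∈-map⁺ suc (∈-elements⁺ x∈))
∈-elements⁺ {S = outside Vec.∷ _} (Vec.there x∈) = ∈-map⁺ suc (∈-elements⁺ x∈)

∈-elements⁻ : (S : Subset n) {x : Fin n} → x ∈ˡ elements S → x ∈ S
∈-elements⁻ (inside Vec.∷ S) (here refl) = Vec.here
∈-elements⁻ (inside Vec.∷ S) (there x∈) with ∈-map⁻ suc x∈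
... | _ , y∈ , refl = Vec.there (∈-elements⁻ S y∈)
∈-elements⁻ (outside Vec.∷ S) x∈ with ∈-map⁻ suc x∈
... | _ , y∈ , refl = Vec.there (∈-elements⁻ S y∈)

Unique-elements : (S : Subset n) → Unique (elements S)
Unique-elements Vec.[]            = []
Unique-elements (inside Vec.∷ S)  =
  ¬Any⇒All¬ _ (λ z∈ → case ∈-map⁻ suc z∈ of λ { (_ , _ , ()) })
  ∷ Unique.map⁺ Fin.suc-injective (Unique-elements S)
Unique-elements (outside Vec.∷ S) = Unique.map⁺ Fin.suc-injective (Unique-elements S)

length≤∣∣ : {xs : List (Fin n)} {S : Subset n} → Unique xs → (∀ {x} → x ∈ˡ xs → x ∈ S) → length xs ≤ ∣ S ∣
length≤∣∣ {xs = xs} {S} u sub = subst (length xs ≤_) (length-elements S) (length-mono u (∈-elements⁺ ∘ sub))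

length≡∣∣ : {xs : List (Fin n)} {S : Subset n} → Lists xs (_∈ S) → length xs ≡ ∣ S ∣
length≡∣∣ {xs = xs} {S} (u , mem) = ≤-antisym (length≤∣∣ u (to (mem _)))
  (subst (_≤ length xs) (length-elements S) (length-mono (Unique-elements S) (from (mem _) ∘ ∈-elements⁻ S)))

∣∣-mono-injective : {S S′ : Subset n} (f : Fin n → Fin n) → (∀ {x y} → f x ≡ f y → x ≡ y) →
                    (∀ {x} → x ∈ S → f x ∈ S′) → ∣ S ∣ ≤ ∣ S′ ∣
∣∣-mono-injective {S = S} {S′} f inj sub = begin
  ∣ S ∣                      ≡⟨ length-elements S ⟨
  length (elements S)         ≡⟨ length-map f (elements S) ⟨
  length (map f (elements S)) ≤⟨ length≤∣∣ (Unique.map⁺ inj (Unique-elements S)) sub′ ⟩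
  ∣ S′ ∣                     ∎
  where
  open ≤-Reasoning
  sub′ : ∀ {x} → x ∈ˡ map f (elements S) → x ∈ S′
  sub′ x∈ with ∈-map⁻ f x∈
  ... | _ , y∈ , refl = sub (∈-elements⁻ S y∈)

transpose-view : (i j k : Fin n) → (k ≡ i × transpose i j k ≡ j)
                 ⊎ (k ≢ i × k ≡ j × transpose i j k ≡ i) ⊎ (k ≢ i × k ≢ j × transpose i j k ≡ k)
transpose-view i j k with k ≟ᶠ i
... | yes k≡i = inj₁ (k≡i , refl)
... | no k≢i with k ≟ᶠ j
...   | yes k≡j = inj₂ (inj₁ (k≢i , k≡j , refl))
...   | no k≢j  = inj₂ (inj₂ (k≢i , k≢j , refl))

transpose-fixes : {i j k : Fin n} → k ≢ i → k ≢ j → transpose i j k ≡ k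
transpose-fixes {i = i} {j} {k} k≢i k≢j with transpose-view i j k
... | inj₁ (e , _)               = contradiction e k≢i
... | inj₂ (inj₁ (_ , e , _))    = contradiction e k≢j
... | inj₂ (inj₂ (_ , _ , e))    = e

transpose-left : (i j : Fin n) → transpose i j i ≡ j
transpose-left i j with transpose-view i j i
... | inj₁ (_ , e)               = e
... | inj₂ (inj₁ (i≢i , _ , _))  = contradiction refl i≢i
... | inj₂ (inj₂ (i≢i , _ , _))  = contradiction refl i≢i

transpose-right : (i j : Fin n) → transpose i j j ≡ i
transpose-right i j with transpose-view i j j
... | inj₁ (e , e′)              = trans e′ e
... | inj₂ (inj₁ (_ , _ , e))    = e
... | inj₂ (inj₂ (_ , j≢j , _))  = contradiction refl j≢j

transpose-involutive : (i j k : Fin n) → transpose i j (transpose i j k) ≡ k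
transpose-involutive i j k with transpose-view i j k
... | inj₁ (refl , e)                 = trans (cong (transpose i j) e) (transpose-right i j)
... | inj₂ (inj₁ (_ , refl , e))      = trans (cong (transpose i j) e) (transpose-left i j)
... | inj₂ (inj₂ (k≢i , k≢j , e))     = trans (cong (transpose i j) e) e

involutive⇒injective : (π : A → A) → (∀ x → π (π x) ≡ x) → ∀ {x y} → π x ≡ π y → x ≡ y
involutive⇒injective π inv {x} {y} e = trans (sym (inv x)) (trans (cong π e) (inv y))

∉-∪ : {S S′ : Subset n} {x : Fin n} → x ∉ S → x ∉ S′ → x ∉ S ∪ S′
∉-∪ {S = S} {S′} x∉S x∉S′ x∈ = [ x∉S , x∉S′ ]′ (x∈p∪q⁻ S S′ x∈)

∈-∪ˡ : {S S′ : Subset n} {x : Fin n} → x ∈ S → x ∈ S ∪ S′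
∈-∪ˡ = x∈p∪q⁺ ∘ inj₁

∈-∪-new : {S : Subset n} (v : Fin n) → v ∈ S ∪ ⁅ v ⁆
∈-∪-new v = x∈p∪q⁺ (inj₂ (x∈⁅x⁆ v))

∈-∪-⁅⁆⁻ : {S : Subset n} {v x : Fin n} → x ∈ S ∪ ⁅ v ⁆ → x ∈ S ⊎ x ≡ v
∈-∪-⁅⁆⁻ {S = S} {v} x∈ with x∈p∪q⁻ S ⁅ v ⁆ x∈
... | inj₁ x∈S = inj₁ x∈S
... | inj₂ x∈v = inj₂ (x∈⁅y⁆⇒x≡y v x∈v)

x∈p─q⇒x∉q : (p q : Subset n) {x : Fin n} → x ∈ p ─ q → x ∉ q
x∈p─q⇒x∉q (_ Vec.∷ p) (inside Vec.∷ q)  (Vec.there x∈) (Vec.there x∈q) = x∈p─q⇒x∉q p q x∈ x∈q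
x∈p─q⇒x∉q (_ Vec.∷ p) (outside Vec.∷ q) (Vec.there x∈) (Vec.there x∈q) = x∈p─q⇒x∉q p q x∈ x∈q

-- Spread of the fire, and the vicinal preorder of a threshold graph

module _ {n : ℕ} (G : Graph n) where
  open Graph G renaming (sym to ~-sym)

  ~⇒≢ : ∀ {u v} → u ~ v → u ≢ v
  ~⇒≢ u~v u≡v = irrefl u≡v u~v

  neighbours⁺ : ∀ {B u w} → u ∈ B → u ~ w → w ∈ neighbours G B
  neighbours⁺ {B} {u} {w} u∈B u~w =
    lookup⇒[]= w _ (trans (lookup∘tabulate _ w) (trans (isYes≗does found?) (dec-true found? (u , u∈B , u~w))))
    where found? = any? λ u → (u ∈? B) ×-dec (u ~? w)

  neighbours⁻ : ∀ {B w} → w ∈ neighbours G B → ∃ λ u → u ∈ B × u ~ w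
  neighbours⁻ {B} {w} w∈ = toWitness (subst T (sym (trans (sym (lookup∘tabulate _ w)) ([]=⇒lookup w∈))) tt)

  spread-new : ∀ {D B u w} → u ∈ B → u ~ w → w ∉ D → w ∈ spread G D B
  spread-new u∈B u~w w∉D = x∈p∪q⁺ (inj₂ (x∈p∧x∉q⇒x∈p─q (neighbours⁺ u∈B u~w) w∉D))

  spread⁻ : ∀ D B {w} → w ∈ spread G D B → w ∈ B ⊎ (w ∉ D × ∃ λ u → u ∈ B × u ~ w)
  spread⁻ D B w∈ with x∈p∪q⁻ B _ w∈
  ... | inj₁ w∈B = inj₁ w∈B
  ... | inj₂ w∈N = inj₂ (x∈p─q⇒x∉q _ D w∈N , neighbours⁻ {B} (p─q⊆p _ D w∈N))

  stable : ∀ {D B} → (∀ {u w} → u ∈ B → u ~ w → w ∉ D → w ∈ B) → spread G D B ≡ B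
  stable {D} {B} closed = ⊆-antisym sub (p⊆p∪q _)
    where
    sub : spread G D B ⊆ B
    sub w∈ with spread⁻ D B w∈
    ... | inj₁ w∈B                   = w∈B
    ... | inj₂ (w∉D , u , u∈B , u~w) = closed u∈B u~w w∉D

  -- Guarantees that a round which is not the last one has a free vertex to defend, whatever class
  -- was guessed.
  unstable⁻ : ∀ {D B} → spread G D B ≢ B → ∃ λ w → w ∉ B × w ∉ D
  unstable⁻ {D} {B} ≢B with any? (λ w → (w ∈? spread G D B) ×-dec ¬? (w ∈? B))
  ... | yes (w , w∈ , w∉B) = w , w∉B , [ (λ w∈B → contradiction w∈B w∉B) , proj₁ ]′ (spread⁻ D B w∈)
  ... | no none = contradiction (stable λ {u} {w} u∈B u~w w∉D → decidable-stable (w ∈? B)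
      (λ w∉B → none (w , spread-new u∈B u~w w∉D , w∉B))) ≢B

  lonely : ∀ {U v w} → (∀ {u} → u ∈ U → ¬ u ~ v) → w ∈ U ∪ ⁅ v ⁆ → ¬ v ~ w
  lonely iso w∈ v~w with ∈-∪-⁅⁆⁻ w∈
  ... | inj₁ w∈U  = iso w∈U (~-sym v~w)
  ... | inj₂ refl = ~⇒≢ v~w refl

  -- Induction along the construction. The vertex added last is below all others if isolated and
  -- above all others if universal. It sees both or neither of two older vertices, so their
  -- comparison survives. The compared vertex is exempted because no vertex is its own neighbour.
  vicinal-total : ∀ {U} → Threshold G U → ∀ {a d} → a ∈ U → d ∈ U →
            (∀ {w} → w ∈ U → w ≢ d → a ~ w → d ~ w) ⊎ (∀ {w} → w ∈ U → w ≢ a → d ~ w → a ~ w)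
  vicinal-total empty a∈ _ = contradiction a∈ ∉⊥
  vicinal-total (isolated v v∉U iso th) a∈ d∈ with ∈-∪-⁅⁆⁻ a∈ | ∈-∪-⁅⁆⁻ d∈
  ... | inj₂ refl | _ = inj₁ λ w∈ _ v~w → contradiction v~w (lonely iso w∈)
  ... | inj₁ _ | inj₂ refl = inj₂ λ w∈ _ v~w → contradiction v~w (lonely iso w∈)
  ... | inj₁ a∈U | inj₁ d∈U with vicinal-total th a∈U d∈U
  ...   | inj₁ below = inj₁ λ w∈ w≢d a~w → case ∈-∪-⁅⁆⁻ w∈ of λ where
            (inj₁ w∈U) → below w∈U w≢d a~w
            (inj₂ refl) → contradiction a~w (iso a∈U)
  ...   | inj₂ above = inj₂ λ w∈ w≢a d~w → case ∈-∪-⁅⁆⁻ w∈ of λ where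
            (inj₁ w∈U) → above w∈U w≢a d~w
            (inj₂ refl) → contradiction d~w (iso d∈U)
  vicinal-total (universal v v∉U uni th) a∈ d∈ with ∈-∪-⁅⁆⁻ a∈ | ∈-∪-⁅⁆⁻ d∈
  ... | inj₂ refl | _ = inj₂ λ w∈ w≢v _ → case ∈-∪-⁅⁆⁻ w∈ of λ where
            (inj₁ w∈U) → ~-sym (uni w∈U)
            (inj₂ w≡v) → contradiction w≡v w≢v
  ... | inj₁ _ | inj₂ refl = inj₁ λ w∈ w≢v _ → case ∈-∪-⁅⁆⁻ w∈ of λ where
            (inj₁ w∈U) → ~-sym (uni w∈U)
            (inj₂ w≡v) → contradiction w≡v w≢v
  ... | inj₁ a∈U | inj₁ d∈U with vicinal-total th a∈U d∈U
  ...   | inj₁ below = inj₁ λ w∈ w≢d a~w → case ∈-∪-⁅⁆⁻ w∈ of λ where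
            (inj₁ w∈U) → below w∈U w≢d a~w
            (inj₂ refl) → uni d∈U
  ...   | inj₂ above = inj₂ λ w∈ w≢a d~w → case ∈-∪-⁅⁆⁻ w∈ of λ where
            (inj₁ w∈U) → above w∈U w≢a d~w
            (inj₂ refl) → uni a∈U

  -- The three forbidden induced subgraphs 2K₂, P₄ and C₄ at once.
  no-alternating-4-cycle : ∀ {U} → Threshold G U → ∀ {a b c d} → a ∈ U → b ∈ U → c ∈ U → d ∈ U →
                           a ~ b → c ~ d → ¬ a ~ c → ¬ b ~ d → b ≢ d → c ≢ a → ⊥′
  no-alternating-4-cycle th {a} {b} {c} {d} a∈ b∈ c∈ d∈ a~b c~d a≁c b≁d b≢d c≢a with vicinal-total th a∈ d∈
  ... | inj₁ below = b≁d (~-sym (below b∈ b≢d a~b))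
  ... | inj₂ above = a≁c (above c∈ c≢a (~-sym c~d))

  -- Induced paths and the number of rounds

  data InducedPath : List (Fin n) → Set where
    single : ∀ v → InducedPath (v ∷ [])
    -- Missing adjacency does not exclude a return to `v`, as in the list `v , u , v`; hence
    -- distinctness is demanded as well.
    cons : ∀ {v u r} → v ~ u → (∀ {w} → w ∈ˡ r → ¬ v ~ w) → v ∉ˡ u ∷ r →
           InducedPath (u ∷ r) → InducedPath (v ∷ u ∷ r)

  InducedPath⇒Unique : ∀ {l} → InducedPath l → Unique l
  InducedPath⇒Unique (single v)             = [] ∷ []
  InducedPath⇒Unique (cons _ _ v∉ p) = ¬Any⇒All¬ _ v∉ ∷ InducedPath⇒Unique p

  module _ {X : Subset n} (th : Threshold G (∁ X)) where

    hits : List (Fin n) → ℕ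
    hits l = length (filter (_∈? X) l)

    hits-∈ : ∀ {v} r → v ∈ X → hits (v ∷ r) ≡ suc (hits r)
    hits-∈ r v∈ = cong length (filter-accept (_∈? X) {xs = r} v∈)

    hits-∉ : ∀ {v} r → v ∉ X → hits (v ∷ r) ≡ hits r
    hits-∉ r v∉ = cong length (filter-reject (_∈? X) {xs = r} v∉)

    data Alternating : List (Fin n) → Set where
      []   : Alternating []
      single : ∀ v → Alternating (v ∷ [])
      cons : ∀ {v u r} → v ∈ X ⊎ u ∈ X → Alternating (u ∷ r) → Alternating (v ∷ u ∷ r)

    step₁ : ∀ {m h b} → m ≤ 2 * h + b → suc m ≤ 2 * suc h + b
    step₁ {m} {h} {b} le = begin
      suc m               ≤⟨ s≤s le ⟩
      suc (2 * h + b)     ≤⟨ n≤1+n _ ⟩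
      2 + 2 * h + b       ≡⟨ cong (_+ b) (*-suc 2 h) ⟨
      2 * suc h + b       ∎
      where open ≤-Reasoning

    step₂ : ∀ {m h b} → m ≤ 2 * h + b → suc (suc m) ≤ 2 * suc h + b
    step₂ {m} {h} {b} le = begin
      suc (suc m)         ≤⟨ s≤s (s≤s le) ⟩
      2 + 2 * h + b       ≡⟨ cong (_+ b) (*-suc 2 h) ⟨
      2 * suc h + b       ∎
      where open ≤-Reasoning

    -- Every vertex outside `X`, except possibly the last, is followed by one in `X`, so those
    -- outside exceed those inside by at most one.
    Alternating-length : ∀ {l} → Alternating l → length l ≤ 2 * hits l + 1
    Alternating-length [] = z≤n
    Alternating-length (single v) = m≤n+m 1 _
    Alternating-length (cons {v} {u} {r} some alt) with toSum (v ∈? X) | toSum (u ∈? X) | some | alt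
    ... | inj₁ v∈ | _ | _ | _ rewrite hits-∈ (u ∷ r) v∈ = step₁ {b = 1} (Alternating-length alt)
    ... | inj₂ v∉ | _ | inj₁ v∈ | _ = contradiction v∈ v∉
    ... | inj₂ v∉ | inj₂ u∉ | inj₂ u∈ | _ = contradiction u∈ u∉
    ... | inj₂ v∉ | inj₁ u∈ | inj₂ _ | single _ rewrite hits-∉ (u ∷ []) v∉ | hits-∈ [] u∈ = s≤s (s≤s z≤n)
    ... | inj₂ v∉ | inj₁ u∈ | inj₂ _ | cons {r = r′} _ alt′ rewrite hits-∉ (u ∷ r) v∉ | hits-∈ r u∈ =
      step₂ {b = 1} (Alternating-length alt′)

    tail-∉ : ∀ {v u : Fin n} {r} → v ∉ˡ u ∷ r → v ∉ˡ r
    tail-∉ v∉ v∈ = v∉ (there v∈)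

    -- Two consecutive vertices outside `X` would form, with the edge `a b`, an alternating 4-cycle
    -- in the threshold graph. An edge from `b` to the first vertex `c` is tolerated: it only turns
    -- an induced 2K₂ into an induced P₄.
    far-edge-hits : ∀ {a b c r} → a ∉ X → b ∉ X → a ~ b → InducedPath (c ∷ r) →
                    (∀ {w} → w ∈ˡ c ∷ r → ¬ a ~ w) → (∀ {w} → w ∈ˡ r → ¬ b ~ w) →
                    a ∉ˡ c ∷ r → b ∉ˡ c ∷ r → Alternating (c ∷ r)
    far-edge-hits _ _ _ (single v) _ _ _ _ = (single v)
    far-edge-hits {a} {b} a∉X b∉X a~b (cons {c} {d} c~d _ _ p) a≁ b≁ a∉ b∉ =
      cons some (far-edge-hits a∉X b∉X a~b p (a≁ ∘ there) (b≁ ∘ there) (tail-∉ a∉) (tail-∉ b∉))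
      where
      some : c ∈ X ⊎ d ∈ X
      some with c ∈? X | d ∈? X
      ... | yes c∈ | _      = inj₁ c∈
      ... | no _   | yes d∈ = inj₂ d∈
      ... | no c∉  | no d∉  = ⊥-elim (no-alternating-4-cycle th (x∉p⇒x∈∁p a∉X) (x∉p⇒x∈∁p b∉X)
              (x∉p⇒x∈∁p c∉) (x∉p⇒x∈∁p d∉) a~b c~d (a≁ (here refl)) (b≁ (here refl))
              (λ { refl → b∉ (there (here refl)) }) (λ { refl → a∉ (here refl) }))

    -- The path is stripped from the front, at most two vertices per hit, until its first edge lies
    -- outside `X`. What follows this edge alternates, which leaves `2 + (2 * h + 1)` vertices for
    -- `h` hits.
    InducedPath-length : ∀ {l} → InducedPath l → length l ≤ 2 * hits l + 3
    InducedPath-length (single v) = ≤-trans (s≤s z≤n) (m≤n+m 3 _)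
    InducedPath-length (cons {a} {b} {r} a~b a≁ a∉ p) with toSum (a ∈? X) | toSum (b ∈? X) | p
    ... | inj₁ a∈X | _ | _ rewrite hits-∈ (b ∷ r) a∈X = step₁ {b = 3} (InducedPath-length p)
    ... | inj₂ a∉X | inj₁ b∈X | single _ rewrite hits-∉ (b ∷ []) a∉X | hits-∈ [] b∈X = s≤s (s≤s z≤n)
    ... | inj₂ a∉X | inj₁ b∈X | cons _ _ _ q rewrite hits-∉ (b ∷ r) a∉X | hits-∈ r b∈X = step₂ {b = 3} (InducedPath-length q)
    ... | inj₂ a∉X | inj₂ b∉X | single _ rewrite hits-∉ (b ∷ []) a∉X | hits-∉ [] b∉X = s≤s (s≤s z≤n)
    ... | inj₂ a∉X | inj₂ b∉X | cons {u = c} {r = r′} b~c b≁ b∉ q rewrite hits-∉ (b ∷ r) a∉X | hits-∉ r b∉X = begin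
      2 + length (c ∷ r′)           ≤⟨ s≤s (s≤s (Alternating-length alt)) ⟩
      2 + (2 * hits (c ∷ r′) + 1)   ≡⟨ +-comm 2 _ ⟩
      2 * hits (c ∷ r′) + 1 + 2     ≡⟨ +-assoc (2 * hits (c ∷ r′)) 1 2 ⟩
      2 * hits (c ∷ r′) + 3         ∎
      where
      open ≤-Reasoning
      alt = far-edge-hits a∉X b∉X a~b q a≁ b≁ (tail-∉ a∉) b∉

    InducedPath-bound : ∀ {l} → InducedPath l → length l ≤ 2 * ∣ X ∣ + 3
    InducedPath-bound {l} p = ≤-trans (InducedPath-length p) (+-monoˡ-≤ 3 (*-monoʳ-≤ 2
      (length≤∣∣ (Unique.filter⁺ (_∈? X) (InducedPath⇒Unique p)) (λ x∈ → proj₂ (∈-filter⁻ (_∈? X) {xs = l} x∈)))))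

  -- In Layered t D B, t rounds have been played: whatever burns next ends an
  -- induced path of t + 2 vertices, one for each time at which vertices caught fire.
  Layered : ℕ → Subset n → Subset n → Set
  Layered t D B = ∀ {u w} → u ∈ B → w ∉ B → w ∉ D → u ~ w →
    ∃ λ r → length r ≡ t × InducedPath (u ∷ r) × (∀ {x} → x ∈ˡ r → x ∈ B)
      × (∀ {x y} → x ∈ˡ r → x ~ y → y ∈ B ⊎ y ∈ D)

  Layered-init : ∀ s → Layered 0 ⊥ ⁅ s ⁆
  Layered-init s {u} u∈ w∉ w∉D u~w = [] , refl , single u , (λ ()) , (λ ())

  -- All neighbours of a vertex of `r` are burning or defended. So the free vertex `w` is adjacent
  -- to none of them and prolongs the path without a chord.
  extend : ∀ {t D B} → Layered t D B → ∀ {u w} → u ∈ B → w ∉ B → w ∉ D → u ~ w →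
           ∃ λ r → length r ≡ suc t × InducedPath (w ∷ r) × (∀ {x} → x ∈ˡ r → x ∈ B)
             × (∀ {x y} → x ∈ˡ r → x ≢ u → x ~ y → y ∈ B ⊎ y ∈ D)
  extend {B = B} L {u} {w} u∈B w∉B w∉D u~w with L u∈B w∉B w∉D u~w
  ... | r , refl , path , r⊆B , closed =
    u ∷ r , refl , cons (~-sym u~w) w≁ w∉ path , ur⊆B , closed′
    where
    ur⊆B : ∀ {x} → x ∈ˡ u ∷ r → x ∈ B
    ur⊆B (here refl) = u∈B
    ur⊆B (there x∈)  = r⊆B x∈

    w∉ : w ∉ˡ u ∷ r
    w∉ w∈ = w∉B (ur⊆B w∈)

    w≁ : ∀ {x} → x ∈ˡ r → ¬ w ~ x
    w≁ x∈ w~x = [ w∉B , w∉D ]′ (closed x∈ (~-sym w~x))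

    closed′ : ∀ {x y} → x ∈ˡ u ∷ r → x ≢ u → x ~ y → _
    closed′ (here refl) x≢u _ = contradiction refl x≢u
    closed′ (there x∈) _ x~y  = closed x∈ x~y

  -- A burning `u` next to a free `w` must have caught fire in this very round: had it burned
  -- before, `w` would burn by now. So `u` prolongs a path of the previous round, and the vertices
  -- of that path have now set all their undefended neighbours on fire.
  Layered-step : ∀ {t D B} v → Layered t D B → Layered (suc t) (D ∪ ⁅ v ⁆) (spread G (D ∪ ⁅ v ⁆) B)
  Layered-step {t} {D} {B} v L {u} {w} u∈ w∉B′ w∉D′ u~w with spread⁻ (D ∪ ⁅ v ⁆) B u∈
  ... | inj₁ u∈B = contradiction (spread-new u∈B u~w w∉D′) w∉B′
  ... | inj₂ (u∉D′ , x , x∈B , x~u) with u ∈? B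
  ...   | yes u∈B = contradiction (spread-new u∈B u~w w∉D′) w∉B′
  ...   | no u∉B with extend L x∈B u∉B (u∉D′ ∘ ∈-∪ˡ) x~u
  ...     | r , eq , path , r⊆B , closed = r , eq , path , p⊆p∪q _ ∘ r⊆B , closed′
    where
    closed′ : ∀ {y z} → y ∈ˡ r → y ~ z → z ∈ spread G (D ∪ ⁅ v ⁆) B ⊎ z ∈ D ∪ ⁅ v ⁆
    closed′ {y} {z} y∈ y~z with z ∈? (D ∪ ⁅ v ⁆)
    ... | yes z∈D′ = inj₂ z∈D′
    ... | no z∉D′  = inj₁ (spread-new (r⊆B y∈) y~z z∉D′)

  -- A further vertex to burn would end an induced path on `t + 2` vertices, which is at least
  -- `2 * ∣ X ∣ + 4` and thus one too many.
  Layered-stable : ∀ {X} → Threshold G (∁ X) → ∀ {t D B} → Layered t D B → 2 * ∣ X ∣ + 2 ≤ t → spread G D B ≡ B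
  Layered-stable {X} th {t} {D} {B} L le = stable λ {u} {w} u∈B u~w w∉D →
    decidable-stable (w ∈? B) λ w∉B → case extend L u∈B w∉B w∉D u~w of λ where
      (r , eq , path , _) → <⇒≱ (too-long eq) (InducedPath-bound th path)
    where
    too-long : ∀ {l} → l ≡ suc t → 2 * ∣ X ∣ + 3 < suc l
    too-long refl = s≤s (subst (_≤ suc t) (sym (+-suc (2 * ∣ X ∣) 2)) (s≤s le))

  -- Exchange arguments

  burnedFrom-⊇ : ∀ D B vs → B ⊆ burnedFrom G D B vs
  burnedFrom-⊇ D B []       x∈ = x∈
  burnedFrom-⊇ D B (v ∷ vs) x∈ = burnedFrom-⊇ _ _ vs (p⊆p∪q _ x∈)

  spread-∪ : ∀ {D B} v → spread G D B ≡ B → spread G (D ∪ ⁅ v ⁆) B ≡ B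
  spread-∪ {D} {B} v eq = stable λ {u} {w} u∈B u~w w∉ → subst (w ∈_) eq (spread-new u∈B u~w (w∉ ∘ ∈-∪ˡ))

  burnedFrom-stable : ∀ {D B} → spread G D B ≡ B → ∀ vs → burnedFrom G D B vs ≡ B
  burnedFrom-stable eq []       = refl
  burnedFrom-stable {D} {B} eq (v ∷ vs) rewrite spread-∪ v eq = burnedFrom-stable (spread-∪ v eq) vs

  -- A stuck fire stays stuck under further defences. This permits padding all valid strategies to
  -- the same length.
  burnedFrom-++ : ∀ {D B vs} → ValidFrom G D B vs → ∀ ws → burnedFrom G D B (vs ++ ws) ≡ burnedFrom G D B vs
  burnedFrom-++ (stop eq)        ws = burnedFrom-stable eq ws
  burnedFrom-++ (defend _ _ val) ws = burnedFrom-++ val ws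

  -- P collects defended vertices at which π need not preserve adjacency.
  burnedFrom-exchange :
    ∀ {π} → (∀ x → π (π x) ≡ x) → ∀ {P : Fin n → Set} →
    (∀ {x w} → ¬ P x → ¬ P w → x ~ w → π x ~ π w) →
    ∀ vs {D B D′ B′} → (∀ {x} → x ∈ B′ → π x ∈ B) → (∀ {x} → x ∈ D → π x ∈ D′ ⊎ x ∈ B) →
    (∀ {x} → P x → x ∈ D′ × x ∉ B′) →
    ∀ {x} → x ∈ burnedFrom G D′ B′ (map π vs) → π x ∈ burnedFrom G D B vs
  burnedFrom-exchange inv adj [] B′→B _ _ x∈ = B′→B x∈
  burnedFrom-exchange {π} inv {P} adj (v ∷ vs) {D} {B} {D′} {B′} B′→B D→D′ P→D′ x∈ =
    burnedFrom-exchange inv adj vs B⁺ D⁺ P⁺ x∈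
    where
    D⁺ : ∀ {x} → x ∈ D ∪ ⁅ v ⁆ → π x ∈ D′ ∪ ⁅ π v ⁆ ⊎ x ∈ spread G (D ∪ ⁅ v ⁆) B
    D⁺ x∈ with ∈-∪-⁅⁆⁻ x∈
    ... | inj₂ refl = inj₁ (∈-∪-new _)
    ... | inj₁ x∈D with D→D′ x∈D
    ...   | inj₁ πx∈ = inj₁ (∈-∪ˡ πx∈)
    ...   | inj₂ x∈B = inj₂ (p⊆p∪q _ x∈B)

    P⁺ : ∀ {x} → P x → x ∈ D′ ∪ ⁅ π v ⁆ × x ∉ spread G (D′ ∪ ⁅ π v ⁆) B′
    P⁺ Px with P→D′ Px
    ... | x∈D′ , x∉B′ = ∈-∪ˡ x∈D′ , λ x∈ → [ x∉B′ , (λ (x∉ , _) → x∉ (∈-∪ˡ x∈D′)) ]′ (spread⁻ _ B′ x∈)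

    B⁺ : ∀ {x} → x ∈ spread G (D′ ∪ ⁅ π v ⁆) B′ → π x ∈ spread G (D ∪ ⁅ v ⁆) B
    B⁺ {x} x∈ with spread⁻ _ B′ x∈
    ... | inj₁ x∈B′ = p⊆p∪q _ (B′→B x∈B′)
    ... | inj₂ (x∉D′ , u , u∈B′ , u~x) with π x ∈? (D ∪ ⁅ v ⁆)
    ...   | no πx∉ = spread-new (B′→B u∈B′) (adj (λ Pu → proj₂ (P→D′ Pu) u∈B′)
                       (λ Px → x∉D′ (∈-∪ˡ (proj₁ (P→D′ Px)))) u~x) πx∉
    -- A defence of `π x` is mirrored by a defence of `x`, which then could not have caught fire.
    -- The only exception is a wasted defence of a vertex `π x` that burns anyway.
    ...   | yes πx∈ with ∈-∪-⁅⁆⁻ πx∈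
    ...     | inj₂ refl = contradiction (subst (_∈ D′ ∪ ⁅ π (π x) ⁆) (inv x) (∈-∪-new _)) x∉D′
    ...     | inj₁ πx∈D with D→D′ πx∈D
    ...       | inj₁ ππx∈ = contradiction (∈-∪ˡ (subst (_∈ D′) (inv x) ππx∈)) x∉D′
    ...       | inj₂ πx∈B = p⊆p∪q _ πx∈B

  Dominates : Fin n → Fin n → Set
  Dominates p v = ∀ {w} → w ≢ p → v ~ w → p ~ w

  -- Domination is one-sided: the edges of `v` may be moved to `p`, but those of `p` need not
  -- survive a move to `v`.
  transpose-~ : ∀ {p v} → Dominates p v → ∀ {x w} → x ≢ p → w ≢ p → x ~ w → transpose v p x ~ transpose v p w
  transpose-~ {p} {v} dom {x} {w} x≢p w≢p x~w with transpose-view v p x | transpose-view v p w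
  ... | inj₁ (refl , _)            | inj₁ (refl , _) = contradiction refl (~⇒≢ x~w)
  ... | inj₁ (refl , e)            | inj₂ (inj₂ (_ , _ , e′)) rewrite e | e′ = dom w≢p x~w
  ... | inj₂ (inj₂ (_ , _ , e))    | inj₁ (refl , e′) rewrite e | e′ = ~-sym (dom x≢p (~-sym x~w))
  ... | inj₂ (inj₂ (_ , _ , e))    | inj₂ (inj₂ (_ , _ , e′)) rewrite e | e′ = x~w
  ... | inj₂ (inj₁ (_ , x≡p , _))  | _ = contradiction x≡p x≢p
  ... | inj₁ _                     | inj₂ (inj₁ (_ , w≡p , _)) = contradiction w≡p w≢p
  ... | inj₂ (inj₂ _)              | inj₂ (inj₁ (_ , w≡p , _)) = contradiction w≡p w≢p

  -- The transposition maps the fire of the changed strategy injectively into that of the original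
  -- one. The round of the swap is treated by hand, since `burnedFrom-exchange` wants `p` defended
  -- from the outset. Until then `v` and `p` are free, so the transposition fixes all burning and
  -- defended vertices.
  exchange-dominating : ∀ {D B p v} → p ∉ D → p ∉ B → v ∉ D → v ∉ B → Dominates p v → ∀ vs →
    ∣ burnedFrom G D B (p ∷ map (transpose v p) vs) ∣ ≤ ∣ burnedFrom G D B (v ∷ vs) ∣
  exchange-dominating {D} {B} {p} {v} p∉D p∉B v∉D v∉B dom vs =
    ∣∣-mono-injective π (involutive⇒injective π inv)
      (burnedFrom-exchange inv {_≡ p} (λ x≢p w≢p → transpose-~ dom x≢p w≢p) vs B⁺ D⁺ P⁺)
    where
    π = transpose v p

    inv = transpose-involutive v p

    fixes : ∀ {x} → x ∈ D ⊎ x ∈ B → π x ≡ x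
    fixes (inj₁ x∈D) = transpose-fixes (λ { refl → v∉D x∈D }) (λ { refl → p∉D x∈D })
    fixes (inj₂ x∈B) = transpose-fixes (λ { refl → v∉B x∈B }) (λ { refl → p∉B x∈B })

    D⁺ : ∀ {x} → x ∈ D ∪ ⁅ v ⁆ → π x ∈ D ∪ ⁅ p ⁆ ⊎ x ∈ spread G (D ∪ ⁅ v ⁆) B
    D⁺ x∈ with ∈-∪-⁅⁆⁻ x∈
    ... | inj₁ x∈D  = inj₁ (∈-∪ˡ (subst (_∈ D) (sym (fixes (inj₁ x∈D))) x∈D))
    ... | inj₂ refl = inj₁ (subst (_∈ D ∪ ⁅ p ⁆) (sym (transpose-left v p)) (∈-∪-new p))

    P⁺ : ∀ {x} → x ≡ p → x ∈ D ∪ ⁅ p ⁆ × x ∉ spread G (D ∪ ⁅ p ⁆) B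
    P⁺ refl = ∈-∪-new p , λ p∈ → [ p∉B , (λ (p∉ , _) → p∉ (∈-∪-new p)) ]′ (spread⁻ _ B p∈)

    B⁺ : ∀ {x} → x ∈ spread G (D ∪ ⁅ p ⁆) B → π x ∈ spread G (D ∪ ⁅ v ⁆) B
    B⁺ {x} x∈ with spread⁻ _ B x∈
    ... | inj₁ x∈B = p⊆p∪q _ (subst (_∈ B) (sym (fixes (inj₂ x∈B))) x∈B)
    ... | inj₂ (x∉ , u , u∈B , u~x) = spread-new (subst (_∈ B) (sym (fixes (inj₂ u∈B))) u∈B)
        (transpose-~ dom (λ { refl → p∉B u∈B }) x≢p u~x) πx∉
      where
      x≢p : x ≢ p
      x≢p refl = x∉ (∈-∪-new p)
      πx∉ : π x ∉ D ∪ ⁅ v ⁆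
      πx∉ πx∈ with ∈-∪-⁅⁆⁻ πx∈
      ... | inj₁ πx∈D = x∉ (∈-∪ˡ (subst (_∈ D) (trans (sym (fixes (inj₁ πx∈D))) (inv x)) πx∈D))
      ... | inj₂ πx≡v = x≢p (trans (sym (inv x)) (trans (cong π πx≡v) (transpose-left v p)))

  -- Such wasted moves do arise, since neither padding nor transposing preserves validity. They
  -- achieve nothing, so the pick may take their place with the rest of the strategy unchanged.
  exchange-idle : ∀ {D B p v} → v ∈ D ⊎ v ∈ B → ∀ vs →
    ∣ burnedFrom G D B (p ∷ map id vs) ∣ ≤ ∣ burnedFrom G D B (v ∷ vs) ∣
  exchange-idle {D} {B} {p} {v} idle vs = p⊆q⇒∣p∣≤∣q∣
    (burnedFrom-exchange (λ _ → refl) {λ _ → ⊥′} (λ _ _ x~w → x~w) vs B⁺ D⁺ (λ ()))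
    where
    D⁺ : ∀ {x} → x ∈ D ∪ ⁅ v ⁆ → x ∈ D ∪ ⁅ p ⁆ ⊎ x ∈ spread G (D ∪ ⁅ v ⁆) B
    D⁺ x∈ with ∈-∪-⁅⁆⁻ x∈
    ... | inj₁ x∈D  = inj₁ (∈-∪ˡ x∈D)
    ... | inj₂ refl = [ inj₁ ∘ ∈-∪ˡ , inj₂ ∘ p⊆p∪q _ ]′ idle

    B⁺ : ∀ {x} → x ∈ spread G (D ∪ ⁅ p ⁆) B → x ∈ spread G (D ∪ ⁅ v ⁆) B
    B⁺ {x} x∈ with spread⁻ _ B x∈ | x ∈? (D ∪ ⁅ v ⁆)
    ... | inj₁ x∈B | _ = p⊆p∪q _ x∈B
    ... | inj₂ (x∉ , u , u∈B , u~x) | no x∉′ = spread-new u∈B u~x x∉′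
    ... | inj₂ (x∉ , _) | yes x∈′ with ∈-∪-⁅⁆⁻ x∈′
    ...   | inj₁ x∈D  = contradiction (∈-∪ˡ x∈D) x∉
    ...   | inj₂ refl = [ (λ v∈D → contradiction (∈-∪ˡ v∈D) x∉) , p⊆p∪q _ ]′ idle

  -- Inside `X` the neighbourhoods agree, and outside they are comparable. If the comparison went
  -- the wrong way and `p` missed a neighbour `w` of `v`, then the transposition would map the
  -- neighbours of `p` into those of `v` without hitting `w`, contrary to the degrees. The identity
  -- would not do here, because `v` and `p` may be adjacent.
  degree-dominates : ∀ {X nbrs} → Threshold G (∁ X) → AdjacencyLists G nbrs → ∀ {v p} → v ∉ X → p ∉ X →
    (∀ {x} → x ∈ X → (x ~ v → x ~ p) × (x ~ p → x ~ v)) →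
    length (nbrs v) ≤ length (nbrs p) → Dominates p v
  degree-dominates {X} {nbrs} th adj {v} {p} v∉X p∉X same le {w} w≢p v~w
    with vicinal-total th (x∉p⇒x∈∁p v∉X) (x∉p⇒x∈∁p p∉X) | toSum (w ∈? X)
  ... | _          | inj₁ w∈X = ~-sym (proj₁ (same w∈X) (~-sym v~w))
  ... | inj₁ below | inj₂ w∉X = below (x∉p⇒x∈∁p w∉X) w≢p v~w
  ... | inj₂ above | inj₂ _   = decidable-stable (p ~? w) λ p≁w → <⇒≱ (longer p≁w) le
    where
    π = transpose v p

    into : ∀ {x} → x ∈ˡ nbrs p → π x ∈ˡ nbrs v
    into {x} x∈ with to (proj₂ (adj p) x) x∈ | transpose-view v p x
    ... | p~x | inj₁ (refl , e) rewrite e = from (proj₂ (adj v) p) (~-sym p~x)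
    ... | p~x | inj₂ (inj₁ (_ , x≡p , _)) = contradiction (sym x≡p) (~⇒≢ p~x)
    ... | p~x | inj₂ (inj₂ (x≢v , _ , e)) rewrite e with toSum (x ∈? X)
    ...   | inj₁ x∈X = from (proj₂ (adj v) x) (~-sym (proj₂ (same x∈X) (~-sym p~x)))
    ...   | inj₂ x∉X = from (proj₂ (adj v) x) (above (x∉p⇒x∈∁p x∉X) x≢v p~x)

    missed : ¬ p ~ w → w ∉ˡ map π (nbrs p)
    missed p≁w w∈ with ∈-map⁻ π w∈
    ... | x , x∈ , refl with transpose-view v p x
    ...   | inj₁ (_ , e)            = w≢p e
    ...   | inj₂ (inj₁ (_ , _ , e)) = ~⇒≢ v~w (sym e)
    ...   | inj₂ (inj₂ (_ , _ , e)) = p≁w (subst (p ~_) (sym e) (to (proj₂ (adj p) x) x∈))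

    sub : ∀ {x} → x ∈ˡ w ∷ map π (nbrs p) → x ∈ˡ nbrs v
    sub (here refl) = from (proj₂ (adj v) w) v~w
    sub (there x∈) with ∈-map⁻ π x∈
    ... | _ , y∈ , refl = into y∈

    longer : ¬ p ~ w → length (nbrs p) < length (nbrs v)
    longer p≁w = subst (_≤ length (nbrs v)) (cong suc (length-map π (nbrs p)))
      (length-mono (¬Any⇒All¬ _ (missed p≁w) ∷ Unique.map⁺ (involutive⇒injective π (transpose-involutive v p))
          (proj₁ (adj p))) sub)

  -- Choice of a vertex within a class, and sufficiency of guessing classes

  module _ (κ deg : Fin n → ℕ) where

    Free : (D B : Subset n) → Fin n → Set
    Free D B v = v ∉ B × v ∉ D

    -- The second summand is 1 + n if κ v = g, and 0 otherwise.
    score : ℕ → Fin n → ℕ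
    score g v = suc (deg v) + (1 ∸ ((κ v ∸ g) + (g ∸ κ v))) * suc n

    -- Ties go to the least vertex. This makes the choice unique, so the vertex found by the program
    -- is the one for which the exchange argument is made.
    record Pick (D B : Subset n) (g : ℕ) (i : ℕ) (p : Fin n) : Set where
      field
        free    : Free D B p
        below   : toℕ p < i
        maximal : ∀ {v} → toℕ v < i → Free D B v → score g v ≤ score g p
        first   : ∀ {v} → toℕ v < toℕ p → Free D B v → score g v < score g p

    open Pick

    Pick-unique : ∀ {D B g i p q} → Pick D B g i p → Pick D B g i q → p ≡ q
    Pick-unique {p = p} {q} P Q with <-cmp (toℕ p) (toℕ q)
    ... | tri< p<q _ _ = contradiction (maximal P (below Q) (free Q)) (<⇒≱ (first Q p<q (free P)))
    ... | tri≈ _ p≡q _ = toℕ-injective p≡q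
    ... | tri> _ _ q<p = contradiction (maximal Q (below P) (free P)) (<⇒≱ (first P q<p (free Q)))

    -- The candidate q with score b after the vertices below i have been
    -- inspected; b = 0 if there is none yet.
    Scan : (D B : Subset n) (g i b q : ℕ) → Set
    Scan D B g i b q = (b ≡ 0 × ∀ {v} → toℕ v < i → ¬ Free D B v)
                     ⊎ ∃ λ p → q ≡ toℕ p × b ≡ score g p × Pick D B g i p

    m<1+n⇒m<n⊎ : ∀ {v w : Fin n} → toℕ v < suc (toℕ w) → toℕ v < toℕ w ⊎ v ≡ w
    m<1+n⇒m<n⊎ lt with m<1+n⇒m<n∨m≡n lt
    ... | inj₁ v<w = inj₁ v<w
    ... | inj₂ v≡w = inj₂ (toℕ-injective v≡w)

    Scan-skip : ∀ {D B g b q} w → ¬ Free D B w → Scan D B g (toℕ w) b q → Scan D B g (suc (toℕ w)) b q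
    Scan-skip w ¬fr (inj₁ (b≡0 , none)) =
      inj₁ (b≡0 , λ lt fr → [ (λ v<w → none v<w fr) , (λ { refl → ¬fr fr }) ]′ (m<1+n⇒m<n⊎ lt))
    Scan-skip w ¬fr (inj₂ (p , q≡ , b≡ , P)) = inj₂ (p , q≡ , b≡ , record
      { free = free P ; below = m<n⇒m<1+n (below P) ; first = first P
      ; maximal = λ lt fr → [ (λ v<w → maximal P v<w fr) , (λ { refl → contradiction fr ¬fr }) ]′ (m<1+n⇒m<n⊎ lt) })

    Scan-keep : ∀ {D B g b q} w → ¬ b < score g w → Scan D B g (toℕ w) b q → Scan D B g (suc (toℕ w)) b q
    -- Scores start at 1, so the initial value 0 is beaten by the first free vertex.
    Scan-keep w b≮ (inj₁ (refl , none)) = contradiction (s≤s z≤n) b≮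
    Scan-keep w b≮ (inj₂ (p , q≡ , refl , P)) = inj₂ (p , q≡ , refl , record
      { free = free P ; below = m<n⇒m<1+n (below P) ; first = first P
      ; maximal = λ lt fr → [ (λ v<w → maximal P v<w fr) , (λ { refl → ≮⇒≥ b≮ }) ]′ (m<1+n⇒m<n⊎ lt) })

    Scan-take : ∀ {D B g b q} w → Free D B w → b < score g w → Scan D B g (toℕ w) b q →
                Scan D B g (suc (toℕ w)) (score g w) (toℕ w)
    Scan-take w fr-w b< (inj₁ (refl , none)) = inj₂ (w , refl , refl , record
      { free = fr-w ; below = n<1+n _
      ; first = λ lt fr → contradiction fr (none lt)
      ; maximal = λ lt fr → [ (λ v<w → contradiction fr (none v<w)) , (λ { refl → ≤-refl }) ]′ (m<1+n⇒m<n⊎ lt) })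
    Scan-take w fr-w b< (inj₂ (p , q≡ , refl , P)) = inj₂ (w , refl , refl , record
      { free = fr-w ; below = n<1+n _
      ; first = λ lt fr → ≤-<-trans (maximal P lt fr) b<
      ; maximal = λ lt fr → [ (λ v<w → ≤-trans (maximal P v<w fr) (<⇒≤ b<)) , (λ { refl → ≤-refl }) ]′ (m<1+n⇒m<n⊎ lt) })

    -- Existence of a best vertex is obtained by performing the scan of the program within the
    -- proof.
    Scan-complete : ∀ D B g i → i ≤ n → ∃ λ b → ∃ λ q → Scan D B g i b q
    Scan-complete D B g zero    _   = 0 , 0 , inj₁ (refl , λ ())
    Scan-complete D B g (suc i) i<n with Scan-complete D B g i (<⇒≤ i<n)
    ... | b , q , S with fromℕ< i<n | toℕ-fromℕ< i<n
    ...   | w | refl with w ∈? B | w ∈? D | b <? score g w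
    ...     | yes w∈B | _       | _      = b , q , Scan-skip w (λ (w∉B , _) → w∉B w∈B) S
    ...     | no _    | yes w∈D | _      = b , q , Scan-skip w (λ (_ , w∉D) → w∉D w∈D) S
    ...     | no w∉B  | no w∉D  | yes b< = _ , _ , Scan-take w (w∉B , w∉D) b< S
    ...     | no _    | no _    | no b≮  = b , q , Scan-keep w b≮ S

    Scan⇒Pick : ∀ {D B g b q} → spread G D B ≢ B → Scan D B g n b q → ∃ λ p → q ≡ toℕ p × Pick D B g n p
    Scan⇒Pick ≢B (inj₁ (_ , none)) with unstable⁻ ≢B
    ... | w , w∉B , w∉D = contradiction (w∉B , w∉D) (none (toℕ<n w))
    Scan⇒Pick ≢B (inj₂ (p , q≡ , _ , P)) = p , q≡ , P

    -- In round i the class g i is tried first; if it has no free vertex, another one is defended.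
    data Play : ℕ → (ℕ → ℕ) → (D B : Subset n) → List (Fin n) → Set where
      stop : ∀ {T g D B} → spread G D B ≡ B → Play T g D B []
      move : ∀ {T g D B p vs} → spread G D B ≢ B → Pick D B (g 0) n p →
             Play T (g ∘ suc) (D ∪ ⁅ p ⁆) (spread G (D ∪ ⁅ p ⁆) B) vs → Play (suc T) g D B (p ∷ vs)

    Play⇒Valid : ∀ {T g D B vs} → Play T g D B vs → ValidFrom G D B vs
    Play⇒Valid (stop eq)       = stop eq
    Play⇒Valid (move ≢B pick play) = defend ≢B (proj₁ (free pick)) (Play⇒Valid play)

    Play-cong : ∀ {T g h D B vs} → (∀ i → i < T → g i ≡ h i) → Play T g D B vs → Play T h D B vs
    Play-cong eq (stop e) = stop e
    Play-cong eq (move {D = D} {B} ≢B pick play) =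
      move ≢B (subst (λ x → Pick D B x n _) (eq 0 (s≤s z≤n)) pick) (Play-cong (λ i i<T → eq (suc i) (s≤s i<T)) play)

    score-≡ : ∀ {g v} → κ v ≡ g → score g v ≡ suc (deg v) + suc n
    score-≡ {v = v} refl rewrite n∸n≡0 (κ v) = cong (suc (deg v) +_) (*-identityˡ (suc n))

    score-≢ : ∀ {g v} → κ v ≢ g → score g v ≡ suc (deg v)
    score-≢ {g} {v} κv≢g with (κ v ∸ g) + (g ∸ κ v) in eq
    ... | suc m = cong suc (trans (cong (λ z → deg v + z * suc n) (0∸n≡0 m)) (+-identityʳ _))
    ... | zero = contradiction (≤-antisym (m∸n≡0⇒m≤n (m+n≡0⇒m≡0 _ eq)) (m∸n≡0⇒m≤n (m+n≡0⇒n≡0 (κ v ∸ g) eq))) κv≢g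

    -- The bonus `1 + n` is as large as the best score outside the class, and a vertex of the class
    -- has a positive base score on top of it. Within the class the bonus cancels and the degrees
    -- decide.
    Pick-class : (∀ v → deg v ≤ n) → ∀ {D B v p} → Free D B v → Pick D B (κ v) n p → κ v ≡ κ p × deg v ≤ deg p
    Pick-class deg≤ {v = v} {p} fr P with maximal P (toℕ<n v) fr | κ p ≟ κ v
    ... | le | yes eq = sym eq , +-cancelʳ-≤ _ _ _ (s≤s⁻¹ (subst₂ _≤_ (score-≡ {v = v} refl) (score-≡ eq) le))
    ... | le | no ≢ = contradiction (subst₂ _≤_ (score-≡ {v = v} refl) (score-≢ ≢) le)
                       (<⇒≱ (s≤s (≤-trans (s≤s (deg≤ p)) (m≤n+m (suc n) (deg v)))))

    module _ {c T₀ : ℕ} (κ<c : ∀ v → κ v < c) (deg≤ : ∀ v → deg v ≤ n)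
             (dominates : ∀ {v p} → κ v ≡ κ p → deg v ≤ deg p → v ≢ p → Dominates p v)
             (stable-at : ∀ {t D B} → Layered t D B → T₀ ≤ t → spread G D B ≡ B) where

      improve : ∀ {D B p v vs} → Pick D B (κ v) n p →
                ∃ λ us → length us ≡ length vs × ∣ burnedFrom G D B (p ∷ us) ∣ ≤ ∣ burnedFrom G D B (v ∷ vs) ∣
      improve {D} {B} {p} {v} {vs} P with v ∈? D | v ∈? B
      ... | yes v∈D | _ = map id vs , length-map id vs , exchange-idle (inj₁ v∈D) vs
      ... | no _ | yes v∈B = map id vs , length-map id vs , exchange-idle (inj₂ v∈B) vs
      ... | no v∉D | no v∉B with Pick-class deg≤ (v∉B , v∉D) P
      ...   | same , le with v ≟ᶠ p
      ...     | yes refl = vs , refl , ≤-refl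
      ...     | no v≢p = map (transpose v p) vs , length-map _ vs ,
                  exchange-dominating (proj₂ (free P)) (proj₁ (free P)) v∉D v∉B (dominates same le v≢p) vs

      -- Here `ws` is any list with one entry per remaining round. Each round guesses the class of
      -- the first entry, puts the pick in its place and goes on with the rest as rewritten by
      -- `improve`. The conclusion covers all plays of `g`, so that it applies to the one simulated
      -- by the program.
      follow : ∀ T {t D B} → Layered t D B → T + t ≡ T₀ → Fin n → ∀ ws → length ws ≡ T →
               ∃ λ g → (∀ i → g i < c) ×
                 ∀ {S} → Play T g D B S → ∣ burnedFrom G D B S ∣ ≤ ∣ burnedFrom G D B ws ∣
      follow T {D = D} {B} L _ s ws _ with ≡-dec _≟ᵇ_ (spread G D B) B
      -- The process is over and no further class is read; `κ s` is just some number below `c`.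
      ... | yes eq = (λ _ → κ s) , (λ _ → κ<c s) , λ where
              (stop _) → p⊆q⇒∣p∣≤∣q∣ (burnedFrom-⊇ D B ws)
              (move ≢B _ _) → contradiction eq ≢B
      follow zero L refl s _ _ | no ≢B = contradiction (stable-at L ≤-refl) ≢B
      follow (suc T) {t} {D} {B} L eq s (v ∷ vs) len | no ≢B =
        g , bounded , λ where
          (stop e) → contradiction e ≢B
          (move _ P′ play) → case Pick-unique P P′ of λ where
            refl → ≤-trans (proj₂ (proj₂ rest) play) better
        where
        pick = Scan⇒Pick ≢B (proj₂ (proj₂ (Scan-complete D B (κ v) n ≤-refl)))
        p = proj₁ pick
        P = proj₂ (proj₂ pick)

        replacement = improve {vs = vs} P

        better = proj₂ (proj₂ replacement)

        rest = follow T (Layered-step p L) (trans (+-suc T t) eq) s (proj₁ replacement)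
          (trans (proj₁ (proj₂ replacement)) (suc-injective len))

        g : ℕ → ℕ
        g zero    = κ v
        g (suc i) = proj₁ rest i

        bounded : ∀ i → g i < c
        bounded zero    = κ<c v
        bounded (suc i) = proj₁ (proj₂ rest) i

      Valid-length : ∀ {t D B ws} → Layered t D B → ValidFrom G D B ws → t ≤ T₀ → t + length ws ≤ T₀
      Valid-length {t} L (stop _) le = subst (_≤ T₀) (sym (+-identityʳ t)) le
      Valid-length {t} L (defend {v} {vs} ≢B _ val) le = subst (_≤ T₀) (sym (+-suc t (length vs)))
        (Valid-length (Layered-step v L) val (≰⇒> λ T₀≤t → ≢B (stable-at L T₀≤t)))

      classes-suffice : ∀ s ws → Valid G s ws → ∃ λ g → (∀ i → g i < c) ×
        ∀ {S} → Play T₀ g ⊥ ⁅ s ⁆ S → ∣ burnedFrom G ⊥ ⁅ s ⁆ S ∣ ≤ ∣ burnedFrom G ⊥ ⁅ s ⁆ ws ∣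
      -- The padding defends `s` again and again, after the fire has stopped.
      classes-suffice s ws val with follow T₀ (Layered-init s) (+-identityʳ T₀) s (ws ++ replicate (T₀ ∸ length ws) s)
        (trans (length-++ ws) (trans (cong (length ws +_) (length-replicate (T₀ ∸ length ws)))
          (m+[n∸m]≡n (Valid-length (Layered-init s) val z≤n))))
      ... | g , g<c , best = g , g<c , λ {S} play → subst (∣ burnedFrom G ⊥ ⁅ s ⁆ S ∣ ≤_)
              (cong ∣_∣ (burnedFrom-++ val (replicate (T₀ ∸ length ws) s))) (best play)

-- Reasoning about the word RAM

update-≡ : {A : Set} (f : ℕ → A) (i : ℕ) {a : A} → update f i a i ≡ a
update-≡ f i with i ≡ᵇ i | ≡⇒≡ᵇ i i refl
... | true | _ = refl

update-≢ : {A : Set} (f : ℕ → A) {i j : ℕ} {a : A} → i ≢ j → update f i a j ≡ f j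
update-≢ f {i} {j} i≢j with i ≡ᵇ j in eq
... | false = refl
... | true  = contradiction (≡ᵇ⇒≡ i j (subst T (sym eq) tt)) i≢j

writesReg : Program → ℕ → Bool
writesReg skip                   r = false
writesReg (r′ ≔ _)               r = r′ ≡ᵇ r
writesReg (_ ⟦ _ ⟧≔ _)           r = false
writesReg (p ⨾ q)                r = writesReg p r ∨ writesReg q r
writesReg (cond _ then p else q) r = writesReg p r ∨ writesReg q r
writesReg (while _ loop p)       r = writesReg p r

writesArr : Program → ℕ → Bool
writesArr skip                   a = false
writesArr (_ ≔ _)                a = false
writesArr (a′ ⟦ _ ⟧≔ _)          a = a′ ≡ᵇ a
writesArr (p ⨾ q)                a = writesArr p a ∨ writesArr q a
writesArr (cond _ then p else q) a = writesArr p a ∨ writesArr q a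
writesArr (while _ loop p)       a = writesArr p a

-- For a concrete program and index the hidden premise computes to the unit type and is filled in
-- silently, so that preservation of a register or an array is a mere projection.
record Frame (p : Program) (σ τ : Store) : Set where
  field
    reg= : ∀ r {_ : T (not (writesReg p r))} → regs τ r ≡ regs σ r
    arr= : ∀ a {_ : T (not (writesArr p a))} → arrs τ a ≡ arrs σ a

open Frame public

not-∨ˡ : ∀ {a b} → T (not (a ∨ b)) → T (not a)
not-∨ˡ {false} _ = tt

not-∨ʳ : ∀ {a b} → T (not (a ∨ b)) → T (not b)
not-∨ʳ {false} h = h

update-kept : {A : Set} (f : ℕ → A) (i j : ℕ) {a : A} → T (not (i ≡ᵇ j)) → update f i a j ≡ f j
update-kept f i j h with i ≡ᵇ j
... | false = refl

frame : ∀ {W p σ τ t} → W ⊢ p , σ ⇓ τ , t → Frame p σ τ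
frame skip = record { reg= = λ _ → refl ; arr= = λ _ → refl }
frame {σ = σ} (assign {r = r′} _) = record { reg= = λ r {h} → update-kept (regs σ) r′ r h ; arr= = λ _ → refl }
frame {σ = σ} (write {a = a′} _ _) = record { reg= = λ _ → refl ; arr= = λ a {h} → update-kept (arrs σ) a′ a h }
frame (seq x y) = record
  { reg= = λ r {h} → trans (reg= (frame y) r {not-∨ʳ h}) (reg= (frame x) r {not-∨ˡ h})
  ; arr= = λ a {h} → trans (arr= (frame y) a {not-∨ʳ h}) (arr= (frame x) a {not-∨ˡ h}) }
frame (if-true _ x) = record
  { reg= = λ r {h} → reg= (frame x) r {not-∨ˡ h} ; arr= = λ a {h} → arr= (frame x) a {not-∨ˡ h} }
frame (if-false _ y) = record
  { reg= = λ r {h} → reg= (frame y) r {not-∨ʳ h} ; arr= = λ a {h} → arr= (frame y) a {not-∨ʳ h} }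
frame (while-true _ x y) = record
  { reg= = λ r {h} → trans (reg= (frame y) r {h}) (reg= (frame x) r {h})
  ; arr= = λ a {h} → trans (arr= (frame y) a {h}) (arr= (frame x) a {h}) }
frame (while-false _) = record { reg= = λ _ → refl ; arr= = λ _ → refl }

Frame-trans : ∀ {p σ τ υ} → Frame p σ τ → Frame p τ υ → Frame p σ υ
Frame-trans f g = record
  { reg= = λ r {h} → trans (reg= g r {h}) (reg= f r {h}) ; arr= = λ a {h} → trans (arr= g a {h}) (arr= f a {h}) }

Frame-refl : ∀ {p σ} → Frame p σ σ
Frame-refl = record { reg= = λ _ → refl ; arr= = λ _ → refl }

-- A frame depends only on what is written to, so `lit 0` stands for any expression.
setReg-frame : ∀ {σ} r {x} → Frame (r ≔ lit 0) σ (setReg σ r x)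
setReg-frame {σ} r = record { reg= = λ s {h} → update-kept (regs σ) r s h ; arr= = λ _ → refl }

⊏⇒< : ∀ {a b} → (if a <ᵇ b then 1 else 0) ≢ 0 → a < b
⊏⇒< {a} {b} h with a <ᵇ b in eq
... | true  = <ᵇ⇒< a b (subst T (sym eq) tt)
... | false = contradiction refl h

⊏⇒≥ : ∀ {a b} → (if a <ᵇ b then 1 else 0) ≡ 0 → b ≤ a
⊏⇒≥ {a} {b} h with a <ᵇ b in eq
... | false = ≮⇒≥ λ lt → subst T eq (<⇒<ᵇ lt)

infix 6 for_below_loop_
for_below_loop_ : ℕ → ℕ → Program → Program
for r below b loop p = r ≔ lit 0 ⨾ while reg r ⊏ reg b loop (p ⨾ r ≔ reg r ⊕ lit 1)

-- Run W U p σ a Q: from σ, the program p halts within U * a units of time in a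
-- store satisfying Q.
record Run (W U : ℕ) (p : Program) (σ : Store) (a : ℕ) (Q : Store → Set) : Set where
  no-eta-equality
  pattern
  constructor run
  field
    {final}   : Store
    {elapsed} : ℕ
    execution : W ⊢ p , σ ⇓ final , elapsed
    timely    : elapsed ≤ U * a
    outcome   : Q final

module _ {W : ℕ} where

  weaken : ∀ {U p σ a b Q R} → a ≤ b → (∀ {τ} → Frame p σ τ → Q τ → R τ) → Run W U p σ a Q → Run W U p σ b R
  weaken {U} a≤b Q⇒R (run e t≤ q) = run e (≤-trans t≤ (*-monoʳ-≤ U a≤b)) (Q⇒R (frame e) q)

  rescale : ∀ {U V p σ a Q} → U ≤ V → Run W U p σ a Q → Run W V p σ a Q
  rescale {a = a} U≤V (run e t≤ q) = run e (≤-trans t≤ (*-monoˡ-≤ a U≤V)) q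

  run-skip : ∀ {U σ} {Q : Store → Set} .{{_ : NonZero U}} → Q σ → Run W U skip σ 1 Q
  run-skip {U} q = run skip (m≤n*m 1 U) q

  run-≔ : ∀ {U r e σ} {Q : Store → Set} .{{_ : NonZero U}} → eval σ e < W → Q (setReg σ r (eval σ e)) →
          Run W U (r ≔ e) σ (suc (cost e)) Q
  run-≔ {U} lt q = run (assign lt) (m≤n*m _ U) q

  run-⟦⟧≔ : ∀ {U a e f σ} {Q : Store → Set} .{{_ : NonZero U}} → eval σ e < W → eval σ f < W →
            Q (setArr σ a (eval σ e) (eval σ f)) → Run W U (a ⟦ e ⟧≔ f) σ (suc (cost e + cost f)) Q
  run-⟦⟧≔ {U} lt lt′ q = run (write lt lt′) (m≤n*m _ U) q

  infixr 5 _⟫_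
  _⟫_ : ∀ {U p q σ a b Q R} → Run W U p σ a Q → (∀ {τ} → Frame p σ τ → Q τ → Run W U q τ b R) →
        Run W U (p ⨾ q) σ (a + b) R
  _⟫_ {U} {a = a} {b} (run e t≤ q) k with k (frame e) q
  ... | run e′ t′≤ r = run (seq e e′) (≤-trans (+-mono-≤ t≤ t′≤) (≤-reflexive (sym (*-distribˡ-+ U a b)))) r

  run-≔⨾ : ∀ {U r e q σ b R} .{{_ : NonZero U}} → eval σ e < W → Run W U q (setReg σ r (eval σ e)) b R →
           Run W U (r ≔ e ⨾ q) σ (suc (cost e) + b) R
  run-≔⨾ {U} {e = e} {b = b} lt (run x t≤ r) =
    run (seq (assign lt) x) (≤-trans (+-mono-≤ (m≤n*m _ U) t≤) (≤-reflexive (sym (*-distribˡ-+ U (suc (cost e)) b)))) r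

  run-⟦⟧≔⨾ : ∀ {U a e f q σ b R} .{{_ : NonZero U}} → eval σ e < W → eval σ f < W →
             Run W U q (setArr σ a (eval σ e) (eval σ f)) b R →
             Run W U (a ⟦ e ⟧≔ f ⨾ q) σ (suc (cost e + cost f) + b) R
  run-⟦⟧≔⨾ {U} {e = e} {f} {b = b} lt lt′ (run x t≤ r) =
    run (seq (write lt lt′) x) (≤-trans (+-mono-≤ (m≤n*m _ U) t≤)
        (≤-reflexive (sym (*-distribˡ-+ U (suc (cost e + cost f)) b)))) r

  run-cond : ∀ {U e p q σ a b Q} .{{_ : NonZero U}} → (eval σ e ≢ 0 → Run W U p σ a Q) → (eval σ e ≡ 0 → Run W U q σ b Q) →
             Run W U (cond e then p else q) σ (suc (cost e) + (a + b)) Q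
  run-cond {U} {e} {σ = σ} {a} {b} yes! no! with eval σ e ≟ 0
  ... | yes z = case no! z of λ where
    (run x t≤ q) → run (if-false z x) (≤-trans (+-mono-≤ (m≤n*m _ U) (≤-trans t≤ (*-monoʳ-≤ U (m≤n+m b a))))
                     (≤-reflexive (sym (*-distribˡ-+ U (suc (cost e)) (a + b))))) q
  ... | no nz = case yes! nz of λ where
    (run x t≤ q) → run (if-true nz x) (≤-trans (+-mono-≤ (m≤n*m _ U) (≤-trans t≤ (*-monoʳ-≤ U (m≤m+n a b))))
                     (≤-reflexive (sym (*-distribˡ-+ U (suc (cost e)) (a + b))))) q

  -- At most `N` passes and the failing last test give the factor `suc N`. It is absorbed by the
  -- scale `V`, which may depend on the input, while the constant `a` remains a numeral read off the
  -- program. Nesting thus multiplies scales but only adds up numerals.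
  run-while : ∀ {U V N e p σ a} .{{_ : NonZero U}} (I : Store → Set) (μ : Store → ℕ) → I σ → μ σ ≤ N → suc N * U ≤ V →
              (∀ {τ} → Frame p σ τ → I τ → eval τ e ≢ 0 → Run W U p τ a (λ υ → I υ × μ υ < μ τ)) →
              Run W V (while e loop p) σ (suc (cost e) + a) (λ τ → I τ × eval τ e ≡ 0)
  run-while {U} {V} {N} {e} {p} {σ} {a} I μ Iσ μσ≤N N≤V body with go N μσ≤N Frame-refl Iσ
    where
    c = suc (cost e) + a

    go : ∀ {τ} M → μ τ ≤ M → Frame p σ τ → I τ →
         ∃ λ υ → ∃ λ t → (W ⊢ while e loop p , τ ⇓ υ , t) × t ≤ suc M * (U * c) × (I υ × eval υ e ≡ 0)
    go {τ} M μ≤ fr Iτ with eval τ e ≟ 0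
    ... | yes z = τ , _ , while-false z , le , Iτ , z
      where
      le : suc (cost e) ≤ suc M * (U * c)
      le = ≤-trans (m≤m+n (suc (cost e)) a) (≤-trans (m≤n*m c U) (m≤m+n (U * c) (M * (U * c))))
    ... | no nz with body fr Iτ nz
    ...   | run {τ′} {t} x t≤ (Iτ′ , dec) with M
    ...     | zero = contradiction (<-≤-trans dec μ≤) λ ()
    ...     | suc M′ with go M′ (s≤s⁻¹ (<-≤-trans dec μ≤)) (Frame-trans fr (frame x)) Iτ′
    ...       | υ , u , y , u≤ , post = υ , _ , while-true nz x y , le , post
      where
      le : suc (cost e + t + u) ≤ suc (suc M′) * (U * c)
      le = +-mono-≤ (≤-trans (+-mono-≤ (m≤n*m (suc (cost e)) U) t≤) (≤-reflexive (sym (*-distribˡ-+ U (suc (cost e)) a)))) u≤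
  ... | υ , t , x , t≤ , post = run x
    (≤-trans t≤ (≤-trans (≤-reflexive (sym (*-assoc (suc N) U _))) (*-monoˡ-≤ (suc (cost e) + a) N≤V))) post

  -- `I i` is stated for the store in which the counter already equals `i`, so it may refer to the
  -- counter. The hidden premises say that the body writes neither the counter nor the bound and
  -- that these differ.
  run-for : ∀ {U V N r b p σ a} .{{_ : NonZero U}} .{{_ : NonZero V}} (I : ℕ → Store → Set) →
            regs σ b ≡ N → N < W → suc N * U ≤ V →
            {_ : T (not (writesReg p r))} {_ : T (not (writesReg p b))} {_ : T (not (r ≡ᵇ b))} →
            I 0 (setReg σ r 0) →
            (∀ {τ i} → Frame (for r below b loop p) σ τ → regs τ r ≡ i → i < N → I i τ →
              Run W U p τ a (λ υ → I (suc i) (setReg υ r (suc i)))) →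
            Run W V (for r below b loop p) σ (2 + (4 + (a + 4))) (I N)
  run-for {U} {V} {N} {r} {b} {p} {σ} {a} I b≡N N<W N≤V {r∉p} {b∉p} {r≢b} start step =
    run-≔⨾ (≤-<-trans z≤n N<W) (weaken ≤-refl exit
      (run-while {a = a + 4} Inv (λ τ → N ∸ regs τ r) (0 , update-≡ (regs σ) r , z≤n , start , update-kept (regs σ) r b r≢b ,
          Frame-refl)
        (m∸n≤m N (regs σ₀ r)) N≤V body))
    where
    σ₀ = setReg σ r 0
    loop = while reg r ⊏ reg b loop (p ⨾ r ≔ reg r ⊕ lit 1)

    Inv : Store → Set
    Inv τ = ∃ λ i → regs τ r ≡ i × i ≤ N × I i τ × regs τ b ≡ regs σ b × Frame loop σ₀ τ

    Frame-for : ∀ {τ} → Frame loop σ₀ τ → Frame (for r below b loop p) σ τ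
    Frame-for fr = record
      { reg= = λ s {h} → trans (reg= fr s {not-∨ʳ {r ≡ᵇ s} h}) (update-kept (regs σ) r s (not-∨ˡ {r ≡ᵇ s} h))
      ; arr= = λ s {h} → arr= fr s {h} }

    exit : ∀ {τ} → Frame loop σ₀ τ → Inv τ × eval τ (reg r ⊏ reg b) ≡ 0 → I N τ
    exit {τ} fr ((i , r≡i , i≤N , Iτ , b≡ , _) , done) =
      subst (λ z → I z τ) (≤-antisym i≤N (subst₂ _≤_ (trans b≡ b≡N) r≡i (⊏⇒≥ done))) Iτ

    body : ∀ {τ} → Frame (p ⨾ r ≔ reg r ⊕ lit 1) σ₀ τ → Inv τ → eval τ (reg r ⊏ reg b) ≢ 0 →
           Run W U (p ⨾ r ≔ reg r ⊕ lit 1) τ (a + 4) (λ υ → Inv υ × N ∸ regs υ r < N ∸ regs τ r)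
    body {τ} _ (i , r≡i , i≤N , Iτ , b≡ , fr) lt with subst₂ _<_ r≡i (trans b≡ b≡N) (⊏⇒< lt)
    ... | i<N = step (Frame-for fr) r≡i i<N Iτ ⟫ λ {υ} fr′ Iυ →
      let r≡ : regs υ r + 1 ≡ suc i
          r≡ = trans (+-comm _ 1) (cong suc (trans (reg= fr′ r {r∉p}) r≡i))
          new : regs (setReg υ r (regs υ r + 1)) r ≡ suc i
          new = trans (update-≡ (regs υ) r) r≡
      in run-≔ (subst (_< W) (sym r≡) (≤-<-trans i<N N<W))
           ( ( suc i , new , i<N , subst (λ z → I (suc i) (setReg υ r z)) (sym r≡) Iυ
             , trans (update-kept (regs υ) r b r≢b) (trans (reg= fr′ b {b∉p}) b≡)
             , Frame-trans fr (record
                 { reg= = λ s {h} → trans (update-kept (regs υ) r s (not-∨ʳ {writesReg p s} h))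
                     (reg= fr′ s {not-∨ˡ {writesReg p s} h})
                 ; arr= = λ s {h} → arr= fr′ s {not-∨ˡ h} }))
           , subst₂ (λ x y → N ∸ x < N ∸ y) (sym new) (sym r≡i) (∸-monoʳ-< (n<1+n i) i<N))

-- Lists of arcs and classes of vertices

#n #s #k #m #T #c #p #i #j #on #best #best-len #len #go #top #pick #score #burnt : ℕ
#n = 0
#s = 1
#k = 2
#m = 3
#T = 4
#c = 5
#p = 6
#i = 7
#j = 8
#on = 9
#best = 10
#best-len = 11
#len = 12
#go = 13
#top = 14
#pick = 15
#score = 16
#burnt = 17

-- $bn, $df and $nb are the indicators of the burning vertices, of the defended vertices and of
-- the neighbours of the fire; $dig is the odometer that runs through all sequences of classes.
$off $adj $xs $src $cls $dig $best $now $bn $df $nb : ℕ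
$off = 0
$adj = 1
$xs = 2
$src = 3
$cls = 4
$dig = 5
$best = 6
$now = 7
$bn = 8
$df = 9
$nb = 10

infix 7 _≐_
-- The two truncated differences vanish together exactly when the operands agree; `score` uses the
-- same formula.
_≐_ : Expr → Expr → Expr
e ≐ f = lit 1 ⊖ ((e ⊖ f) ⊕ (f ⊖ e))

≐⇒≡ : ∀ {a b} → 1 ∸ ((a ∸ b) + (b ∸ a)) ≢ 0 → a ≡ b
≐⇒≡ {a} {b} h with (a ∸ b) + (b ∸ a) in eq
... | zero  = ≤-antisym (m∸n≡0⇒m≤n (m+n≡0⇒m≡0 _ eq)) (m∸n≡0⇒m≤n (m+n≡0⇒n≡0 (a ∸ b) eq))
... | suc m = contradiction (0∸n≡0 m) h

≐⇒≢ : ∀ {a b} → 1 ∸ ((a ∸ b) + (b ∸ a)) ≡ 0 → a ≢ b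
≐⇒≢ {a} h refl rewrite n∸n≡0 a = contradiction h λ ()

-- Every pass of the single loop advances either the vertex or the position, hence `n + M` passes.
-- The rule for loops charges all passes alike, so two nested loops would be charged a product.
list-arcs : Program
list-arcs =
  #m ≔ arr $off (reg #n) ⨾
  #i ≔ lit 0 ⨾
  #j ≔ lit 0 ⨾
  while reg #i ⊏ reg #n loop
    (cond reg #j ⊏ arr $off (reg #i ⊕ lit 1)
     then ($src ⟦ reg #j ⟧≔ reg #i ⨾ #j ≔ reg #j ⊕ lit 1)
     else (#i ≔ reg #i ⊕ lit 1))

-- After round i the class of v is the sum of 2 ^ j over the j ≤ i for which the jth vertex of X is
-- adjacent to v.  As 2 ^ k may not fit into a word, this stops when #p ≥ n; then n ≤ 2 ^ k, and
-- every vertex may have a class of its own.  The test against #p makes a repeated addition harmless.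
classify : Program
classify =
  #p ≔ lit 1 ⨾
  for #i below #k loop
    (cond reg #p ⊏ reg #n
     then (for #j below #m loop
             (cond arr $src (reg #j) ≐ arr $xs (reg #i)
              then (cond arr $cls (arr $adj (reg #j)) ⊏ reg #p
                    then $cls ⟦ arr $adj (reg #j) ⟧≔ (arr $cls (arr $adj (reg #j)) ⊕ reg #p)
                    else skip)
              else skip) ⨾
           #p ≔ reg #p ⊕ reg #p)
     else skip) ⨾
  cond reg #p ⊏ reg #n
  then (#c ≔ reg #p ⊕ reg #k ⨾
        for #i below #k loop ($cls ⟦ arr $xs (reg #i) ⟧≔ (reg #p ⊕ reg #i)))
  else (#c ≔ reg #n ⨾
        for #i below #n loop ($cls ⟦ reg #i ⟧≔ reg #i))

-- Rounds the constant computed by the rules for `Run` up to a convenient numeral; the comparison is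
-- settled by evaluation.
≤-lit : ∀ m n {_ : T (m ≤ᵇ n)} → m ≤ n
≤-lit m n {h} = ≤ᵇ⇒≤ m n h

vertex : ∀ {n i} → i < n → ∃ λ (v : Fin n) → toℕ v ≡ i
vertex i<n = fromℕ< i<n , toℕ-fromℕ< i<n

update-split : ∀ (f : ℕ → ℕ) i x j → (i ≡ j × update f i x j ≡ x) ⊎ (i ≢ j × update f i x j ≡ f j)
update-split f i x j with i ≟ j
... | yes refl = inj₁ (refl , update-≡ f i)
... | no i≢j   = inj₂ (i≢j , update-≢ f i≢j)

-- `L` measures both resources: a pass over the vertices or over the arcs takes time proportional to
-- `L`, and what the program writes stays within `4 * L`.
module Sizes (W n M : ℕ) (big : 4 * (2 + n + M) ≤ W) where

  L : ℕ
  L = suc (n + M)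

  fits : ∀ {x} → x ≤ 4 * L → x < W
  fits le = <-≤-trans (s≤s le) (≤-trans (*-monoʳ-< 4 (n<1+n L)) big)

  n≤L : n ≤ L
  n≤L = ≤-trans (m≤m+n n M) (n≤1+n _)

  ≤n-fits : ∀ {x} → x ≤ n → x < W
  ≤n-fits le = fits (≤-trans le (≤-trans n≤L (m≤n*m L 4)))

  2n-fits : ∀ {x} → x ≤ n + n → x < W
  2n-fits le = fits (≤-trans le (≤-trans (+-mono-≤ n≤L n≤L) (+-monoʳ-≤ L (m≤m+n L _))))

  3n-fits : ∀ {x} → x ≤ n + n + n → x < W
  3n-fits le = fits (≤-trans le (≤-trans (≤-reflexive (+-assoc n n n))
      (+-mono-≤ n≤L (+-mono-≤ n≤L (≤-trans n≤L (m≤m+n L _))))))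

module Arcs (W n M : ℕ) (big : 4 * (2 + n + M) ≤ W)
            (off : ℕ → ℕ) (off-zero : off 0 ≡ 0) (off-end : off n ≡ M)
            (off-mono : ∀ {i j} → i ≤ j → j ≤ n → off i ≤ off j) where

  open Sizes W n M big
  n≤ : n ≤ 4 * L
  n≤ = ≤-trans (≤-trans (m≤m+n n M) (n≤1+n _)) (m≤n*m L 4)

  M≤ : M ≤ 4 * L
  M≤ = ≤-trans (≤-trans (m≤n+m M n) (n≤1+n _)) (m≤n*m L 4)

  Listed : ℕ → (ℕ → ℕ) → Set
  Listed J src = ∀ {j} → j < J → src j < n × off (src j) ≤ j × j < off (suc (src j))

  run-list-arcs : ∀ {σ} → regs σ #n ≡ n → arrs σ $off ≡ off →
                  Run W L list-arcs σ 100 (λ τ → regs τ #m ≡ M × Listed M (arrs τ $src))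
  run-list-arcs {σ} n≡ off≡ = weaken (≤-lit _ 100) (λ _ → id)
    (run-≔⨾ (fits (subst (_≤ 4 * L) (sym m≡) M≤))
    (run-≔⨾ (fits z≤n)
    (run-≔⨾ (fits z≤n)
    (weaken ≤-refl exit (run-while {U = 1} {N = n + M} Inv μ
      (z≤n , ≤-reflexive off-zero , z≤n , λ ()) ≤-refl
      (≤-reflexive (*-identityʳ (suc (n + M)))) body)))))
    where

    m≡ : arrs σ $off (regs σ #n) ≡ M
    m≡ = trans (cong₂ (λ f x → f x) off≡ n≡) off-end

    Inv : Store → Set
    Inv τ = regs τ #i ≤ n × off (regs τ #i) ≤ regs τ #j × regs τ #j ≤ M × Listed (regs τ #j) (arrs τ $src)

    μ : Store → ℕ
    μ τ = (n ∸ regs τ #i) + (M ∸ regs τ #j)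

    σ₀ = setReg (setReg (setReg σ #m (arrs σ $off (regs σ #n))) #i 0) #j 0

    loop-body = cond reg #j ⊏ arr $off (reg #i ⊕ lit 1)
     then ($src ⟦ reg #j ⟧≔ reg #i ⨾ #j ≔ reg #j ⊕ lit 1)
     else (#i ≔ reg #i ⊕ lit 1)

    exit : ∀ {τ} → Frame (while reg #i ⊏ reg #n loop loop-body) σ₀ τ →
           Inv τ × eval τ (reg #i ⊏ reg #n) ≡ 0 → regs τ #m ≡ M × Listed M (arrs τ $src)
    exit {τ} fr ((i≤ , off≤ , j≤ , listed) , done) =
      trans (reg= fr #m) m≡ , subst (λ z → Listed z (arrs τ $src)) j≡M listed
      where
      i≡n : regs τ #i ≡ n
      i≡n = ≤-antisym i≤ (subst (_≤ regs τ #i) (trans (reg= fr #n) n≡) (⊏⇒≥ done))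
      j≡M : regs τ #j ≡ M
      j≡M = ≤-antisym j≤ (subst (_≤ regs τ #j) (trans (cong off i≡n) off-end) off≤)

    body : ∀ {τ} → Frame loop-body σ₀ τ → Inv τ → eval τ (reg #i ⊏ reg #n) ≢ 0 →
           Run W 1 loop-body τ _ (λ υ → Inv υ × μ υ < μ τ)
    body {τ} fr (i≤ , off≤ , j≤ , listed) lt = run-cond
      (λ h → let j<off = subst (regs τ #j <_) off-next (⊏⇒< h)
                 j<M = <-≤-trans j<off (≤-trans (off-mono i<n ≤-refl) (≤-reflexive off-end))
             in run-⟦⟧≔⨾ (fits (≤-trans j≤ M≤)) (fits (≤-trans i≤ n≤))
                (run-≔ (fits (subst (_≤ 4 * L) (+-comm 1 (regs τ #j)) (≤-trans j<M M≤)))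
                 ((i≤ , ≤-trans off≤ (m≤m+n _ 1) , subst (_≤ M) (+-comm 1 (regs τ #j)) j<M , extended j<off) ,
                  +-monoʳ-< (n ∸ regs τ #i) (∸-monoʳ-< {M} (subst (regs τ #j <_) (+-comm 1 _) (n<1+n _))
                      (subst (_≤ M) (+-comm 1 (regs τ #j)) j<M)))))
      (λ h → run-≔ (fits (subst (_≤ 4 * L) (+-comm 1 (regs τ #i)) (≤-trans i<n n≤)))
               ((subst (_≤ n) (+-comm 1 (regs τ #i)) i<n , subst (_≤ regs τ #j)
                   (trans off-next (cong off (+-comm 1 (regs τ #i)))) (⊏⇒≥ h) , j≤ , listed) ,
                +-monoˡ-< (M ∸ regs τ #j) (∸-monoʳ-< {n} (subst (regs τ #i <_) (+-comm 1 _) (n<1+n _))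
                    (subst (_≤ n) (+-comm 1 (regs τ #i)) i<n))))
      where
      i<n : regs τ #i < n
      i<n = subst (regs τ #i <_) (trans (reg= fr #n) n≡) (⊏⇒< lt)

      off-next : arrs τ $off (regs τ #i + 1) ≡ off (suc (regs τ #i))
      off-next = trans (cong-app (trans (arr= fr $off) off≡) _) (cong off (+-comm _ 1))

      extended : regs τ #j < off (suc (regs τ #i)) → Listed (regs τ #j + 1) (update (arrs τ $src) (regs τ #j) (regs τ #i))
      extended j<off {j} j< with update-split (arrs τ $src) (regs τ #j) (regs τ #i) j
      ... | inj₁ (refl , e) rewrite e = i<n , off≤ , j<off
      ... | inj₂ (j≢ , e) rewrite e = listed (≤∧≢⇒< (s≤s⁻¹ (subst (j <_) (+-comm _ 1) j<)) (j≢ ∘ sym))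

record Loaded (n k M : ℕ) (src adj xs : ℕ → ℕ) (σ : Store) : Set where
  field
    n≡   : regs σ #n ≡ n
    k≡   : regs σ #k ≡ k
    m≡   : regs σ #m ≡ M
    src≡ : arrs σ $src ≡ src
    adj≡ : arrs σ $adj ≡ adj
    xs≡  : arrs σ $xs ≡ xs

module Classes (W n M : ℕ) (big : 4 * (2 + n + M) ≤ W) (G : Graph n) (X : Subset n) (k : ℕ) (1≤n : 1 ≤ n) (k≤n : k ≤ n)
               (src adj xs : ℕ → ℕ)
               (arc-sound : ∀ {j} → j < M → ∃ λ u → ∃ λ v → src j ≡ toℕ u × adj j ≡ toℕ v × Graph._~_ G u v)
               (arc-complete : ∀ {u v} → Graph._~_ G u v → ∃ λ j → j < M × src j ≡ toℕ u × adj j ≡ toℕ v)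
               (xs-sound : ∀ {i} → i < k → ∃ λ x → x ∈ X × xs i ≡ toℕ x)
               (xs-complete : ∀ {x} → x ∈ X → ∃ λ i → i < k × xs i ≡ toℕ x) where

  open Graph G renaming (sym to ~-sym)

  open Sizes W n M big
  open Loaded

  keep : ∀ {p σ τ} → Frame p σ τ →
         {_ : T (not (writesReg p #n))} {_ : T (not (writesReg p #k))} {_ : T (not (writesReg p #m))}
         {_ : T (not (writesArr p $src))} {_ : T (not (writesArr p $adj))} {_ : T (not (writesArr p $xs))} →
         Loaded n k M src adj xs σ → Loaded n k M src adj xs τ
  keep fr {a} {b} {c} {d} {e} {f} l = record
    { n≡ = trans (reg= fr #n {a}) (n≡ l) ; k≡ = trans (reg= fr #k {b}) (k≡ l) ; m≡ = trans (reg= fr #m {c}) (m≡ l)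
    ; src≡ = trans (arr= fr $src {d}) (src≡ l) ; adj≡ = trans (arr= fr $adj {e}) (adj≡ l) ; xs≡ = trans (arr= fr $xs {f})
        (xs≡ l) }

  Separates : ℕ → (ℕ → ℕ) → Set
  Separates I cls = ∀ {u v} → cls (toℕ u) ≡ cls (toℕ v) → ∀ {i x} → i < I → xs i ≡ toℕ x → x ~ u → x ~ v

  Bounded : ℕ → (ℕ → ℕ) → Set
  Bounded P cls = ∀ (v : Fin n) → cls (toℕ v) < P

  -- The class numbers in use are below `#p`, which is doubled only while it is below `n` and so
  -- never exceeds `2 n`. Once it reaches `n` these numbers are given up, and nothing is claimed
  -- about them.
  Refined : ℕ → Store → Set
  Refined i τ = 1 ≤ regs τ #p × regs τ #p ≤ 2 ^ i × regs τ #p ≤ n + n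
              × (regs τ #p < n → Bounded (regs τ #p) (arrs τ $cls) × Separates i (arrs τ $cls))

  Marked : Fin n → ℕ → (ℕ → ℕ) → ℕ → (ℕ → ℕ) → Set
  Marked x P old J cls = ∀ v → (cls (toℕ v) ≡ old (toℕ v) × (∀ {j} → j < J → src j ≡ toℕ x → adj j ≢ toℕ v))
                             ⊎ (cls (toℕ v) ≡ old (toℕ v) + P × x ~ v)

  mark-loop : Program
  mark-loop = for #j below #m loop
             (cond arr $src (reg #j) ≐ arr $xs (reg #i)
              then (cond arr $cls (arr $adj (reg #j)) ⊏ reg #p
                    then $cls ⟦ arr $adj (reg #j) ⟧≔ (arr $cls (arr $adj (reg #j)) ⊕ reg #p)
                    else skip)
              else skip)

  run-mark : ∀ {σ} → Loaded n k M src adj xs σ → ∀ x → xs (regs σ #i) ≡ toℕ x → regs σ #p < n →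
             Bounded (regs σ #p) (arrs σ $cls) →
             Run W L mark-loop σ 100 (λ τ → Marked x (regs σ #p) (arrs σ $cls) M (arrs τ $cls))
  run-mark {σ} l x xs≡x P<n bounded = weaken (≤-lit _ 100) (λ _ → id) (run-for
    (λ J τ → Marked x P old J (arrs τ $cls)) (m≡ l)
    (fits (≤-trans (m≤n+m M n) (≤-trans (n≤1+n _) (m≤n*m L 4))))
    (≤-trans (≤-reflexive (*-identityʳ (suc M))) (s≤s (m≤n+m M n)))
    (λ v → inj₁ (refl , λ ()))
    step)
    where
    P = regs σ #p
    old = arrs σ $cls

    step : ∀ {τ J} → Frame mark-loop σ τ → regs τ #j ≡ J → J < M → Marked x P old J (arrs τ $cls) → Run W 1 _ τ _ _
    step {τ} {J} fr refl J<M marked with arc-sound J<M | keep fr l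
    ... | u , v , src≡u , adj≡v , u~v | l′ = run-cond
        (λ h → run-cond
          (λ h′ → run-⟦⟧≔ (fits (subst (_≤ 4 * L) (sym at-v) v≤))
            (2n-fits (subst₂ (λ a b → a + b ≤ n + n) refl (sym P≡)
                (+-mono-≤ (≤-trans (<⇒≤ (subst (_ <_) P≡ (⊏⇒< h′))) (<⇒≤ P<n)) (<⇒≤ P<n))))
            (write-v (u≡x (≐⇒≡ h)) (subst₂ _<_ (cong (arrs τ $cls) at-v) P≡ (⊏⇒< h′))))
          (λ h′ → run-skip (full (subst₂ _≤_ P≡ (cong (arrs τ $cls) at-v) (⊏⇒≥ h′)))))
        (λ h → run-skip (other λ { refl → ≐⇒≢ h (trans src-at (trans src≡u (sym xs-at))) }))
      where
      at-v : arrs τ $adj J ≡ toℕ v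
      at-v = trans (cong-app (adj≡ l′) J) adj≡v
      src-at : arrs τ $src J ≡ src J
      src-at = cong-app (src≡ l′) J
      xs-at : arrs τ $xs (regs τ #i) ≡ toℕ x
      xs-at = trans (cong₂ (λ f i → f i) (xs≡ l′) (reg= fr #i)) xs≡x
      P≡ : regs τ #p ≡ P
      P≡ = reg= fr #p
      v≤ : toℕ v ≤ 4 * L
      v≤ = ≤-trans (<⇒≤ (toℕ<n v)) (≤-trans n≤L (m≤n*m L 4))
      u≡x : arrs τ $src J ≡ arrs τ $xs (regs τ #i) → u ≡ x
      u≡x e = toℕ-injective (trans (sym src≡u) (trans (sym src-at) (trans e xs-at)))

      other : u ≢ x → Marked x P old (suc J) (arrs τ $cls)
      other u≢x w with marked w
      ... | inj₂ r = inj₂ r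
      ... | inj₁ (e , none) = inj₁ (e , λ j<sJ sj → [ (λ j<J → none j<J sj) ,
              (λ { refl → contradiction (toℕ-injective (trans (sym src≡u) sj)) u≢x }) ]′ (m<1+n⇒m<n∨m≡n j<sJ))

      -- Old numbers are below `P`, so a number of at least `P` shows that `P` has already been
      -- added.
      full : P ≤ arrs τ $cls (toℕ v) → Marked x P old (suc J) (arrs τ $cls)
      full P≤ w with marked w
      ... | inj₂ r = inj₂ r
      ... | inj₁ (e , none) = inj₁ (e , λ j<sJ sj → [ (λ j<J → none j<J sj) ,
              (λ { refl aj → <⇒≱ (bounded w) (subst (P ≤_) (trans (cong (arrs τ $cls) (trans (sym adj≡v) aj)) e) P≤) }) ]′
                  (m<1+n⇒m<n∨m≡n j<sJ))

      write-v : u ≡ x → arrs τ $cls (toℕ v) < P →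
                Marked x P old (suc J) (update (arrs τ $cls) (arrs τ $adj J) (arrs τ $cls (arrs τ $adj J) + regs τ #p))
      write-v refl <P w rewrite at-v | P≡ with update-split (arrs τ $cls) (toℕ v) (arrs τ $cls (toℕ v) + P) (toℕ w) | marked
          w
      ... | inj₁ (v≡w , e) | inj₁ (e′ , _) rewrite toℕ-injective v≡w = inj₂ (trans e (cong (_+ P) e′) , u~v)
      ... | inj₁ (v≡w , e) | inj₂ (e′ , _) rewrite toℕ-injective v≡w = contradiction
          (≤-trans (m≤n+m P _) (≤-reflexive (sym e′))) (<⇒≱ <P)
      ... | inj₂ (v≢w , e) | inj₂ (e′ , r) = inj₂ (trans e e′ , r)
      ... | inj₂ (v≢w , e) | inj₁ (e′ , none) = inj₁ (trans e e′ , λ j<sJ sj → [ (λ j<J → none j<J sj) ,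
              (λ { refl aj → v≢w (trans (sym adj≡v) aj) }) ]′ (m<1+n⇒m<n∨m≡n j<sJ))

  Marked-all : ∀ {x P} old cls → Marked x P old M cls → ∀ v →
               (cls (toℕ v) ≡ old (toℕ v) × ¬ x ~ v) ⊎ (cls (toℕ v) ≡ old (toℕ v) + P × x ~ v)
  Marked-all old cls marked v with marked v
  ... | inj₂ r = inj₂ r
  ... | inj₁ (e , none) = inj₁ (e , λ x~v → case arc-complete x~v of λ where
          (j , j<M , sj , aj) → none j<M sj aj)

  -- As old numbers are below `P`, a new one determines both the old number and the adjacency to
  -- `x`, like a binary expansion with one more digit.
  Marked-refines : ∀ {x P I} old cls → xs I ≡ toℕ x → Marked x P old M cls → Bounded P old → Separates I old →
                   Bounded (P + P) cls × Separates (suc I) cls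
  Marked-refines {x} {P} {I} old cls xs≡x marked bounded sep = bounded′ , sep′
    where
    bounded′ : Bounded (P + P) cls
    bounded′ v with Marked-all old cls marked v
    ... | inj₁ (e , _) rewrite e = ≤-trans (bounded v) (m≤m+n P P)
    ... | inj₂ (e , _) rewrite e = +-monoˡ-< P (bounded v)

    sep′ : Separates (suc I) cls
    sep′ {u} {v} e {i} {y} i<sI xi with Marked-all old cls marked u | Marked-all old cls marked v | m<1+n⇒m<n∨m≡n i<sI
    ... | inj₁ (eu , _)  | inj₁ (ev , _)  | inj₁ i<I = sep (trans (sym eu) (trans e ev)) i<I xi
    ... | inj₂ (eu , _)  | inj₂ (ev , _)  | inj₁ i<I = sep (+-cancelʳ-≡ P _ _ (trans (sym eu) (trans e ev))) i<I xi
    ... | inj₁ (_ , x≁u) | inj₁ _ | inj₂ refl =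
      λ y~u → contradiction (subst (_~ u) (toℕ-injective (trans (sym xi) xs≡x)) y~u) x≁u
    ... | inj₂ _ | inj₂ (_ , x~v) | inj₂ refl = λ _ → subst (_~ v) (sym (toℕ-injective (trans (sym xi) xs≡x))) x~v
    ... | inj₁ (eu , _)  | inj₂ (ev , _)  | _ = contradiction (subst (P ≤_) (trans (sym ev) (trans (sym e) eu)) (m≤n+m P _))
        (<⇒≱ (bounded u))
    ... | inj₂ (eu , _)  | inj₁ (ev , _)  | _ = contradiction (subst (P ≤_) (trans (sym eu) (trans e ev)) (m≤n+m P _))
        (<⇒≱ (bounded v))

  refine-loop : Program
  refine-loop = for #i below #k loop
    (cond reg #p ⊏ reg #n then (mark-loop ⨾ #p ≔ reg #p ⊕ reg #p) else skip)

  V : ℕ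
  V = suc k * L

  run-refine : ∀ {σ} → Loaded n k M src adj xs σ → Refined 0 σ → Run W V refine-loop σ 200 (Refined k)
  run-refine {σ} l start = weaken (≤-lit _ 200) (λ _ → id) (run-for Refined (k≡ l)
    (2n-fits (≤-trans k≤n (m≤m+n n n))) ≤-refl start step)
    where
    step : ∀ {τ I} → Frame refine-loop σ τ → regs τ #i ≡ I → I < k → Refined I τ → Run W L _ τ _ _
    step {τ} {I} fr refl I<k (1≤p , p≤ , p≤2n , ref) with xs-sound I<k | keep fr l
    ... | x , x∈X , xs≡x | l′ = run-cond
      (λ h → let p<n = subst (regs τ #p <_) (n≡ l′) (⊏⇒< h) in
        run-mark l′ x xs≡x p<n (proj₁ (ref p<n)) ⟫ λ {υ} fr′ marked →
          run-≔ (2n-fits (subst₂ (λ a b → a + b ≤ n + n) (sym (reg= fr′ #p)) (sym (reg= fr′ #p))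
              (+-mono-≤ (<⇒≤ p<n) (<⇒≤ p<n))))
            (doubled {υ} p<n (reg= fr′ #p) marked))
      (λ h → run-skip (1≤p , ≤-trans p≤ (m≤m+n (2 ^ I) _) , p≤2n ,
        λ p<n → contradiction p<n (≤⇒≯ (subst (_≤ regs τ #p) (n≡ l′) (⊏⇒≥ h)))))
      where
      doubled : ∀ {υ} → regs τ #p < n → regs υ #p ≡ regs τ #p → Marked x (regs τ #p) (arrs τ $cls) M (arrs υ $cls) →
                Refined (suc I) (setReg υ #p (regs υ #p + regs υ #p))
      doubled {υ} p<n e marked rewrite e =
        ≤-trans 1≤p (m≤m+n _ _) , subst (λ z → regs τ #p + regs τ #p ≤ 2 ^ I + z) (sym (+-identityʳ (2 ^ I)))
            (+-mono-≤ p≤ p≤) ,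
        +-mono-≤ (<⇒≤ p<n) (<⇒≤ p<n) ,
        λ _ → Marked-refines (arrs τ $cls) (arrs υ $cls) xs≡x marked (proj₁ (ref p<n)) (proj₂ (ref p<n))

  -- The alternative `u ≡ v` covers the vertices of `X`, which get classes of their own, and the
  -- fallback in which all vertices are told apart.
  Twins : (ℕ → ℕ) → Set
  Twins cls = ∀ {u v : Fin n} → cls (toℕ u) ≡ cls (toℕ v) →
    u ≡ v ⊎ (u ∉ X × v ∉ X × (∀ {x} → x ∈ X → (x ~ u → x ~ v) × (x ~ v → x ~ u)))

  -- The two bounds on `#c` serve different ends: the first limits the number of sequences to be
  -- tried, the second makes class numbers fit in a word.
  Classified : Store → Set
  Classified τ = regs τ #c ≤ 2 ^ k + k × regs τ #c ≤ n + n + n × Bounded (regs τ #c) (arrs τ $cls) × Twins (arrs τ $cls)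

  private-classes identity-classes : Program
  private-classes = for #i below #k loop ($cls ⟦ arr $xs (reg #i) ⟧≔ (reg #p ⊕ reg #i))
  identity-classes = for #i below #n loop ($cls ⟦ reg #i ⟧≔ reg #i)

  Private : ℕ → (ℕ → ℕ) → ℕ → (ℕ → ℕ) → Set
  Private P old I cls = ∀ (v : Fin n) → (∃ λ i → i < I × xs i ≡ toℕ v × cls (toℕ v) ≡ P + i)
                            ⊎ ((∀ {i} → i < I → xs i ≢ toℕ v) × cls (toℕ v) ≡ old (toℕ v))

  run-private : ∀ {σ} → Loaded n k M src adj xs σ → regs σ #p < n →
                Run W L private-classes σ 100 (λ τ → Private (regs σ #p) (arrs σ $cls) k (arrs τ $cls))
  run-private {σ} l p<n = weaken (≤-lit _ 100) (λ _ → id) (run-for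
    (λ I τ → Private P old I (arrs τ $cls)) (k≡ l)
    (2n-fits (≤-trans k≤n (m≤m+n n n))) (≤-trans (≤-reflexive (*-identityʳ (suc k))) (s≤s (≤-trans k≤n (m≤m+n n M))))
    (λ v → inj₂ ((λ ()) , refl)) step)
    where
    P = regs σ #p
    old = arrs σ $cls

    step : ∀ {τ I} → Frame private-classes σ τ → regs τ #i ≡ I → I < k → Private P old I (arrs τ $cls) → Run W 1 _ τ _ _
    step {τ} {I} fr refl I<k priv with xs-sound I<k | keep fr l
    ... | x , x∈X , xs≡x | l′ = run-⟦⟧≔
      (2n-fits (subst (_≤ n + n) (sym xs-at) (≤-trans (<⇒≤ (toℕ<n x)) (m≤m+n n n))))
      (2n-fits (subst (λ z → z + I ≤ n + n) (sym (reg= fr #p)) (+-mono-≤ (<⇒≤ p<n) (<⇒≤ (<-≤-trans I<k k≤n)))))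
      written
      where
      xs-at : arrs τ $xs I ≡ toℕ x
      xs-at = trans (cong-app (xs≡ l′) I) xs≡x
      p-at : regs τ #p ≡ P
      p-at = reg= fr #p

      written : Private P old (suc I) (update (arrs τ $cls) (arrs τ $xs I) (regs τ #p + I))
      written v rewrite xs-at | p-at with update-split (arrs τ $cls) (toℕ x) (P + I) (toℕ v) | priv v
      ... | inj₁ (x≡v , e) | _ = inj₁ (I , n<1+n I , trans xs≡x x≡v , e)
      ... | inj₂ (_ , e) | inj₁ (i , i<I , xi , e′) = inj₁ (i , m<n⇒m<1+n i<I , xi , trans e e′)
      ... | inj₂ (x≢v , e) | inj₂ (none , e′) = inj₂ ((λ i<sI xi → [ (λ i<I → none i<I xi) ,
              (λ { refl → x≢v (trans (sym xs≡x) xi) }) ]′ (m<1+n⇒m<n∨m≡n i<sI)) , trans e e′)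

  run-identity : ∀ {σ} → Loaded n k M src adj xs σ →
                 Run W L identity-classes σ 100 (λ τ → ∀ (v : Fin n) → arrs τ $cls (toℕ v) ≡ toℕ v)
  run-identity {σ} l = weaken (≤-lit _ 100) (λ _ all v → all v (toℕ<n v)) (run-for
    (λ I τ → ∀ (v : Fin n) → toℕ v < I → arrs τ $cls (toℕ v) ≡ toℕ v) (n≡ l)
    (2n-fits (m≤m+n n n)) (≤-trans (≤-reflexive (*-identityʳ (suc n))) (s≤s (m≤m+n n M))) (λ _ ()) step)
    where
    step : ∀ {τ I} → Frame identity-classes σ τ → regs τ #i ≡ I → I < n →
           (∀ (v : Fin n) → toℕ v < I → arrs τ $cls (toℕ v) ≡ toℕ v) → Run W 1 _ τ _ _
    step {τ} {I} fr refl I<n done = run-⟦⟧≔ small small written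
      where
      small : I < W
      small = 2n-fits (≤-trans (<⇒≤ I<n) (m≤m+n n n))
      written : ∀ (v : Fin n) → toℕ v < suc I → update (arrs τ $cls) I I (toℕ v) ≡ toℕ v
      written v lt with update-split (arrs τ $cls) I I (toℕ v)
      ... | inj₁ (e , e′) = trans e′ e
      ... | inj₂ (I≢v , e) = trans e (done v (≤∧≢⇒< (s≤s⁻¹ lt) (I≢v ∘ sym)))

  Private-classified : ∀ {P} old cls → Bounded P old → Separates k old → Private P old k cls →
                       Bounded (P + k) cls × Twins cls
  Private-classified {P} old cls bounded sep priv = bounded′ , twins
    where
    bounded′ : Bounded (P + k) cls
    bounded′ v with priv v
    ... | inj₁ (i , i<k , _ , e) = subst (_< P + k) (sym e) (+-monoʳ-< P i<k)
    ... | inj₂ (_ , e) = subst (_< P + k) (sym e) (≤-trans (bounded v) (m≤m+n P k))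

    outside-X : ∀ {v} → (∀ {i} → i < k → xs i ≢ toℕ v) → v ∉ X
    outside-X none v∈X = case xs-complete v∈X of λ where (i , i<k , xi) → none i<k xi

    twins : Twins cls
    twins {u} {v} e with priv u | priv v
    ... | inj₁ (i , _ , xi , eu) | inj₁ (j , _ , xj , ev) = inj₁ (toℕ-injective (trans (sym xi)
            (trans (cong xs (+-cancelˡ-≡ P i j (trans (sym eu) (trans e ev)))) xj)))
    ... | inj₁ (i , _ , xi , eu) | inj₂ (_ , ev) = contradiction (subst (P ≤_) (trans (sym eu) (trans e ev)) (m≤m+n P i))
        (<⇒≱ (bounded v))
    ... | inj₂ (_ , eu) | inj₁ (j , _ , xj , ev) = contradiction (subst (P ≤_) (trans (sym ev) (trans (sym e) eu))
        (m≤m+n P j)) (<⇒≱ (bounded u))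
    ... | inj₂ (nu , eu) | inj₂ (nv , ev) = inj₂ (outside-X nu , outside-X nv , λ x∈X → case xs-complete x∈X of λ where
            (i , i<k , xi) → sep (trans (sym eu) (trans e ev)) i<k xi , sep (trans (sym ev) (trans (sym e) eu)) i<k xi)

  run-classify : ∀ {σ} → Loaded n k M src adj xs σ → (∀ i → arrs σ $cls i ≡ 0) → Run W V classify σ 1000 Classified
  run-classify {σ} l zeros = weaken (≤-lit _ 1000) (λ _ → id)
    (run-≔⨾ (2n-fits 1≤2n)
    (run-refine (keep (setReg-frame #p) l)
       (≤-refl , ≤-refl , 1≤2n , λ _ → (λ v → subst (_< 1) (sym (zeros (toℕ v))) (s≤s z≤n)) , λ _ ()) ⟫ finish))
    where
    1≤2n : 1 ≤ n + n
    1≤2n = ≤-trans 1≤n (m≤m+n n n)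

    L≤V : L ≤ V
    L≤V = m≤m+n L (k * L)

    finish : ∀ {τ} → Frame refine-loop (setReg σ #p 1) τ → Refined k τ → Run W V _ τ _ Classified
    finish {τ} fr (1≤p , p≤ , p≤2n , ref) = run-cond
      (λ h → let p<n = subst (regs τ #p <_) (n≡ lτ) (⊏⇒< h)
                 c≤ = subst (λ z → regs τ #p + regs τ #k ≤ 2 ^ k + z) (k≡ lτ) (+-monoˡ-≤ (regs τ #k) p≤)
                 c≤3n = +-mono-≤ p≤2n (subst (_≤ n) (sym (k≡ lτ)) k≤n)
             in run-≔⨾ (3n-fits c≤3n) (weaken ≤-refl (λ {υ} fr′ priv →
                  let c≡ = trans (reg= fr′ #c) (cong (regs τ #p +_) (k≡ lτ))
                      b , t = Private-classified (arrs τ $cls) (arrs υ $cls) (proj₁ (ref p<n)) (proj₂ (ref p<n)) priv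
                  in subst (_≤ _) (sym (reg= fr′ #c)) c≤ , subst (_≤ _) (sym (reg= fr′ #c)) c≤3n ,
                     subst (λ z → Bounded z (arrs υ $cls)) (sym c≡) b , t)
                (rescale L≤V (run-private (keep (setReg-frame #c) lτ) p<n))))
      (λ h → run-≔⨾ (2n-fits (subst (_≤ n + n) (sym (n≡ lτ)) (m≤m+n n n))) (weaken ≤-refl (λ {υ} fr′ same →
                  let c≡ = trans (reg= fr′ #c) (n≡ lτ)
                  in subst (_≤ _) (sym c≡) (≤-trans (subst (_≤ regs τ #p) (n≡ lτ) (⊏⇒≥ h)) (≤-trans p≤ (m≤m+n _ k))) ,
                     subst (_≤ _) (sym c≡) (≤-trans (m≤m+n n n) (m≤m+n (n + n) n)) ,
                     (λ v → subst₂ _<_ (sym (same v)) (sym c≡) (toℕ<n v)) ,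
                     λ {u} {v} e → inj₁ (toℕ-injective (trans (sym (same u)) (trans e (same v)))))
                (rescale L≤V (run-identity (keep (setReg-frame #c) lτ)))))
      where
      lτ = keep fr (keep (setReg-frame #p) l)

-- Simulation of a sequence of classes, and search through all of them

-- The value is exactly 1, and not merely nonzero, because `tally` counts burned vertices by adding
-- up the entries.
IndicatesAt : ∀ {n} → ℕ → Subset n → Fin n → Set
IndicatesAt x S v = (v ∈ S × x ≡ 1) ⊎ (v ∉ S × x ≡ 0)

Indicates : ∀ {n} → (ℕ → ℕ) → Subset n → Set
Indicates A S = ∀ v → IndicatesAt (A (toℕ v)) S v

IndicatesAt-∈ : ∀ {n x} {S : Subset n} {v} → IndicatesAt x S v → x ≢ 0 → v ∈ S
IndicatesAt-∈ (inj₁ (v∈ , _)) _  = v∈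
IndicatesAt-∈ (inj₂ (_ , x≡0)) x≢0 = contradiction x≡0 x≢0

IndicatesAt-∉ : ∀ {n x} {S : Subset n} {v} → IndicatesAt x S v → x ≡ 0 → v ∉ S
IndicatesAt-∉ (inj₁ (_ , refl)) ()
IndicatesAt-∉ (inj₂ (v∉ , _)) _ = v∉

sumBelow : (ℕ → ℕ) → ℕ → ℕ
sumBelow f zero    = 0
sumBelow f (suc i) = sumBelow f i + f i

-- The loop adds its terms at the end, whereas a subset is taken apart from the front.
sumBelow-suc : ∀ f i → sumBelow f (suc i) ≡ f 0 + sumBelow (f ∘ suc) i
sumBelow-suc f zero    = +-comm 0 (f 0)
sumBelow-suc f (suc i) = trans (cong (_+ f (suc i)) (sumBelow-suc f i)) (+-assoc (f 0) _ _)

sumBelow-∣∣ : ∀ {n A} {S : Subset n} → Indicates A S → sumBelow A n ≡ ∣ S ∣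
sumBelow-∣∣ {S = Vec.[]} _ = refl
sumBelow-∣∣ {suc n} {A} {b Vec.∷ S} ind = trans (sumBelow-suc A n) (head b (ind zero))
  where
  tail : Indicates (A ∘ suc) S
  tail v with ind (suc v)
  ... | inj₁ (Vec.there v∈ , e) = inj₁ (v∈ , e)
  ... | inj₂ (v∉ , e)           = inj₂ (v∉ ∘ Vec.there , e)
  head : ∀ b → IndicatesAt (A 0) (b Vec.∷ S) zero → A 0 + sumBelow (A ∘ suc) n ≡ ∣ b Vec.∷ S ∣
  head true  (inj₁ (Vec.here , e)) = cong₂ _+_ e (sumBelow-∣∣ tail)
  head true  (inj₂ (v∉ , _))       = contradiction Vec.here v∉
  head false (inj₂ (_ , e))        = cong₂ _+_ e (sumBelow-∣∣ tail)

Stored : ∀ {n} → (ℕ → ℕ) → List (Fin n) → Set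
Stored A []       = ⊤
Stored A (v ∷ vs) = A 0 ≡ toℕ v × Stored (A ∘ suc) vs

Stored-cong : ∀ {n A A′} (vs : List (Fin n)) → (∀ i → i < length vs → A i ≡ A′ i) → Stored A vs → Stored A′ vs
Stored-cong []       _  _        = tt
Stored-cong (v ∷ vs) eq (e , st) = trans (sym (eq 0 (s≤s z≤n))) e , Stored-cong vs (λ i lt → eq (suc i) (s≤s lt)) st

Stored-∷ʳ : ∀ {n A} (vs : List (Fin n)) {v} → Stored A vs → A (length vs) ≡ toℕ v → Stored A (vs ++ v ∷ [])
Stored-∷ʳ []       _        e = e , tt
Stored-∷ʳ (u ∷ vs) (e′ , st) e = e′ , Stored-∷ʳ vs st e

Stored-≤n : ∀ {n A} (vs : List (Fin n)) → Stored A vs → ∀ i → i < length vs → A i ≤ n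
Stored-≤n (v ∷ vs) (e , _)  zero    _        = subst (_≤ _) (sym e) (<⇒≤ (toℕ<n v))
Stored-≤n (v ∷ vs) (_ , st) (suc i) (s≤s i<) = Stored-≤n vs st i i<

Stored-map : ∀ {n A} (vs : List (Fin n)) → Stored A vs → map A (upTo (length vs)) ≡ map toℕ vs
Stored-map {A = A} vs st = trans (map-upTo A (length vs)) (go vs st)
  where
  go : ∀ {A} vs → Stored A vs → applyUpTo A (length vs) ≡ map toℕ vs
  go []       _        = refl
  go (v ∷ vs) (e , st) = cong₂ _∷_ e (go vs st)

-- The marks in `$nb` depend on the fire alone and not on the defence. One computation of them
-- serves to decide whether the process has ended and, after the defence, to spread the fire.
frontier scan ignite round simulate : Program
frontier =
  for #i below #m loop
    (cond arr $bn (arr $src (reg #i)) then ($nb ⟦ arr $adj (reg #i) ⟧≔ lit 1) else skip)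
scan =
  #go ≔ lit 0 ⨾
  #top ≔ lit 0 ⨾
  #pick ≔ lit 0 ⨾
  for #i below #n loop
    (cond arr $bn (reg #i) ⊕ arr $df (reg #i)
     then skip
     else ((cond arr $nb (reg #i) then (#go ≔ lit 1) else skip) ⨾
           #score ≔ (lit 1 ⊕ (arr $off (reg #i ⊕ lit 1) ⊖ arr $off (reg #i)))
                    ⊕ ((arr $cls (reg #i) ≐ arr $dig (reg #len)) ⊗ (lit 1 ⊕ reg #n)) ⨾
           cond reg #top ⊏ reg #score then (#top ≔ reg #score ⨾ #pick ≔ reg #i) else skip))
ignite =
  for #i below #n loop
    ((cond arr $nb (reg #i)
      then (cond arr $df (reg #i) then skip else ($bn ⟦ reg #i ⟧≔ lit 1))
      else skip) ⨾
     $nb ⟦ reg #i ⟧≔ lit 0)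
round =
  frontier ⨾
  scan ⨾
  cond reg #go
  then ($df ⟦ reg #pick ⟧≔ lit 1 ⨾
        $now ⟦ reg #len ⟧≔ reg #pick ⨾
        #len ≔ reg #len ⊕ lit 1 ⨾
        ignite)
  else skip
simulate =
  for #i below #n loop ($bn ⟦ reg #i ⟧≔ lit 0 ⨾ $df ⟦ reg #i ⟧≔ lit 0 ⨾ $nb ⟦ reg #i ⟧≔ lit 0) ⨾
  $bn ⟦ reg #s ⟧≔ lit 1 ⨾
  #len ≔ lit 0 ⨾
  #go ≔ lit 1 ⨾
  while reg #go loop round

tally keep-best increment search output : Program
tally =
  #burnt ≔ lit 0 ⨾
  for #i below #n loop (#burnt ≔ reg #burnt ⊕ arr $bn (reg #i))
keep-best =
  cond reg #burnt ⊏ reg #best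
  then (#best ≔ reg #burnt ⨾
        #best-len ≔ reg #len ⨾
        for #i below #len loop ($best ⟦ reg #i ⟧≔ arr $now (reg #i)))
  else skip
increment =
  #i ≔ lit 0 ⨾
  -- The product is a conjunction. As digits are below `c`, its second factor says that the digit is
  -- `c - 1`.
  while (reg #i ⊏ reg #T) ⊗ (reg #c ⊏ (arr $dig (reg #i) ⊕ lit 2))
  loop ($dig ⟦ reg #i ⟧≔ lit 0 ⨾ #i ≔ reg #i ⊕ lit 1) ⨾
  cond reg #i ⊏ reg #T
  then ($dig ⟦ reg #i ⟧≔ (arr $dig (reg #i) ⊕ lit 1))
  else (#on ≔ lit 0)
search =
  #on ≔ lit 1 ⨾
  -- No fire burns `n + 1` vertices, so the first simulation replaces this value.
  #best ≔ lit 1 ⊕ reg #n ⨾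
  #best-len ≔ lit 0 ⨾
  while reg #on loop (simulate ⨾ tally ⨾ keep-best ⨾ increment)
output =
  -- Array 0 held the offsets; it is overwritten only after the last scan has read them.
  for #i below #best-len loop ($off ⟦ reg #i ⟧≔ arr $best (reg #i)) ⨾
  #n ≔ reg #best-len

-- A sequence of classes is read as a number in base `c`, least significant digit first, so that
-- progress of the search becomes an inequality.
value : ℕ → ℕ → (ℕ → ℕ) → ℕ
value c zero    g = 0
value c (suc T) g = g 0 + c * value c T (g ∘ suc)

digit-split : ∀ {c a b x y} → a < c → b < c → a + c * x ≡ b + c * y → a ≡ b × x ≡ y
digit-split {suc c-1} {a} {b} {x} {y} a<c b<c e = a≡b , *-cancelˡ-≡ x y c
    (+-cancelˡ-≡ b _ _ (trans (cong (_+ c * x) (sym a≡b)) e))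
  where
  c = suc c-1
  low : ∀ {a} x → a < c → (a + c * x) % c ≡ a
  low {a} x a<c = trans (cong (λ z → (a + z) % c) (*-comm c x)) (trans ([m+kn]%n≡m%n a x c) (m<n⇒m%n≡m a<c))
  a≡b : a ≡ b
  a≡b = trans (sym (low x a<c)) (trans (cong (_% c) e) (low y b<c))

Digits : ℕ → ℕ → (ℕ → ℕ) → Set
Digits c T g = ∀ i → i < T → g i < c

value-injective : ∀ {c} T {g h} → Digits c T g → Digits c T h → value c T g ≡ value c T h → ∀ i → i < T → g i ≡ h i
value-injective (suc T) g< h< e zero    _         = proj₁ (digit-split (g< 0 (s≤s z≤n)) (h< 0 (s≤s z≤n)) e)
value-injective (suc T) g< h< e (suc i) (s≤s i<T) =
  value-injective T (λ j → g< (suc j) ∘ s≤s) (λ j → h< (suc j) ∘ s≤s)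
    (proj₂ (digit-split (g< 0 (s≤s z≤n)) (h< 0 (s≤s z≤n)) e)) i i<T

value-bound : ∀ {c} T {g} → Digits c T g → value c T g < c ^ T
value-bound zero    _  = s≤s z≤n
value-bound {c} (suc T) {g} g< = begin-strict
  g 0 + c * value c T (g ∘ suc)   <⟨ +-monoˡ-< _ (g< 0 (s≤s z≤n)) ⟩
  c + c * value c T (g ∘ suc)     ≡⟨ *-suc c _ ⟨
  c * suc (value c T (g ∘ suc))   ≤⟨ *-monoʳ-≤ c (value-bound T (λ j → g< (suc j) ∘ s≤s)) ⟩
  c * c ^ T                       ∎
  where open ≤-Reasoning

-- The old and the new contribution of the digit are added crosswise, which avoids truncated
-- subtraction.
value-update : ∀ {c T} g {i} x → i < T → value c T (update g i x) + g i * c ^ i ≡ value c T g + x * c ^ i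
value-update {c} {suc T} g {zero} x _ = begin
  x + c * v + g 0 * 1     ≡⟨ solve 4 (λ x g c v → x :+ c :* v :+ g :* con 1 := g :+ c :* v :+ x :* con 1) refl x (g 0) c v ⟩
  g 0 + c * v + x * 1     ∎
  where
  open ≡-Reasoning
  v = value c T (g ∘ suc)
value-update {c} {suc T} g {suc i} x (s≤s i<T) = begin
  g 0 + c * v′ + g (suc i) * (c * c ^ i)
    ≡⟨ solve 5 (λ a c v y p → a :+ c :* v :+ y :* (c :* p) := a :+ c :* (v :+ y :* p)) refl (g 0) c v′ (g (suc i)) (c ^ i) ⟩
  g 0 + c * (v′ + g (suc i) * c ^ i)
    ≡⟨ cong (λ z → g 0 + c * z) (value-update (g ∘ suc) x i<T) ⟩
  g 0 + c * (v + x * c ^ i)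
    ≡⟨ solve 5 (λ a c v y p → a :+ c :* v :+ y :* (c :* p) := a :+ c :* (v :+ y :* p)) refl (g 0) c v x (c ^ i) ⟨
  g 0 + c * v + x * (c * c ^ i) ∎
  where
  open ≡-Reasoning
  v  = value c T (g ∘ suc)
  v′ = value c T (update (g ∘ suc) i x)

Digits-update : ∀ {c T} g i {x} → x < c → Digits c T g → Digits c T (update g i x)
Digits-update g i {x} x<c g< j j<T with update-split g i x j
... | inj₁ (_ , e) = subst (_< _) (sym e) x<c
... | inj₂ (_ , e) = subst (_< _) (sym e) (g< j j<T)

record Ready (n s M T c : ℕ) (off adj src cls : ℕ → ℕ) (σ : Store) : Set where
  field
    n≡   : regs σ #n ≡ n
    s≡   : regs σ #s ≡ s
    m≡   : regs σ #m ≡ M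
    T≡   : regs σ #T ≡ T
    c≡   : regs σ #c ≡ c
    off≡ : arrs σ $off ≡ off
    adj≡ : arrs σ $adj ≡ adj
    src≡ : arrs σ $src ≡ src
    cls≡ : arrs σ $cls ≡ cls

open Ready

Ready-frame : ∀ {n s M T′ c off adj src cls p σ τ} → Frame p σ τ →
  {_ : T (not (writesReg p #n))} {_ : T (not (writesReg p #s))} {_ : T (not (writesReg p #m))}
  {_ : T (not (writesReg p #T))} {_ : T (not (writesReg p #c))}
  {_ : T (not (writesArr p $off))} {_ : T (not (writesArr p $adj))} {_ : T (not (writesArr p $src))}
      {_ : T (not (writesArr p $cls))} →
  Ready n s M T′ c off adj src cls σ → Ready n s M T′ c off adj src cls τ
Ready-frame fr {a} {b} {d} {e} {f} {g} {h} {i} {j} l = record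
  { n≡ = trans (reg= fr #n {a}) (n≡ l) ; s≡ = trans (reg= fr #s {b}) (s≡ l) ; m≡ = trans (reg= fr #m {d}) (m≡ l)
  ; T≡ = trans (reg= fr #T {e}) (T≡ l) ; c≡ = trans (reg= fr #c {f}) (c≡ l)
  ; off≡ = trans (arr= fr $off {g}) (off≡ l) ; adj≡ = trans (arr= fr $adj {h}) (adj≡ l)
  ; src≡ = trans (arr= fr $src {i}) (src≡ l) ; cls≡ = trans (arr= fr $cls {j}) (cls≡ l) }

module Simulation
  (W n M : ℕ) (big : 4 * (2 + n + M) ≤ W) (G : Graph n) (s : Fin n) (T₀ c : ℕ) (T₀≤ : T₀ ≤ 2 + n + n) (c-fits : c < W)
  (off adj src cls : ℕ → ℕ) (deg : Fin n → ℕ)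
  (arc-sound : ∀ {j} → j < M → ∃ λ u → ∃ λ v → src j ≡ toℕ u × adj j ≡ toℕ v × Graph._~_ G u v)
  (arc-complete : ∀ {u v} → Graph._~_ G u v → ∃ λ j → j < M × src j ≡ toℕ u × adj j ≡ toℕ v)
  (off-deg : ∀ v → off (toℕ v + 1) ∸ off (toℕ v) ≡ deg v) (deg≤ : ∀ v → deg v ≤ n)
  (stable-at : ∀ {t D B} → Layered G t D B → T₀ ≤ t → spread G D B ≡ B) where

  open Graph G renaming (sym to ~-sym)

  κ : Fin n → ℕ
  κ v = cls (toℕ v)

  State : Store → Set
  State = Ready n (toℕ s) M T₀ c off adj src cls

  open Sizes W n M big

  1-fits : 1 < W
  1-fits = fits (s≤s z≤n)

  for-vertices : suc n * 1 ≤ L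
  for-vertices = ≤-trans (≤-reflexive (*-identityʳ (suc n))) (s≤s (m≤m+n n M))

  Clear : (ℕ → ℕ) → Set
  Clear A = ∀ (v : Fin n) → A (toℕ v) ≡ 0

  run-frontier : ∀ {σ B} → State σ → Indicates (arrs σ $bn) B → Clear (arrs σ $nb) →
                 Run W L frontier σ 100 (λ τ → Indicates (arrs τ $nb) (neighbours G B))
  run-frontier {σ} {B} st bn nb = weaken (≤-lit _ 100) (λ {τ} _ → all {τ}) (run-for
    (λ J τ → Reached J (arrs τ $nb)) (m≡ st) (fits (≤-trans (m≤n+m M n) (≤-trans (n≤1+n _) (m≤m+n L _))))
    (≤-trans (≤-reflexive (*-identityʳ (suc M))) (s≤s (m≤n+m M n)))
    (λ v → inj₂ (nb v , λ ())) step)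
    where
    Reached : ℕ → (ℕ → ℕ) → Set
    Reached J A = ∀ (v : Fin n) → (A (toℕ v) ≡ 1 × v ∈ neighbours G B)
                  ⊎ (A (toℕ v) ≡ 0 × ∀ {j u} → j < J → src j ≡ toℕ u → adj j ≡ toℕ v → u ∉ B)

    all : ∀ {τ} → Reached M (arrs τ $nb) → Indicates (arrs τ $nb) (neighbours G B)
    all reached v with reached v
    ... | inj₁ (e , v∈) = inj₁ (v∈ , e)
    ... | inj₂ (e , none) = inj₂ ((λ v∈ → case neighbours⁻ G {B} v∈ of λ where
            (u , u∈B , u~v) → case arc-complete u~v of λ where
              (j , j<M , sj , aj) → none j<M sj aj u∈B) , e)

    step : ∀ {τ J} → Frame frontier σ τ → regs τ #i ≡ J → J < M → Reached J (arrs τ $nb) → Run W 1 _ τ _ _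
    step {τ} {J} fr refl J<M reached with arc-sound J<M | Ready-frame fr st
    ... | u , v , src≡u , adj≡v , u~v | st′ = run-cond
      (λ h → run-⟦⟧≔ (≤n-fits (subst (_≤ n) (sym v-at) (<⇒≤ (toℕ<n v)))) 1-fits
        (marked (IndicatesAt-∈ (bn u) (subst (_≢ 0) bn-at h))))
      (λ h → run-skip (unmarked (IndicatesAt-∉ (bn u) (trans (sym bn-at) h))))
      where
      v-at : arrs τ $adj J ≡ toℕ v
      v-at = trans (cong-app (adj≡ st′) J) adj≡v
      bn-at : arrs τ $bn (arrs τ $src J) ≡ arrs σ $bn (toℕ u)
      bn-at = cong₂ (λ f i → f i) (arr= fr $bn) (trans (cong-app (src≡ st′) J) src≡u)

      marked : u ∈ B → Reached (suc J) (update (arrs τ $nb) (arrs τ $adj J) 1)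
      marked u∈B w with update-split (arrs τ $nb) (arrs τ $adj J) 1 (toℕ w) | reached w
      ... | inj₁ (v≡w , e) | _ =
        inj₁ (e , subst (_∈ neighbours G B) (toℕ-injective (trans (sym v-at) v≡w)) (neighbours⁺ G u∈B u~v))
      ... | inj₂ (v≢w , e) | inj₁ (e′ , w∈) = inj₁ (trans e e′ , w∈)
      ... | inj₂ (v≢w , e) | inj₂ (e′ , none) = inj₂ (trans e e′ , λ j<sJ sj aj →
              [ (λ j<J → none j<J sj aj) , (λ { refl → contradiction (trans v-at (trans (sym adj≡v) aj)) v≢w }) ]′
                  (m<1+n⇒m<n∨m≡n j<sJ))

      unmarked : u ∉ B → Reached (suc J) (arrs τ $nb)
      unmarked u∉B w with reached w
      ... | inj₁ r = inj₁ r
      ... | inj₂ (e , none) = inj₂ (e , λ j<sJ sj aj →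
              [ (λ j<J → none j<J sj aj) , (λ { refl → subst (_∉ B) (toℕ-injective (trans (sym src≡u) sj)) u∉B }) ]′
                  (m<1+n⇒m<n∨m≡n j<sJ))

  -- A raised flag is final, while a lowered one speaks only of the vertices inspected so far.
  Spreads : ℕ → (D B : Subset n) → ℕ → Set
  Spreads I D B go = (go ≡ 1 × spread G D B ≢ B)
                   ⊎ (go ≡ 0 × (∀ {v : Fin n} → toℕ v < I → v ∉ B → v ∉ D → v ∉ neighbours G B))

  scan-body : Program
  scan-body = cond arr $bn (reg #i) ⊕ arr $df (reg #i)
     then skip
     else ((cond arr $nb (reg #i) then (#go ≔ lit 1) else skip) ⨾
           #score ≔ (lit 1 ⊕ (arr $off (reg #i ⊕ lit 1) ⊖ arr $off (reg #i)))
                    ⊕ ((arr $cls (reg #i) ≐ arr $dig (reg #len)) ⊗ (lit 1 ⊕ reg #n)) ⨾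
           cond reg #top ⊏ reg #score then (#top ≔ reg #score ⨾ #pick ≔ reg #i) else skip)

  run-scan : ∀ {σ D B} → State σ → Indicates (arrs σ $bn) B → Indicates (arrs σ $df) D →
             Indicates (arrs σ $nb) (neighbours G B) →
             Run W L scan σ 300 (λ τ → Spreads n D B (regs τ #go) × Scan G κ deg D B (arrs σ $dig (regs σ #len)) n
                 (regs τ #top) (regs τ #pick))
  run-scan {σ} {D} {B} st bn df nb = weaken (≤-lit _ 300) (λ _ → id)
    (run-≔⨾ (fits z≤n) (run-≔⨾ (fits z≤n) (run-≔⨾ (fits z≤n) (run-for Inv (n≡ st)
      (≤n-fits ≤-refl) for-vertices (inj₂ (refl , λ ()) , inj₁ (refl , λ ())) step))))
    where
    g = arrs σ $dig (regs σ #len)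

    Inv : ℕ → Store → Set
    Inv I τ = Spreads I D B (regs τ #go) × Scan G κ deg D B g I (regs τ #top) (regs τ #pick)

    σ₀ = setReg (setReg (setReg σ #go 0) #top 0) #pick 0

    skipped : ∀ {I go} {v : Fin n} → toℕ v ≡ I → ¬ (v ∉ B × v ∉ D) → Spreads I D B go → Spreads (suc I) D B go
    skipped refl ¬free (inj₁ r) = inj₁ r
    skipped refl ¬free (inj₂ (e , none)) = inj₂ (e , λ lt v∉B v∉D →
      [ (λ v<I → none v<I v∉B v∉D) , (λ v≡I → contradiction (v∉B , v∉D) (subst (λ z → ¬ (z ∉ B × z ∉ D))
          (sym (toℕ-injective v≡I)) ¬free)) ]′ (m<1+n⇒m<n∨m≡n lt))

    unlit : ∀ {go} {v : Fin n} → v ∉ neighbours G B → Spreads (toℕ v) D B go → Spreads (suc (toℕ v)) D B go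
    unlit v∉N (inj₁ r) = inj₁ r
    unlit v∉N (inj₂ (e , none)) = inj₂ (e , λ lt w∉B w∉D →
      [ (λ w<I → none w<I w∉B w∉D) , (λ w≡v → subst (_∉ neighbours G B) (sym (toℕ-injective w≡v)) v∉N) ]′ (m<1+n⇒m<n∨m≡n lt))

    step : ∀ {τ I} → Frame (for #i below #n loop scan-body) σ₀ τ → regs τ #i ≡ I → I < n → Inv I τ →
           Run W 1 scan-body τ _ _
    step {τ} {I} fr i≡I I<n (spr , sc) with vertex I<n
    ... | v , refl = run-cond
      (λ h → run-skip (skipped {v = v} refl (¬free h) spr , Scan-skip G κ deg v (¬free h) sc))
      (λ h → run-cond {Q = λ υ → Spreads (suc (toℕ v)) D B (regs υ #go)}
          (λ h′ → run-≔ 1-fits (inj₁ (refl , ignites (v∉B h) (v∉D h) (IndicatesAt-∈ (nb v) (subst (_≢ 0) nb-at h′)))))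
          (λ h′ → run-skip (quiet (IndicatesAt-∉ (nb v) (trans (sym nb-at) h′)))) ⟫ λ {υ} fr′ spr′ →
        run-≔⨾ (subst (_< W) (sym (score-at fr′)) score-fits)
        (run-cond
          (λ h′ → run-≔⨾ (subst (_< W) (sym (score-at fr′)) score-fits)
              (run-≔ (≤n-fits (subst (_≤ n) (sym (trans (reg= fr′ #i) i≡I)) (<⇒≤ I<n)))
             (spr′ , subst₂ (λ a b → Scan G κ deg D B g (suc (toℕ v)) a b) (sym (score-at fr′))
                 (sym (trans (reg= fr′ #i) i≡I))
                (Scan-take G κ deg v (v∉B h , v∉D h) (subst₂ _<_ (reg= fr′ #top) (score-at fr′) (⊏⇒< h′)) sc))))
          (λ h′ → run-skip (spr′ , subst₂ (λ a b → Scan G κ deg D B g (suc (toℕ v)) a b) (sym (reg= fr′ #top))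
              (sym (reg= fr′ #pick))
                (Scan-keep G κ deg v (≤⇒≯ (subst₂ _≤_ (score-at fr′) (reg= fr′ #top) (⊏⇒≥ h′))) sc)))))
      where
      st′ = Ready-frame fr (Ready-frame (setReg-frame #pick) (Ready-frame (setReg-frame #top) (Ready-frame (setReg-frame #go)
          st)))

      bn-at : arrs τ $bn (regs τ #i) ≡ arrs σ $bn (toℕ v)
      bn-at = cong₂ (λ f i → f i) (arr= fr $bn) i≡I
      df-at : arrs τ $df (regs τ #i) ≡ arrs σ $df (toℕ v)
      df-at = cong₂ (λ f i → f i) (arr= fr $df) i≡I
      nb-at : arrs τ $nb (regs τ #i) ≡ arrs σ $nb (toℕ v)
      nb-at = cong₂ (λ f i → f i) (arr= fr $nb) i≡I

      ¬free : arrs τ $bn (regs τ #i) + arrs τ $df (regs τ #i) ≢ 0 → ¬ (v ∉ B × v ∉ D)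
      ¬free h (v∉B , v∉D) with bn v | df v
      ... | inj₁ (v∈B , _) | _ = v∉B v∈B
      ... | inj₂ _ | inj₁ (v∈D , _) = v∉D v∈D
      ... | inj₂ (_ , e) | inj₂ (_ , e′) = h (cong₂ _+_ (trans bn-at e) (trans df-at e′))

      v∉B : arrs τ $bn (regs τ #i) + arrs τ $df (regs τ #i) ≡ 0 → v ∉ B
      v∉B h = IndicatesAt-∉ (bn v) (trans (sym bn-at) (m+n≡0⇒m≡0 _ h))
      v∉D : arrs τ $bn (regs τ #i) + arrs τ $df (regs τ #i) ≡ 0 → v ∉ D
      v∉D h = IndicatesAt-∉ (df v) (trans (sym df-at) (m+n≡0⇒n≡0 (arrs τ $bn (regs τ #i)) h))

      ignites : v ∉ B → v ∉ D → v ∈ neighbours G B → spread G D B ≢ B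
      ignites v∉B v∉D v∈N e = case neighbours⁻ G {B} v∈N of λ where
        (u , u∈B , u~v) → v∉B (subst (v ∈_) e (spread-new G u∈B u~v v∉D))

      quiet : v ∉ neighbours G B → Spreads (suc (toℕ v)) D B (regs τ #go)
      quiet v∉N = unlit v∉N spr

      score-at : ∀ {υ} → Frame (cond arr $nb (reg #i) then (#go ≔ lit 1) else skip) τ υ →
        eval υ ((lit 1 ⊕ (arr $off (reg #i ⊕ lit 1) ⊖ arr $off (reg #i)))
                    ⊕ ((arr $cls (reg #i) ≐ arr $dig (reg #len)) ⊗ (lit 1 ⊕ reg #n))) ≡ score G κ deg g v
      score-at {υ} fr′ = cong₂ _+_ (cong suc (trans (cong₂ _∸_ (off-at (cong (_+ 1) i′)) (off-at i′)) (off-deg v)))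
          (cong₂ _*_ (cong₂ (λ a b → 1 ∸ ((a ∸ b) + (b ∸ a))) cls-at dig-at) (cong suc (n≡ st″)))
        where
        st″ = Ready-frame fr′ st′
        i′ : regs υ #i ≡ toℕ v
        i′ = trans (reg= fr′ #i) i≡I
        off-at : ∀ {a b} → a ≡ b → arrs υ $off a ≡ off b
        off-at = cong₂ (λ f i → f i) (off≡ st″)
        cls-at : arrs υ $cls (regs υ #i) ≡ κ v
        cls-at = cong₂ (λ f i → f i) (cls≡ st″) i′
        dig-at : arrs υ $dig (regs υ #len) ≡ g
        dig-at = cong₂ (λ f i → f i) (trans (arr= fr′ $dig) (arr= fr $dig)) (trans (reg= fr′ #len) (reg= fr #len))

      score-fits : score G κ deg g v < W
      score-fits = fits (begin
        suc (deg v) + (1 ∸ ((κ v ∸ g) + (g ∸ κ v))) * suc n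
          ≤⟨ +-mono-≤ (s≤s (≤-trans (deg≤ v) (m≤m+n n M))) (*-mono-≤ (m∸n≤m 1 ((κ v ∸ g) + (g ∸ κ v))) (s≤s (m≤m+n n M))) ⟩
        L + 1 * L  ≤⟨ *-monoˡ-≤ L (≤-lit 2 4) ⟩
        4 * L      ∎)
        where open ≤-Reasoning

  run-ignite : ∀ {σ D B} → State σ → Indicates (arrs σ $bn) B → Indicates (arrs σ $df) D →
               Indicates (arrs σ $nb) (neighbours G B) →
               Run W L ignite σ 100 (λ τ → Indicates (arrs τ $bn) (spread G D B) × Clear (arrs τ $nb))
  run-ignite {σ} {D} {B} st bn df nb = weaken (≤-lit _ 100) (λ {τ} _ → all {τ}) (run-for
    Inv (n≡ st) (≤n-fits ≤-refl) for-vertices (λ v → inj₂ (z≤n , refl , refl)) step)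
    where
    Inv : ℕ → Store → Set
    Inv I τ = ∀ (v : Fin n) → (toℕ v < I × IndicatesAt (arrs τ $bn (toℕ v)) (spread G D B) v × arrs τ $nb (toℕ v) ≡ 0)
      ⊎ (I ≤ toℕ v × arrs τ $bn (toℕ v) ≡ arrs σ $bn (toℕ v) × arrs τ $nb (toℕ v) ≡ arrs σ $nb (toℕ v))

    all : ∀ {τ} → Inv n τ → Indicates (arrs τ $bn) (spread G D B) × Clear (arrs τ $nb)
    all {τ} inv = (λ v → [ proj₁ ∘ proj₂ , (λ (le , _) → contradiction (toℕ<n v) (≤⇒≯ le)) ]′ (inv v))
                , (λ v → [ proj₂ ∘ proj₂ , (λ (le , _) → contradiction (toℕ<n v) (≤⇒≯ le)) ]′ (inv v))

    body = (cond arr $nb (reg #i)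
      then (cond arr $df (reg #i) then skip else ($bn ⟦ reg #i ⟧≔ lit 1))
      else skip) ⨾
     $nb ⟦ reg #i ⟧≔ lit 0

    step : ∀ {τ I} → Frame ignite σ τ → regs τ #i ≡ I → I < n → Inv I τ → Run W 1 body τ _
        (λ υ → Inv (suc I) (setReg υ #i (suc I)))
    step {τ} {I} fr i≡I I<n inv with vertex I<n
    ... | v , refl = run-cond {Q = Lit}
        (λ h → run-cond
          (λ h′ → run-skip (inj₁ (p⊆p∪q _ , protected (IndicatesAt-∈ (df v) (subst (_≢ 0) df-at h′)) , λ _ → refl)))
          (λ h′ → run-⟦⟧≔ (≤n-fits i≤n) 1-fits (inj₂ (spread-at (IndicatesAt-∈ (nb v) (subst (_≢ 0) nb-at h))
                      (IndicatesAt-∉ (df v) (trans (sym df-at) h′)) , λ w → written w))))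
        (λ h → run-skip (inj₁ (p⊆p∪q _ , quiet (IndicatesAt-∉ (nb v) (trans (sym nb-at) h)) , λ _ → refl)))
      ⟫ λ {υ} fr′ lit-v → run-⟦⟧≔ (≤n-fits (subst (_≤ n) (sym (reg= fr′ #i)) i≤n)) (fits z≤n) (next fr′ lit-v)
      where
      nb-at : arrs τ $nb (regs τ #i) ≡ arrs σ $nb (toℕ v)
      nb-at = trans (cong (arrs τ $nb) i≡I) ([ (λ (lt , _) → contradiction lt (n≮n _)) , proj₂ ∘ proj₂ ]′ (inv v))
      df-at : arrs τ $df (regs τ #i) ≡ arrs σ $df (toℕ v)
      df-at = cong₂ (λ f i → f i) (arr= fr $df) i≡I
      bn-v : arrs τ $bn (toℕ v) ≡ arrs σ $bn (toℕ v)
      bn-v = [ (λ (lt , _) → contradiction lt (n≮n _)) , proj₁ ∘ proj₂ ]′ (inv v)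
      i≤n : regs τ #i ≤ n
      i≤n = subst (_≤ n) (sym i≡I) (<⇒≤ I<n)

      -- Merges the branches of the conditional: `v` is defended or no neighbour of the fire on one
      -- side, and set on fire on the other.
      Lit : Store → Set
      Lit υ = (B ⊆ spread G D B × (v ∈ spread G D B → v ∈ B) × ((w : Fin n) → arrs υ $bn (toℕ w) ≡ arrs τ $bn (toℕ w)))
            ⊎ (v ∈ spread G D B × ((w : Fin n) → (w ≡ v × arrs υ $bn (toℕ w) ≡ 1) ⊎ (w ≢ v × arrs υ $bn (toℕ w) ≡ arrs τ $bn
                (toℕ w))))

      protected : v ∈ D → v ∈ spread G D B → v ∈ B
      protected v∈D v∈ = [ id , (λ (v∉D , _) → contradiction v∈D v∉D) ]′ (spread⁻ G D B v∈)

      quiet : v ∉ neighbours G B → v ∈ spread G D B → v ∈ B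
      quiet v∉N v∈ = [ id , (λ (_ , u , u∈B , u~v) → contradiction (neighbours⁺ G u∈B u~v) v∉N) ]′ (spread⁻ G D B v∈)

      spread-at : v ∈ neighbours G B → v ∉ D → v ∈ spread G D B
      spread-at v∈N v∉D = case neighbours⁻ G {B} v∈N of λ where (u , u∈B , u~v) → spread-new G u∈B u~v v∉D

      written : (w : Fin n) → (w ≡ v × update (arrs τ $bn) (regs τ #i) 1 (toℕ w) ≡ 1)
                ⊎ (w ≢ v × update (arrs τ $bn) (regs τ #i) 1 (toℕ w) ≡ arrs τ $bn (toℕ w))
      written w with update-split (arrs τ $bn) (regs τ #i) 1 (toℕ w)
      ... | inj₁ (i≡w , e) = inj₁ (toℕ-injective (trans (sym i≡w) i≡I) , e)
      ... | inj₂ (i≢w , e) = inj₂ ((λ { refl → i≢w i≡I }) , e)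

      bn-new : ∀ {υ} → Lit υ → ∀ w → (w ≡ v × IndicatesAt (arrs υ $bn (toℕ w)) (spread G D B) w) ⊎
          (w ≢ v × arrs υ $bn (toℕ w) ≡ arrs τ $bn (toℕ w))
      bn-new (inj₁ (mono , back , same)) w with w ≟ᶠ v
      ... | no w≢v = inj₂ (w≢v , same w)
      ... | yes refl with bn w
      ...   | inj₁ (w∈B , e) = inj₁ (refl , inj₁ (mono w∈B , trans (same w) (trans bn-v e)))
      ...   | inj₂ (w∉B , e) = inj₁ (refl , inj₂ (w∉B ∘ back , trans (same w) (trans bn-v e)))
      bn-new (inj₂ (v∈ , chg)) w with chg w
      ... | inj₁ (refl , e) = inj₁ (refl , inj₁ (v∈ , e))
      ... | inj₂ r = inj₂ r

      next : ∀ {υ} → Frame (cond arr $nb (reg #i)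
               then (cond arr $df (reg #i) then skip else ($bn ⟦ reg #i ⟧≔ lit 1)) else skip) τ υ → Lit υ →
             Inv (suc (toℕ v)) (setReg (setArr υ $nb (regs υ #i) 0) #i (suc (toℕ v)))
      next {υ} fr′ lit-v w with bn-new {υ} lit-v w | update-split (arrs υ $nb) (regs υ #i) 0 (toℕ w)
      ... | inj₁ (refl , ind) | inj₁ (_ , e) = inj₁ (n<1+n _ , ind , e)
      ... | inj₁ (refl , _) | inj₂ (i≢w , _) = contradiction (trans (reg= fr′ #i) i≡I) i≢w
      ... | inj₂ (w≢v , _) | inj₁ (i≡w , _) = contradiction (toℕ-injective (trans (sym i≡w) (trans (reg= fr′ #i) i≡I))) w≢v
      ... | inj₂ (w≢v , e) | inj₂ (_ , e′) with inv w
      ...   | inj₁ (lt , ind , z) = inj₁ (m<n⇒m<1+n lt , subst (λ x → IndicatesAt x (spread G D B) w) (sym e) ind ,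
                trans e′ (trans (cong-app (arr= fr′ $nb) (toℕ w)) z))
      ...   | inj₂ (le , b , z) = inj₂ (≤∧≢⇒< le (w≢v ∘ sym ∘ toℕ-injective) , trans e b , trans e′
          (trans (cong-app (arr= fr′ $nb) (toℕ w)) z))

  T₀-fits : ∀ {x} → x ≤ T₀ → x < W
  T₀-fits le = fits (≤-trans le (≤-trans T₀≤ (≤-trans (≤-reflexive (cong suc (sym (+-suc n n))))
    (+-mono-≤ (s≤s (m≤m+n n M)) (≤-trans (s≤s (m≤m+n n M)) (m≤m+n L _))))))

  -- At most `T₀` rounds with a defence, one that finds the fire stuck, and the last test of the
  -- loop make `2 + T₀` units of `L`.
  V : ℕ
  V = (2 + T₀) * L

  module _ (g : ℕ → ℕ) where

    -- Plays are built from the front, but the loop appends moves at the end; so `complete` and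
    -- `burned` say how any continuation of the present state extends to the whole process. The
    -- shifted guesses `h` agree with `g` pointwise, which avoids function extensionality. The last
    -- round leaves its marks in `$nb`, hence the premise of `nb-clear`.
    record Running (τ : Store) : Set where
      field
        {D B}    : Subset n
        vs       : List (Fin n)
        T′       : ℕ
        bn-B     : Indicates (arrs τ $bn) B
        df-D     : Indicates (arrs τ $df) D
        nb-clear : regs τ #go ≢ 0 → Clear (arrs τ $nb)
        len≡     : regs τ #len ≡ length vs
        left     : T′ + length vs ≡ T₀
        layered  : Layered G (length vs) D B
        stored   : Stored (arrs τ $now) vs
        complete : ∀ {h us} → (∀ i → h i ≡ g (i + length vs)) → Play G κ deg T′ h D B us → Play G κ deg T₀ g ⊥ ⁅ s ⁆
            (vs ++ us)
        burned   : ∀ us → burnedFrom G ⊥ ⁅ s ⁆ (vs ++ us) ≡ burnedFrom G D B us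
        going    : regs τ #go ≡ 1 ⊎ (regs τ #go ≡ 0 × spread G D B ≡ B)

    -- The summand `#go` makes the measure drop also in the last round, which defends nothing.
    μ : Store → ℕ
    μ τ = (T₀ ∸ regs τ #len) + regs τ #go

    go-case : ∀ {D B go} → Spreads n D B go → (go ≡ 1 × spread G D B ≢ B) ⊎ (go ≡ 0 × spread G D B ≡ B)
    go-case (inj₁ r) = inj₁ r
    go-case {D} {B} (inj₂ (e , none)) = inj₂ (e , stable G λ {u} {w} u∈B u~w w∉D → case toSum (w ∈? B) of λ where
      (inj₁ w∈B) → w∈B
      (inj₂ w∉B) → contradiction (neighbours⁺ G u∈B u~w) (none (toℕ<n w) w∉B w∉D))

    Indicates-∪ : ∀ A {i} {D : Subset n} p → i ≡ toℕ p → Indicates A D → Indicates (update A i 1) (D ∪ ⁅ p ⁆)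
    Indicates-∪ A {D = D} p refl ind v with update-split A (toℕ p) 1 (toℕ v) | ind v
    ... | inj₁ (p≡v , e) | _ rewrite toℕ-injective p≡v = inj₁ (∈-∪-new v , e)
    ... | inj₂ (p≢v , e) | inj₁ (v∈ , e′) = inj₁ (∈-∪ˡ v∈ , trans e e′)
    ... | inj₂ (p≢v , e) | inj₂ (v∉ , e′) = inj₂ (∉-∪ v∉ (λ v∈ → p≢v (cong toℕ (sym (x∈⁅y⁆⇒x≡y p v∈)))) , trans e e′)

    prepend : ℕ → (ℕ → ℕ) → ℕ → ℕ
    prepend x h zero    = x
    prepend x h (suc i) = h i

    length-∷ʳ : ∀ (us : List (Fin n)) {p} → length (us ++ p ∷ []) ≡ suc (length us)
    length-∷ʳ us = trans (length-++ us) (+-comm (length us) 1)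

    run-round : ∀ {σ} → State σ → arrs σ $dig ≡ g → Running σ → regs σ #go ≢ 0 →
                Run W L round σ 1000 (λ τ → Running τ × μ τ < μ σ)
    run-round {σ} st dig R go≢0 = weaken (≤-lit _ 1000) (λ _ → id)
      (run-frontier st (bn-B R) (nb-clear R go≢0) ⟫ λ {τ} fr nb →
       let stτ = Ready-frame fr st
           bnτ = subst (λ A → Indicates A (B R)) (sym (arr= fr $bn)) (bn-B R)
           dfτ = subst (λ A → Indicates A (D R)) (sym (arr= fr $df)) (df-D R)
       in run-scan stτ bnτ dfτ nb ⟫ λ {υ} fr′ (spr , sc) →
       let stυ = Ready-frame fr′ stτ
           bnυ = subst (λ A → Indicates A (B R)) (sym (arr= fr′ $bn)) bnτ
           dfυ = subst (λ A → Indicates A (D R)) (sym (arr= fr′ $df)) dfτ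
           nbυ = subst (λ A → Indicates A (neighbours G (B R))) (sym (arr= fr′ $nb)) nb
           lenυ = trans (reg= fr′ #len) (reg= fr #len)
           nowυ = trans (arr= fr′ $now) (arr= fr $now)
           sc′ = subst (λ x → Scan G κ deg (D R) (B R) x n (regs υ #top) (regs υ #pick))
                   (cong₂ (λ f i → f i) (trans (arr= fr $dig) dig) (trans (reg= fr #len) (len≡ R))) sc
       in run-cond (λ h → move-on stυ bnυ dfυ nbυ lenυ nowυ (go-case {D R} {B R} spr) sc′ h)
                   (λ h → run-skip (halt bnυ dfυ lenυ nowυ (go-case {D R} {B R} spr) h)))
      where
      open Running
      halt : ∀ {υ} → Indicates (arrs υ $bn) (B R) → Indicates (arrs υ $df) (D R) →
             regs υ #len ≡ regs σ #len → arrs υ $now ≡ arrs σ $now →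
             (regs υ #go ≡ 1 × spread G (D R) (B R) ≢ B R) ⊎ (regs υ #go ≡ 0 × spread G (D R) (B R) ≡ B R) →
             regs υ #go ≡ 0 → Running υ × μ υ < μ σ
      halt bn df len now (inj₁ (e , _)) h = contradiction (trans (sym e) h) λ ()
      halt {υ} bn df len now (inj₂ (e , eq)) h = record
        { vs = vs R ; T′ = T′ R ; bn-B = bn ; df-D = df ; nb-clear = λ ≢0 → contradiction e ≢0
        ; len≡ = trans len (len≡ R) ; left = left R ; layered = layered R
        ; stored = subst (λ A → Stored A (vs R)) (sym now) (stored R)
        ; complete = complete R ; burned = burned R ; going = inj₂ (e , eq) }
        , subst₂ (λ x y → (T₀ ∸ x) + y < μ σ) (sym len) (sym e) (+-monoʳ-< (T₀ ∸ regs σ #len) (n≢0⇒n>0 go≢0))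

      move-on : ∀ {υ} → State υ → Indicates (arrs υ $bn) (B R) → Indicates (arrs υ $df) (D R) →
             Indicates (arrs υ $nb) (neighbours G (B R)) →
             regs υ #len ≡ regs σ #len → arrs υ $now ≡ arrs σ $now →
             (regs υ #go ≡ 1 × spread G (D R) (B R) ≢ B R) ⊎ (regs υ #go ≡ 0 × spread G (D R) (B R) ≡ B R) →
             Scan G κ deg (D R) (B R) (g (length (vs R))) n (regs υ #top) (regs υ #pick) →
             regs υ #go ≢ 0 → Run W L _ υ _ (λ τ → Running τ × μ τ < μ σ)
      move-on _ _ _ _ _ _ (inj₂ (e , _)) _ h = contradiction e h
      move-on {υ} st bn df nb len now (inj₁ (e , ≢B)) sc h with Scan⇒Pick G κ deg ≢B sc | T′ R in T′≡
      -- Without a round left the fire would be stuck by `stable-at`; so `#len` is below `T₀`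
      -- whenever a vertex is defended.
      ... | p , pick≡ , P | zero = contradiction (stable-at (layered R)
          (≤-reflexive (trans (sym (left R)) (cong (_+ length (vs R)) T′≡)))) ≢B
      ... | p , pick≡ , P | suc T″ =
        run-⟦⟧≔⨾ pick-fits 1-fits
        (run-⟦⟧≔⨾ len-fits pick-fits
        (run-≔⨾ (subst (_< W) (sym (trans (cong (_+ 1) len-υ) (+-comm (length (vs R)) 1))) (T₀-fits len<T₀))
        (weaken ≤-refl (λ {τ} fr (bn′ , nb′) → continue fr bn′ nb′)
        (run-ignite {D = D R ∪ ⁅ p ⁆}
          (record { n≡ = n≡ st ; s≡ = s≡ st ; m≡ = m≡ st ; T≡ = T≡ st ; c≡ = c≡ st ; off≡ = off≡ st ; adj≡ = adj≡ st ; src≡ =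
              src≡ st ; cls≡ = cls≡ st })
          bn (Indicates-∪ (arrs υ $df) p pick≡ df) nb))))
        where
        pick-fits : regs υ #pick < W
        pick-fits = ≤n-fits (subst (_≤ n) (sym pick≡) (<⇒≤ (toℕ<n p)))

        len-υ : regs υ #len ≡ length (vs R)
        len-υ = trans len (len≡ R)

        left′ : suc T″ + length (vs R) ≡ T₀
        left′ = trans (cong (_+ length (vs R)) (sym T′≡)) (left R)

        len<T₀ : length (vs R) < T₀
        len<T₀ = subst (length (vs R) <_) left′ (s≤s (m≤n+m _ T″))

        len-fits : regs υ #len < W
        len-fits = subst (_< W) (sym len-υ) (T₀-fits (<⇒≤ len<T₀))

        σ′ = setReg (setArr (setArr υ $df (regs υ #pick) 1) $now (regs υ #len) (regs υ #pick)) #len (regs υ #len + 1)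

        continue : ∀ {τ} → Frame ignite σ′ τ → Indicates (arrs τ $bn) (spread G (D R ∪ ⁅ p ⁆) (B R)) →
                   Clear (arrs τ $nb) → Running τ × μ τ < μ σ
        continue {τ} fr bn′ nb′ = record
          { vs = vs R ++ p ∷ [] ; T′ = T″ ; bn-B = bn′
          ; df-D = subst (λ A → Indicates A (D R ∪ ⁅ p ⁆)) (sym (arr= fr $df)) (Indicates-∪ (arrs υ $df) p pick≡ df)
          ; nb-clear = λ _ → nb′
          ; len≡ = trans len-τ (sym (length-∷ʳ (vs R)))
          ; left = trans (cong (T″ +_) (length-∷ʳ (vs R))) (trans (+-suc T″ _) left′)
          ; layered = subst (λ t → Layered G t (D R ∪ ⁅ p ⁆) (spread G (D R ∪ ⁅ p ⁆) (B R))) (sym (length-∷ʳ (vs R)))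
              (Layered-step G p (layered R))
          ; stored = Stored-∷ʳ (vs R) (Stored-cong (vs R) older (stored R)) newest
          ; complete = λ {h} {us} h≡ play → subst (Play G κ deg T₀ g ⊥ ⁅ s ⁆) (sym (++-assoc (vs R) (p ∷ []) us))
              (complete R (prepended h≡) (subst (λ t → Play G κ deg t (prepend (g (length (vs R))) h) (D R) (B R) (p ∷ us))
                  (sym T′≡) (move ≢B P play)))
          ; burned = λ us → trans (cong (burnedFrom G ⊥ ⁅ s ⁆) (++-assoc (vs R) (p ∷ []) us)) (burned R (p ∷ us))
          ; going = inj₁ go-τ }
          , subst₂ (λ x y → (T₀ ∸ x) + y < μ σ) (sym len-τ) (sym go-τ)
              decrease
          where
          shift : ∀ {a b} → a < b → b ∸ a ≡ suc (b ∸ suc a)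
          shift {a} {b} a<b = trans (cong (_∸ a) (sym (m∸n+n≡m a<b))) (trans (cong (_∸ a) (+-suc (b ∸ suc a) a))
              (m+n∸n≡m (suc (b ∸ suc a)) a))

          prepended : ∀ {h} → (∀ i → h i ≡ g (i + length (vs R ++ p ∷ []))) →
                      ∀ i → prepend (g (length (vs R))) h i ≡ g (i + length (vs R))
          prepended h≡ zero    = refl
          prepended h≡ (suc i) = trans (h≡ i) (cong g (trans (cong (i +_) (length-∷ʳ (vs R))) (+-suc i _)))

          decrease : (T₀ ∸ suc (length (vs R))) + 1 < μ σ
          decrease = begin
            suc ((T₀ ∸ suc (length (vs R))) + 1)      ≡⟨ cong suc (+-comm _ 1) ⟩
            suc (suc (T₀ ∸ suc (length (vs R))))      ≡⟨ cong suc (shift len<T₀) ⟨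
            suc (T₀ ∸ length (vs R))                  ≡⟨ +-comm 1 _ ⟩
            (T₀ ∸ length (vs R)) + 1                  ≤⟨ +-monoʳ-≤ (T₀ ∸ length (vs R)) (n≢0⇒n>0 go≢0) ⟩
            (T₀ ∸ length (vs R)) + regs σ #go         ≡⟨ cong (λ x → (T₀ ∸ x) + regs σ #go) (len≡ R) ⟨
            μ σ                                       ∎
            where open ≤-Reasoning

          len-τ : regs τ #len ≡ suc (length (vs R))
          len-τ = trans (reg= fr #len) (trans (cong (_+ 1) len-υ) (+-comm _ 1))

          go-τ : regs τ #go ≡ 1
          go-τ = trans (reg= fr #go) e

          now-τ : arrs τ $now ≡ update (arrs υ $now) (regs υ #len) (regs υ #pick)
          now-τ = arr= fr $now

          older : ∀ i → i < length (vs R) → arrs σ $now i ≡ arrs τ $now i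
          older i i< = sym (trans (cong-app now-τ i)
              (trans (update-≢ (arrs υ $now) {regs υ #len} (λ { refl → <-irrefl len-υ i< })) (cong-app now i)))

          newest : arrs τ $now (length (vs R)) ≡ toℕ p
          newest = trans (cong-app now-τ _) (trans (cong (update (arrs υ $now) (regs υ #len) (regs υ #pick)) (sym len-υ))
              (trans (update-≡ (arrs υ $now) (regs υ #len)) pick≡))

    Simulated : Store → Set
    Simulated τ = ∃ λ vs → Play G κ deg T₀ g ⊥ ⁅ s ⁆ vs × regs τ #len ≡ length vs × length vs ≤ T₀ × Stored (arrs τ $now) vs
                  × Indicates (arrs τ $bn) (burnedFrom G ⊥ ⁅ s ⁆ vs)

    run-simulate : ∀ {σ} → State σ → arrs σ $dig ≡ g → Run W V simulate σ 2000 Simulated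
    run-simulate {σ} st dig = weaken (≤-lit _ 2000) (λ _ → id)
      (rescale (m≤m+n L _) (run-for Cleared (n≡ st) (≤n-fits ≤-refl) for-vertices (λ _ ()) clear-step) ⟫ λ {τ} fr cleared →
       run-⟦⟧≔⨾ (≤n-fits (subst (_≤ n) (sym (trans (reg= fr #s) (s≡ st))) (<⇒≤ (toℕ<n s)))) 1-fits
       (run-≔⨾ (fits z≤n)
       (run-≔⨾ 1-fits
       (weaken ≤-refl (λ _ → finish)
       (run-while {U = L} {N = suc T₀} Running μ (initial fr cleared) (≤-reflexive (+-comm T₀ 1)) ≤-refl
         (λ {υ} fr′ R go → run-round (Ready-frame fr′ (kindled-state (Ready-frame fr st)))
            (trans (arr= fr′ $dig) (trans (arr= fr $dig) dig)) R go))))))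
      where
      clear-body : Program
      clear-body = $bn ⟦ reg #i ⟧≔ lit 0 ⨾ $df ⟦ reg #i ⟧≔ lit 0 ⨾ $nb ⟦ reg #i ⟧≔ lit 0

      Cleared : ℕ → Store → Set
      Cleared I τ = ∀ (v : Fin n) → toℕ v < I → arrs τ $bn (toℕ v) ≡ 0 × arrs τ $df (toℕ v) ≡ 0 × arrs τ $nb (toℕ v) ≡ 0

      kindled : Store → Store
      kindled τ = setReg (setReg (setArr τ $bn (regs τ #s) 1) #len 0) #go 1

      kindled-state : ∀ {τ} → State τ → State (kindled τ)
      kindled-state st = record { n≡ = n≡ st ; s≡ = s≡ st ; m≡ = m≡ st ; T≡ = T≡ st ; c≡ = c≡ st ; off≡ = off≡ st ; adj≡ =
          adj≡ st ; src≡ = src≡ st ; cls≡ = cls≡ st }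

      clear-step : ∀ {τ I} → Frame (for #i below #n loop clear-body) σ τ → regs τ #i ≡ I → I < n → Cleared I τ →
                   Run W 1 clear-body τ _ (λ υ → Cleared (suc I) (setReg υ #i (suc I)))
      clear-step {τ} fr refl I<n cleared = run-⟦⟧≔⨾ i-fits (fits z≤n)
          (run-⟦⟧≔⨾ i-fits (fits z≤n) (run-⟦⟧≔ i-fits (fits z≤n) next))
        where
        i-fits : regs τ #i < W
        i-fits = ≤n-fits (<⇒≤ I<n)

        zeroed : ∀ {A : ℕ → ℕ} (v : Fin n) → toℕ v < suc (regs τ #i) → (toℕ v < regs τ #i → A (toℕ v) ≡ 0) → update A
            (regs τ #i) 0 (toℕ v) ≡ 0
        zeroed {A} v lt old with update-split A (regs τ #i) 0 (toℕ v)
        ... | inj₁ (_ , e)   = e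
        ... | inj₂ (i≢v , e) = trans e (old (≤∧≢⇒< (s≤s⁻¹ lt) (i≢v ∘ sym)))

        next : ∀ (v : Fin n) → toℕ v < suc (regs τ #i) → _ × _ × _
        next v lt = zeroed {arrs τ $bn} v lt (λ v<i → proj₁ (cleared v v<i)) , zeroed {arrs τ $df} v lt
            (λ v<i → proj₁ (proj₂ (cleared v v<i)))
                  , zeroed {arrs τ $nb} v lt (λ v<i → proj₂ (proj₂ (cleared v v<i)))

      initial : ∀ {τ} → Frame (for #i below #n loop clear-body) σ τ → Cleared n τ → Running (kindled τ)
      initial {τ} fr cleared = record
        { D = ⊥ ; B = ⁅ s ⁆ ; vs = [] ; T′ = T₀ ; bn-B = bn
        ; df-D = λ v → inj₂ (∉⊥ , proj₁ (proj₂ (cleared v (toℕ<n v))))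
        ; nb-clear = λ _ v → proj₂ (proj₂ (cleared v (toℕ<n v)))
        ; len≡ = refl ; left = +-identityʳ T₀ ; layered = Layered-init G s ; stored = tt
        ; complete = λ h≡ → Play-cong G κ deg (λ i _ → trans (h≡ i) (cong g (+-identityʳ i)))
        ; burned = λ _ → refl ; going = inj₁ refl }
        where
        bn : Indicates (update (arrs τ $bn) (regs τ #s) 1) ⁅ s ⁆
        bn v with update-split (arrs τ $bn) (regs τ #s) 1 (toℕ v)
        ... | inj₁ (s≡v , e) = inj₁ (subst (_∈ ⁅ s ⁆) (toℕ-injective (trans (sym (trans (reg= fr #s) (s≡ st))) s≡v))
            (x∈⁅x⁆ s) , e)
        ... | inj₂ (s≢v , e) = inj₂ ((λ v∈ → s≢v (trans (trans (reg= fr #s) (s≡ st)) (cong toℕ (sym (x∈⁅y⁆⇒x≡y s v∈))))) ,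
                                    trans e (proj₁ (cleared v (toℕ<n v))))

      finish : ∀ {υ} → Running υ × regs υ #go ≡ 0 → Simulated υ
      finish {υ} (R , done) with Running.going R
      ... | inj₁ e = contradiction (trans (sym e) done) λ ()
      ... | inj₂ (_ , eq) = vs ++ [] , complete (λ _ → refl) (stop eq) , trans len≡ (cong length (sym (++-identityʳ vs))) ,
              subst (λ us → length us ≤ T₀) (sym (++-identityʳ vs)) (subst (length vs ≤_) left (m≤n+m _ T′)) ,
              subst (Stored (arrs υ $now)) (sym (++-identityʳ vs)) stored ,
              subst (Indicates (arrs υ $bn)) (sym (burned [])) bn-B
        where open Running R

  L≤V : L ≤ V
  L≤V = m≤m+n L _

  -- Evaluation of a simulated strategy, and the exhaustive search

  run-tally : ∀ {σ B} → State σ → Indicates (arrs σ $bn) B → Run W L tally σ 100 (λ τ → regs τ #burnt ≡ ∣ B ∣)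
  run-tally {σ} {B} st bn = weaken (≤-lit _ 100) (λ _ (e , _) → trans e (sumBelow-∣∣ bn))
    (run-≔⨾ (fits z≤n) (run-for Inv (n≡ st) (≤n-fits ≤-refl) for-vertices (refl , z≤n) step))
    where
    Inv : ℕ → Store → Set
    Inv I τ = regs τ #burnt ≡ sumBelow (arrs σ $bn) I × regs τ #burnt ≤ I

    body = #burnt ≔ reg #burnt ⊕ arr $bn (reg #i)

    step : ∀ {τ I} → Frame (for #i below #n loop body) (setReg σ #burnt 0) τ → regs τ #i ≡ I → I < n → Inv I τ →
           Run W 1 body τ _ (λ υ → Inv (suc I) (setReg υ #i (suc I)))
    step {τ} {I} fr refl I<n (e , le) = run-≔ (≤n-fits (≤-trans le′ I<n)) (cong₂ _+_ e at-i , le′)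
      where
      at-i : arrs τ $bn I ≡ arrs σ $bn I
      at-i = cong-app (arr= fr $bn) I

      at-most-1 : arrs σ $bn I ≤ 1
      at-most-1 with vertex I<n
      ... | v , v≡I with bn v
      ...   | inj₁ (_ , e′) = ≤-reflexive (trans (cong (arrs σ $bn) (sym v≡I)) e′)
      ...   | inj₂ (_ , e′) = ≤-trans (≤-reflexive (trans (cong (arrs σ $bn) (sym v≡I)) e′)) z≤n

      le′ : regs τ #burnt + arrs τ $bn I ≤ suc I
      le′ = subst (regs τ #burnt + arrs τ $bn I ≤_) (+-comm I 1) (+-mono-≤ le (subst (_≤ 1) (sym at-i) at-most-1))

  Burnt : List (Fin n) → ℕ
  Burnt vs = ∣ burnedFrom G ⊥ ⁅ s ⁆ vs ∣

  Burnt≤n : ∀ vs → Burnt vs ≤ n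
  Burnt≤n vs = ∣p∣≤n (burnedFrom G ⊥ ⁅ s ⁆ vs)

  Best : Store → Set
  Best τ = ∃ λ vs → Valid G s vs × regs τ #best ≡ Burnt vs × regs τ #best-len ≡ length vs × length vs ≤ T₀ × Stored
      (arrs τ $best) vs

  run-keep-best : ∀ {σ vs} → Valid G s vs → regs σ #burnt ≡ Burnt vs → regs σ #len ≡ length vs → length vs ≤ T₀ →
                  Stored (arrs σ $now) vs → regs σ #best ≡ suc n ⊎ Best σ →
                  Run W V keep-best σ 100 (λ τ → Best τ × regs τ #best ≤ Burnt vs × regs τ #best ≤ regs σ #best)
  run-keep-best {σ} {vs} val burnt≡ len≡ len≤ stored old = weaken (≤-lit _ 100) (λ _ → id) (run-cond
    (λ h → run-≔⨾ (≤n-fits (subst (_≤ n) (sym burnt≡) (Burnt≤n vs)))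
      (run-≔⨾ (T₀-fits (subst (_≤ T₀) (sym len≡) len≤))
      (weaken ≤-refl (λ {τ} fr copied →
          (vs , val , trans (reg= fr #best) burnt≡ , trans (reg= fr #best-len) len≡ , len≤ ,
             Stored-cong vs (λ i i< → sym (copied i i<)) stored) ,
          ≤-reflexive (trans (reg= fr #best) burnt≡) , subst (_≤ regs σ #best) (sym (reg= fr #best)) (<⇒≤ (⊏⇒< h)))
      (run-for {U = 1} (λ I τ → ∀ i → i < I → arrs τ $best i ≡ arrs σ $now i) len≡
         (T₀-fits len≤) for-prefix (λ _ ()) step))))
    (λ h → run-skip (still (⊏⇒≥ h) old , subst (regs σ #best ≤_) burnt≡ (⊏⇒≥ h) , ≤-refl)))
    where
    for-prefix : suc (length vs) * 1 ≤ V
    for-prefix = ≤-trans (*-mono-≤ (s≤s (≤-trans len≤ (n≤1+n T₀))) (s≤s z≤n)) ≤-refl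

    still : regs σ #best ≤ regs σ #burnt → regs σ #best ≡ suc n ⊎ Best σ → Best σ
    still le (inj₂ b) = b
    still le (inj₁ e) = contradiction (≤-trans (≤-trans (≤-reflexive (sym e)) le) (≤-trans (≤-reflexive burnt≡)
        (Burnt≤n vs))) (n≮n n)

    σ₀ = setReg (setReg σ #best (regs σ #burnt)) #best-len (regs σ #len)
    copy = $best ⟦ reg #i ⟧≔ arr $now (reg #i)

    step : ∀ {τ I} → Frame (for #i below #len loop copy) σ₀ τ → regs τ #i ≡ I → I < length vs →
           (∀ i → i < I → arrs τ $best i ≡ arrs σ $now i) →
           Run W 1 copy τ _ (λ υ → ∀ i → i < suc I → arrs υ $best i ≡ arrs σ $now i)
    step {τ} {I} fr refl I< copied = run-⟦⟧≔ (T₀-fits (≤-trans (<⇒≤ I<) len≤)) (subst (_< W) (sym at-I) now-fits) next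
      where
      at-I : arrs τ $now I ≡ arrs σ $now I
      at-I = cong-app (arr= fr $now) I

      now-fits : arrs σ $now I < W
      now-fits = ≤n-fits (Stored-≤n vs stored I I<)

      next : ∀ i → i < suc I → update (arrs τ $best) I (arrs τ $now I) i ≡ arrs σ $now i
      next i i<sI with update-split (arrs τ $best) I (arrs τ $now I) i
      ... | inj₁ (refl , e) = trans e at-I
      ... | inj₂ (I≢i , e)  = trans e (copied i (≤∧≢⇒< (s≤s⁻¹ i<sI) (I≢i ∘ sym)))

  run-increment : ∀ {σ} → State σ → Digits c T₀ (arrs σ $dig) →
    Run W V increment σ 200 (λ τ →
      (regs τ #on ≡ regs σ #on × Digits c T₀ (arrs τ $dig) × value c T₀ (arrs τ $dig) ≡ suc (value c T₀ (arrs σ $dig)))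
      ⊎ (regs τ #on ≡ 0 × c ^ T₀ ≤ suc (value c T₀ (arrs σ $dig))))
  run-increment {σ} st digits = weaken (≤-lit _ 200) (λ _ → id)
    (run-≔⨾ (fits z≤n)
    (run-while {U = 1} {N = T₀} Inv (λ τ → T₀ ∸ regs τ #i) (z≤n , digits , +-comm _ 1) ≤-refl for-digits carry ⟫ finish))
    where
    value₀ = value c T₀ (arrs σ $dig)

    -- Zeroing i digits equal to c - 1 leaves a carry of c ^ i.
    Inv : Store → Set
    Inv τ = regs τ #i ≤ T₀ × Digits c T₀ (arrs τ $dig) × value c T₀ (arrs τ $dig) + c ^ regs τ #i ≡ suc value₀

    for-digits : suc T₀ * 1 ≤ V
    for-digits = *-mono-≤ (n≤1+n (suc T₀)) (s≤s z≤n)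

    test : Expr
    test = (reg #i ⊏ reg #T) ⊗ (reg #c ⊏ (arr $dig (reg #i) ⊕ lit 2))

    carry-body : Program
    carry-body = $dig ⟦ reg #i ⟧≔ lit 0 ⨾ #i ≔ reg #i ⊕ lit 1

    σ₀ = setReg σ #i 0

    carry : ∀ {τ} → Frame carry-body σ₀ τ → Inv τ → eval τ test ≢ 0 →
            Run W 1 carry-body τ _ (λ υ → Inv υ × T₀ ∸ regs υ #i < T₀ ∸ regs τ #i)
    carry {τ} fr (i≤ , dig< , val) h = run-⟦⟧≔⨾ (T₀-fits i≤) (fits z≤n) (run-≔ (subst (_< W) (sym i+1) (T₀-fits i<T₀))
        ((subst (_≤ T₀) (sym i+1) i<T₀ , Digits-update d i (≤-<-trans z≤n (dig< i i<T₀)) dig< , subst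
            (λ z → value c T₀ d′ + c ^ z ≡ suc value₀) (sym i+1) new-value)
        , subst (λ z → T₀ ∸ z < T₀ ∸ i) (sym i+1) (∸-monoʳ-< (n<1+n i) i<T₀)))
      where
      i = regs τ #i
      d = arrs τ $dig
      d′ = update d i 0

      i+1 : i + 1 ≡ suc i
      i+1 = +-comm i 1

      i<T₀ : i < T₀
      i<T₀ = subst (i <_) (trans (reg= fr #T) (T≡ st))
          (⊏⇒< {i} {regs τ #T} (λ z → h (cong (_* (if regs τ #c <ᵇ d i + 2 then 1 else 0)) z)))

      top-digit : suc (d i) ≡ c
      top-digit = ≤-antisym (dig< i i<T₀) (s≤s⁻¹ (subst₂ _<_ (trans (reg= fr #c) (c≡ st)) (+-comm (d i) 2)
             (⊏⇒< {regs τ #c} {d i + 2} (λ z → h (trans (cong ((if i <ᵇ regs τ #T then 1 else 0) *_) z)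
                 (*-zeroʳ (if i <ᵇ regs τ #T then 1 else 0)))))))

      new-value : value c T₀ d′ + c ^ suc i ≡ suc value₀
      new-value = begin
        value c T₀ d′ + c * c ^ i                   ≡⟨ cong (λ z → value c T₀ d′ + z * c ^ i) top-digit ⟨
        value c T₀ d′ + (c ^ i + d i * c ^ i)       ≡⟨ solve 3 (λ a b e → a :+ (b :+ e) := a :+ e :+ b) refl (value c T₀ d′)
            (c ^ i) (d i * c ^ i) ⟩
        value c T₀ d′ + d i * c ^ i + c ^ i         ≡⟨ cong (_+ c ^ i) (trans (value-update {c} d 0 i<T₀) (+-identityʳ _)) ⟩
        value c T₀ d + c ^ i                        ≡⟨ val ⟩
        suc value₀                                  ∎
        where open ≡-Reasoning

    finish : ∀ {τ} → Frame (while test loop carry-body) σ₀ τ → Inv τ × eval τ test ≡ 0 →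
             Run W V (cond reg #i ⊏ reg #T then ($dig ⟦ reg #i ⟧≔ (arr $dig (reg #i) ⊕ lit 1)) else (#on ≔ lit 0)) τ _ _
    finish {τ} fr ((i≤ , dig< , val) , h) = run-cond
      (λ lt → let i<T₀ = subst (i <_) T≡τ (⊏⇒< lt) in
        run-⟦⟧≔ (T₀-fits i≤) (<-trans (small lt) c-fits) (inj₁ (reg= fr #on , Digits-update d i (small lt) dig< , new-value
            i<T₀)))
      -- The carry has passed through all `T₀` digits, so the old value was the last one,
      -- `c ^ T₀ - 1`.
      (λ ge → run-≔ (fits z≤n) (inj₂ (refl , subst (λ z → c ^ z ≤ suc value₀) (≤-antisym i≤ (subst (_≤ i) T≡τ (⊏⇒≥ ge)))
          (subst (c ^ i ≤_) val (m≤n+m _ _)))))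
      where
      i = regs τ #i
      d = arrs τ $dig
      T≡τ = trans (reg= fr #T) (T≡ st)

      -- The test of the loop has failed although its first factor holds. So the second one fails,
      -- and the digit can be raised without reaching `c`.
      small : (if i <ᵇ regs τ #T then 1 else 0) ≢ 0 → d i + 1 < c
      small nz with m*n≡0⇒m≡0∨n≡0 (if i <ᵇ regs τ #T then 1 else 0) h
      ... | inj₁ z = contradiction z nz
      ... | inj₂ z = subst₂ _≤_ (trans (+-comm (d i) 2) (cong suc (+-comm 1 (d i)))) (trans (reg= fr #c) (c≡ st))
          (⊏⇒≥ {regs τ #c} {d i + 2} z)

      new-value : i < T₀ → value c T₀ (update d i (d i + 1)) ≡ suc value₀
      new-value i<T₀ = +-cancelʳ-≡ (d i * c ^ i) _ _ (begin
        value c T₀ (update d i (d i + 1)) + d i * c ^ i   ≡⟨ value-update {c} d (d i + 1) i<T₀ ⟩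
        value c T₀ d + (d i + 1) * c ^ i                  ≡⟨ solve 3 (λ a b e → a :+ (b :+ con 1) :* e := a :+ e :+ b :* e)
            refl (value c T₀ d) (d i) (c ^ i) ⟩
        value c T₀ d + c ^ i + d i * c ^ i                ≡⟨ cong (_+ d i * c ^ i) val ⟩
        suc value₀ + d i * c ^ i                          ∎)
        where open ≡-Reasoning

  Tried : ℕ → ℕ → Set
  Tried x b = ∀ g → Digits c T₀ g → value c T₀ g < x → ∃ λ vs → Play G κ deg T₀ g ⊥ ⁅ s ⁆ vs × b ≤ Burnt vs

  Searched : Store → Set
  Searched τ = Best τ × Tried (c ^ T₀) (regs τ #best)

  run-search : ∀ {σ} → State σ → Digits c T₀ (arrs σ $dig) → value c T₀ (arrs σ $dig) ≡ 0 →
               Run W (suc (c ^ T₀) * V) search σ 5000 Searched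
  run-search {σ} st digits zero-value = weaken (≤-lit _ 5000) (λ _ → id)
    (run-≔⨾ {{nz}} 1-fits
    (run-≔⨾ {{nz}} (subst (_< W) (cong suc (sym (n≡ st))) (fits (≤-trans (s≤s (m≤m+n n M)) (m≤m+n L _))))
    (run-≔⨾ {{nz}} (fits z≤n)
    (weaken ≤-refl (λ {τ} _ → finish {τ})
    (run-while {U = V} {N = c ^ T₀} Inv measure
      (inj₁ (refl , digits , (λ _ _ lt → contradiction (subst (_ <_) zero-value lt) λ ()) , inj₁ (cong suc (n≡ st))))
      (≤-trans (≤-reflexive (+-identityʳ _)) (m∸n≤m (c ^ T₀) (value c T₀ (arrs σ $dig)))) ≤-refl body)))))
    where
    nz : NonZero (suc (c ^ T₀) * V)
    nz = m*n≢0 (suc (c ^ T₀)) V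

    Inv : Store → Set
    Inv τ = (regs τ #on ≡ 1 × Digits c T₀ (arrs τ $dig) × Tried (value c T₀ (arrs τ $dig)) (regs τ #best)
              × (regs τ #best ≡ suc n ⊎ Best τ))
          ⊎ (regs τ #on ≡ 0 × Searched τ)

    -- The factor `#on` ends the descent on overflow, when the value falls back to 0.
    measure : Store → ℕ
    measure τ = regs τ #on * (c ^ T₀ ∸ value c T₀ (arrs τ $dig))

    finish : ∀ {τ} → Inv τ × regs τ #on ≡ 0 → Searched τ
    finish (inj₁ (on , _) , off) = contradiction (trans (sym on) off) λ ()
    finish (inj₂ (_ , r) , _)    = r

    σ₀ = setReg (setReg (setReg σ #on 1) #best (1 + regs σ #n)) #best-len 0

    loop-body : Program
    loop-body = simulate ⨾ tally ⨾ keep-best ⨾ increment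

    st₀ : State σ₀
    st₀ = Ready-frame (setReg-frame #best-len) (Ready-frame (setReg-frame #best) (Ready-frame (setReg-frame #on) st))

    Best-frame : ∀ {p τ υ} → Frame p τ υ → {_ : T (not (writesReg p #best))} {_ : T (not (writesReg p #best-len))}
        {_ : T (not (writesArr p $best))} →
                 Best τ → Best υ
    Best-frame fr {a} {b} {d} (vs , val , e , e′ , le , stored) =
      vs , val , trans (reg= fr #best {a}) e , trans (reg= fr #best-len {b}) e′ , le , subst (λ A → Stored A vs)
          (sym (arr= fr $best {d})) stored

    Tried-next : ∀ {d vs b b′} → Play G κ deg T₀ d ⊥ ⁅ s ⁆ vs → Digits c T₀ d → b′ ≤ Burnt vs → b′ ≤ b →
                 Tried (value c T₀ d) b → Tried (suc (value c T₀ d)) b′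
    Tried-next {d} {vs} play d< b′≤ b′≤b tried g g< lt with m<1+n⇒m<n∨m≡n lt
    -- Equal values mean equal digits below `T₀`, and a play reads no others.
    ... | inj₂ eq = vs , Play-cong G κ deg (value-injective T₀ d< g< (sym eq)) play , b′≤
    ... | inj₁ lt′ with tried g g< lt′
    ...   | us , play′ , b≤ = us , play′ , ≤-trans b′≤b b≤

    body : ∀ {τ} → Frame loop-body σ₀ τ → Inv τ → regs τ #on ≢ 0 → Run W V loop-body τ _ (λ υ → Inv υ × measure υ < measure
        τ)
    body {τ} fr (inj₂ (off , _)) on = contradiction off on
    body {τ} fr (inj₁ (on , d< , tried , best)) _ =
      run-simulate (arrs τ $dig) stτ refl ⟫ λ {τ₁} f₁ (vs , play , len≡ , len≤ , stored , bn) →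
      let st₁ = Ready-frame f₁ stτ in
      rescale L≤V (run-tally st₁ bn) ⟫ λ {τ₂} f₂ burnt≡ →
      let st₂ = Ready-frame f₂ st₁ in
      run-keep-best (Play⇒Valid G κ deg play) burnt≡ (trans (reg= f₂ #len) len≡) len≤
          (subst (λ A → Stored A vs) (sym (arr= f₂ $now)) stored)
         ([ (λ e → inj₁ (trans (reg= f₂ #best) (trans (reg= f₁ #best) e))) , (λ b → inj₂ (Best-frame f₂ (Best-frame f₁ b)))
             ]′ best) ⟫ λ {τ₃} f₃ (best₃ , b≤ , b≤old) →
      let st₃ = Ready-frame f₃ st₂
          dig₃ : arrs τ₃ $dig ≡ arrs τ $dig
          dig₃ = trans (arr= f₃ $dig) (trans (arr= f₂ $dig) (arr= f₁ $dig))
          on₃ : regs τ₃ #on ≡ 1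
          on₃ = trans (reg= f₃ #on) (trans (reg= f₂ #on) (trans (reg= f₁ #on) on))
          tried₃ = Tried-next play d< b≤ (subst (regs τ₃ #best ≤_) (trans (reg= f₂ #best) (reg= f₁ #best)) b≤old) tried
      in weaken ≤-refl (λ {υ} f₄ post → next {υ} f₄ best₃ tried₃ on₃ (subst (λ d → _ ⊎ (_ × c ^ T₀ ≤ suc (value c T₀ d))) dig₃ (subst (λ d → (_ × _ × _ ≡ suc (value c T₀ d)) ⊎ _) dig₃ post)))
           (run-increment st₃ (subst (Digits c T₀) (sym dig₃) d<))
      where
      stτ = Ready-frame fr st₀

      next : ∀ {υ τ₃} → Frame increment τ₃ υ → Best τ₃ → Tried (suc (value c T₀ (arrs τ $dig))) (regs τ₃ #best) → regs τ₃ #on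
          ≡ 1 →
        (regs υ #on ≡ regs τ₃ #on × Digits c T₀ (arrs υ $dig) × value c T₀ (arrs υ $dig) ≡ suc (value c T₀ (arrs τ $dig)))
        ⊎ (regs υ #on ≡ 0 × c ^ T₀ ≤ suc (value c T₀ (arrs τ $dig))) → Inv υ × measure υ < measure τ
      next {υ} f b₃ t₃ on₃ (inj₁ (on′ , d′< , val)) =
        inj₁ (trans on′ on₃ , d′< , subst₂ Tried (sym val) (sym (reg= f #best)) t₃ , inj₂ (Best-frame f b₃)) ,
        subst₂ (λ x y → x * (c ^ T₀ ∸ value c T₀ (arrs υ $dig)) < y * (c ^ T₀ ∸ value c T₀ (arrs τ $dig)))
            (sym (trans on′ on₃)) (sym on)
          (+-monoˡ-< 0 (∸-monoʳ-< (≤-reflexive (sym val)) (<⇒≤ (value-bound T₀ d′<))))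
      next {υ} f b₃ t₃ on₃ (inj₂ (off , all)) =
        inj₂ (off , Best-frame f b₃ , λ g g< lt → subst (λ b → ∃ λ vs → _ × b ≤ Burnt vs) (sym (reg= f #best))
            (t₃ g g< (<-≤-trans lt all))) ,
        subst₂ (λ x y → x * (c ^ T₀ ∸ value c T₀ (arrs υ $dig)) < y * (c ^ T₀ ∸ value c T₀ (arrs τ $dig))) (sym off) (sym on)
          (≤-trans (m<n⇒0<n∸m (value-bound T₀ d<)) (m≤m+n _ 0))

  run-output : ∀ {σ} → Best σ → Run W V output σ 100 (λ τ → ∃ λ vs → Valid G s vs × regs σ #best ≡ Burnt vs × Outputs τ vs)
  run-output {σ} (vs , val , best≡ , len≡ , len≤ , stored) = weaken (≤-lit _ 100) (λ _ → id)
    (run-for {U = 1} Inv len≡ (T₀-fits len≤) (*-mono-≤ (s≤s (≤-trans len≤ (n≤1+n T₀))) (s≤s z≤n)) (λ _ ()) step ⟫ λ {τ} fr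
        copied →
     let len-τ = trans (reg= fr #best-len) len≡ in
     run-≔ (subst (_< W) (sym len-τ) (T₀-fits len≤))
       (vs , val , best≡ , trans (cong (λ l → map (arrs τ $off) (upTo l)) len-τ)
          (Stored-map vs (Stored-cong vs (λ i i< → sym (copied i i<)) stored))))
    where
    Inv : ℕ → Store → Set
    Inv I τ = ∀ i → i < I → arrs τ $off i ≡ arrs σ $best i

    copy = $off ⟦ reg #i ⟧≔ arr $best (reg #i)

    step : ∀ {τ I} → Frame (for #i below #best-len loop copy) σ τ → regs τ #i ≡ I → I < length vs → Inv I τ →
           Run W 1 copy τ _ (λ υ → Inv (suc I) (setReg υ #i (suc I)))
    step {τ} {I} fr refl I< copied = run-⟦⟧≔ (T₀-fits (≤-trans (<⇒≤ I<) len≤))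
        (subst (_< W) (sym at-I) (≤n-fits (Stored-≤n vs stored I I<))) next
      where
      at-I : arrs τ $best I ≡ arrs σ $best I
      at-I = cong-app (arr= fr $best) I

      next : ∀ i → i < suc I → update (arrs τ $off) I (arrs τ $best I) i ≡ arrs σ $best i
      next i i<sI with update-split (arrs τ $off) I (arrs τ $best I) i
      ... | inj₁ (refl , e) = trans e at-I
      ... | inj₂ (I≢i , e)  = trans e (copied i (≤∧≢⇒< (s≤s⁻¹ i<sI) (I≢i ∘ sym)))

-- Representation of the input

-- Unlike `at`, this relation needs no default value and carries the proof that the index is in
-- range.
data At {A : Set} : List A → ℕ → A → Set where
  zero : ∀ {x xs} → At (x ∷ xs) 0 x
  suc  : ∀ {x y xs i} → At xs i x → At (y ∷ xs) (suc i) x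

At-map : ∀ {n xs i} {x : Fin n} → At xs i x → at 0 (map toℕ xs) i ≡ toℕ x
At-map zero    = refl
At-map (suc a) = At-map a

At-∈ : {xs : List A} {x : A} {i : ℕ} → At xs i x → x ∈ˡ xs
At-∈ zero    = here refl
At-∈ (suc a) = there (At-∈ a)

At-< : {xs : List A} {x : A} {i : ℕ} → At xs i x → i < length xs
At-< zero    = s≤s z≤n
At-< (suc a) = s≤s (At-< a)

∈-At : {xs : List A} {x : A} → x ∈ˡ xs → ∃ λ i → At xs i x
∈-At (here refl) = 0 , zero
∈-At (there x∈) with ∈-At x∈
... | i , a = suc i , suc a

<-At : (xs : List A) (i : ℕ) → i < length xs → ∃ λ x → At xs i x
<-At (x ∷ xs) zero    _        = x , zero
<-At (x ∷ xs) (suc i) (s≤s lt) with <-At xs i lt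
... | y , a = y , suc a

At-++ˡ : {xs ys : List A} {x : A} {i : ℕ} → At xs i x → At (xs ++ ys) i x
At-++ˡ zero    = zero
At-++ˡ (suc a) = suc (At-++ˡ a)

At-++ʳ : (xs : List A) {ys : List A} {x : A} {i : ℕ} → At ys i x → At (xs ++ ys) (length xs + i) x
At-++ʳ []       a = a
At-++ʳ (_ ∷ xs) a = suc (At-++ʳ xs a)

At-tabulate : ∀ {n} (f : Fin n → A) v → At (tabulate f) (toℕ v) (f v)
At-tabulate f zero    = zero
At-tabulate f (suc v) = suc (At-tabulate (f ∘ suc) v)

offset : List (List A) → ℕ → ℕ
offset rows i = length (concat (take i rows))

offset-∷ : (r : List A) (rows : List (List A)) (i : ℕ) → offset (r ∷ rows) (suc i) ≡ length r + offset rows i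
offset-∷ r rows i = length-++ r

offset-mono : (rows : List (List A)) → ∀ {i j} → i ≤ j → offset rows i ≤ offset rows j
offset-mono []         {zero}  _         = z≤n
offset-mono []         {suc _} _         = z≤n
offset-mono (r ∷ rows) {zero}  _         = z≤n
offset-mono (r ∷ rows) {suc i} (s≤s {n = j} i≤j) =
  subst₂ _≤_ (sym (offset-∷ r rows i)) (sym (offset-∷ r rows j)) (+-monoʳ-≤ (length r) (offset-mono rows i≤j))

offset-suc : {rows : List (List A)} {r : List A} {i : ℕ} → At rows i r → offset rows (suc i) ≡ offset rows i + length r
offset-suc {rows = r ∷ rows} zero = trans (offset-∷ r rows 0) (+-identityʳ _)
offset-suc {rows = r ∷ rows} {i = suc i} (suc a) =
  trans (offset-∷ r rows (suc i)) (trans (cong (length r +_) (offset-suc a)) (trans (sym (+-assoc (length r) _ _))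
      (cong (_+ _) (sym (offset-∷ r rows i)))))

At-concat : {rows : List (List A)} {r : List A} {x : A} {i j : ℕ} → At rows i r → At r j x → At (concat rows)
    (offset rows i + j) x
At-concat zero a = At-++ˡ a
At-concat {rows = r ∷ rows} {x = x} {i = suc i} {j} (suc a) b =
  subst (λ m → At (concat (r ∷ rows)) m x) (trans (sym (+-assoc (length r) _ j)) (cong (_+ j) (sym (offset-∷ r rows i))))
      (At-++ʳ r (At-concat a b))

at-applyUpTo : (f : ℕ → ℕ) {i n : ℕ} → i < n → at 0 (applyUpTo f n) i ≡ f i
at-applyUpTo f {zero}  (s≤s _)   = refl
at-applyUpTo f {suc i} (s≤s i<n) = at-applyUpTo (f ∘ suc) i<n

at-map-upTo : (f : ℕ → ℕ) {i n : ℕ} → i < n → at 0 (map f (upTo n)) i ≡ f i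
at-map-upTo f {i} {n} i<n = trans (cong (λ l → at 0 l i) (map-upTo f n)) (at-applyUpTo f i<n)

module _ {n : ℕ} (G : Graph n) (nbrs : Fin n → List (Fin n)) (adj : AdjacencyLists G nbrs) where
  open Graph G renaming (sym to ~-sym)

  arcs : List (Fin n) → List (Fin n × Fin n)
  arcs []       = []
  arcs (u ∷ us) = map (u ,_) (nbrs u) ++ arcs us

  length-arcs : ∀ us → length (arcs us) ≡ length (concat (map nbrs us))
  length-arcs []       = refl
  length-arcs (u ∷ us) = trans (length-++ (map (u ,_) (nbrs u)))
    (trans (cong₂ _+_ (length-map (u ,_) (nbrs u)) (length-arcs us)) (sym (length-++ (nbrs u))))

  ∈-arcs : ∀ {u v} us → (u , v) ∈ˡ arcs us → u ∈ˡ us × u ~ v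
  ∈-arcs (w ∷ us) e∈ with ∈-++⁻ (map (w ,_) (nbrs w)) e∈
  ... | inj₂ e∈′ = case ∈-arcs us e∈′ of λ where (u∈ , u~v) → there u∈ , u~v
  ... | inj₁ e∈′ with ∈-map⁻ (w ,_) e∈′
  ...   | _ , x∈ , refl = here refl , to (proj₂ (adj w) _) x∈

  Unique-arcs : ∀ {us} → Unique us → Unique (arcs us)
  Unique-arcs [] = []
  Unique-arcs {u ∷ us} (u∉ ∷ un) = Unique.++⁺ (Unique.map⁺ (λ { refl → refl }) (proj₁ (adj u))) (Unique-arcs un) disjoint
    where
    disjoint : ∀ {e} → (e ∈ˡ map (u ,_) (nbrs u) × e ∈ˡ arcs us) → ⊥′
    disjoint (e∈ , e∈′) with ∈-map⁻ (u ,_) e∈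
    ... | _ , _ , refl = Unique[x∷xs]⇒x∉xs (u∉ ∷ un) (proj₁ (∈-arcs us e∈′))

  -- The arcs are listed without repetition, and each of them or its reversal is one of the
  -- increasing pairs counted by `edges`.
  handshake : length (concat (map nbrs (allFin n))) ≤ edges G + edges G
  handshake = begin
    length (concat (map nbrs (allFin n)))        ≡⟨ length-arcs (allFin n) ⟨
    length (arcs (allFin n))                     ≤⟨ length-mono (Unique-arcs (allFin⁺ n)) covered ⟩
    length (E ++ map swap E)                     ≡⟨ length-++ E ⟩
    length E + length (map swap E)               ≡⟨ cong (length E +_) (length-map swap E) ⟩
    edges G + edges G                            ∎
    where
    open ≤-Reasoning
    increasing? : (e : Fin n × Fin n) → Dec (_ × _)
    increasing? (u , v) = (u <ᶠ? v) ×-dec (u ~? v)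

    E = filter increasing? (cartesianProduct (allFin n) (allFin n))

    ∈E : ∀ {u v} → toℕ u < toℕ v → u ~ v → (u , v) ∈ˡ E
    ∈E {u} {v} u<v u~v = ∈-filter⁺ increasing? (∈-cartesianProduct⁺ (∈-allFin u) (∈-allFin v)) (u<v , u~v)

    covered : ∀ {e} → e ∈ˡ arcs (allFin n) → e ∈ˡ E ++ map swap E
    covered {u , v} e∈ with proj₂ (∈-arcs (allFin n) e∈) | <-cmp (toℕ u) (toℕ v)
    ... | u~v | tri< u<v _ _ = ∈-++⁺ˡ (∈E u<v u~v)
    ... | u~v | tri≈ _ u≡v _ = contradiction (toℕ-injective u≡v) (~⇒≢ G u~v)
    ... | u~v | tri> _ _ v<u = ∈-++⁺ʳ E (∈-map⁺ swap (∈E v<u (~-sym u~v)))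

-- Bounds on time and word size

k≤2^k : ∀ k → k ≤ 2 ^ k
k≤2^k zero    = z≤n
k≤2^k (suc k) = begin
  suc k              ≤⟨ +-mono-≤ (m^n>0 2 k) (k≤2^k k) ⟩
  2 ^ k + 2 ^ k      ≡⟨ cong (2 ^ k +_) (+-identityʳ (2 ^ k)) ⟨
  2 ^ suc k          ∎
  where open ≤-Reasoning

^-distribʳ-* : ∀ m n o → (m * n) ^ o ≡ m ^ o * n ^ o
^-distribʳ-* m n zero    = refl
^-distribʳ-* m n (suc o) = trans (cong (m * n *_) (^-distribʳ-* m n o))
  (solve 4 (λ a b c d → a :* b :* (c :* d) := a :* c :* (b :* d)) refl m n (m ^ o) (n ^ o))

-- The number of classes is 2 ^ k + k instead of 2 ^ (k + 1) + k, and this gains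
-- a factor of 2 per pair of rounds, which pays for the simulation of 2 k + 2 rounds.
gain : ∀ k → 2 ^ (k + 1) * (2 ^ k + k) ^ (2 * k + 2) ≤ (2 ^ (k + 1) + k) ^ (2 * k + 2)
gain k = begin
  2 ^ (k + 1) * (2 ^ k + k) ^ (2 * k + 2)        ≡⟨ cong (2 ^ (k + 1) *_) (squares (2 ^ k + k)) ⟩
  2 ^ (k + 1) * ((2 ^ k + k) ^ 2) ^ (k + 1)      ≡⟨ ^-distribʳ-* 2 ((2 ^ k + k) ^ 2) (k + 1) ⟨
  (2 * (2 ^ k + k) ^ 2) ^ (k + 1)                ≤⟨ ^-monoˡ-≤ (k + 1) double-square ⟩
  ((2 ^ (k + 1) + k) ^ 2) ^ (k + 1)              ≡⟨ squares (2 ^ (k + 1) + k) ⟨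
  (2 ^ (k + 1) + k) ^ (2 * k + 2)                ∎
  where
  open ≤-Reasoning
  a = 2 ^ k

  squares : ∀ x → x ^ (2 * k + 2) ≡ (x ^ 2) ^ (k + 1)
  squares x = trans (cong (x ^_) (sym (*-distribˡ-+ 2 k 1))) (sym (^-*-assoc x 2 (k + 1)))

  -- The difference of the two sides is `2 * a * a - k * k`, which `k ≤ 2 ^ k` makes nonnegative.
  double-square : 2 * (a + k) ^ 2 ≤ (2 ^ (k + 1) + k) ^ 2
  double-square = begin
    2 * (a + k) ^ 2
      ≡⟨ solve 2 (λ a k → con 2 :* ((a :+ k) :* ((a :+ k) :* con 1)) :=
                          con 2 :* (a :* a) :+ con 4 :* (a :* k) :+ k :* k :+ k :* k) refl a k ⟩
    2 * (a * a) + 4 * (a * k) + k * k + k * k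
      ≤⟨ +-monoʳ-≤ (2 * (a * a) + 4 * (a * k) + k * k) (≤-trans (*-mono-≤ (k≤2^k k) (k≤2^k k)) (m≤n*m (a * a) 2)) ⟩
    2 * (a * a) + 4 * (a * k) + k * k + 2 * (a * a)
      ≡⟨ solve 2 (λ a k → con 2 :* (a :* a) :+ con 4 :* (a :* k) :+ k :* k :+ con 2 :* (a :* a) :=
                          (con 2 :* a :+ k) :* ((con 2 :* a :+ k) :* con 1)) refl a k ⟩
    (2 * a + k) ^ 2
      ≡⟨ cong (λ e → (2 ^ e + k) ^ 2) (+-comm 1 k) ⟩
    (2 ^ (k + 1) + k) ^ 2 ∎

-- The left side is the number `2 + T₀` of units in one simulation; the right side is twice the
-- factor provided by `gain`.
rounds-bound : ∀ k → 4 + 2 * k ≤ 2 * 2 ^ (k + 1)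
rounds-bound zero    = ≤-refl
rounds-bound (suc k) = begin
  4 + 2 * suc k                        ≡⟨ solve 1 (λ k → con 4 :+ con 2 :* (con 1 :+ k) := con 4 :+ con 2 :* k :+ con 2) refl
      k ⟩
  4 + 2 * k + 2                        ≤⟨ +-mono-≤ (rounds-bound k) (*-monoʳ-≤ 2 (m^n>0 2 (k + 1))) ⟩
  2 * 2 ^ (k + 1) + 2 * 2 ^ (k + 1)    ≡⟨ solve 1 (λ a → con 2 :* a :+ con 2 :* a := con 2 :* (con 2 :* a)) refl
      (2 ^ (k + 1)) ⟩
  2 * 2 ^ (suc k + 1)                  ∎
  where open ≤-Reasoning

-- The constant 8 collects three factors of 2: one for the extra unit in the number of sequences,
-- one from `rounds-bound`, and one for counting each edge as two arcs.
total-bound : ∀ a k n m M → 1 ≤ n → M ≤ m + m →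
  (suc ((2 ^ k + k) ^ (k + k + 2)) * ((2 + (k + k + 2)) * suc (n + M))) * a ≤ (a * 8) * ((2 ^ (k + 1) + k) ^ (2 * k + 2) *
      (n + m))
total-bound a k n m M 1≤n M≤ = begin
  (suc ((2 ^ k + k) ^ (k + k + 2)) * ((2 + (k + k + 2)) * suc (n + M))) * a
    ≤⟨ *-monoˡ-≤ a (*-mono-≤ strategies (*-mono-≤ rounds size)) ⟩
  ((2 * P) * ((2 * Q) * (2 * (n + m)))) * a
    ≡⟨ solve 4 (λ P Q r a → ((con 2 :* P) :* ((con 2 :* Q) :* (con 2 :* r))) :* a := (a :* con 8) :* (Q :* P :* r)) refl P Q
        (n + m) a ⟩
  (a * 8) * (Q * P * (n + m))
    ≤⟨ *-monoʳ-≤ (a * 8) (*-monoˡ-≤ (n + m) (gain k)) ⟩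
  (a * 8) * ((2 ^ (k + 1) + k) ^ (2 * k + 2) * (n + m)) ∎
  where
  open ≤-Reasoning
  P = (2 ^ k + k) ^ (2 * k + 2)
  Q = 2 ^ (k + 1)

  2k≡ : k + k + 2 ≡ 2 * k + 2
  2k≡ = cong (λ x → k + x + 2) (sym (+-identityʳ k))

  strategies : suc ((2 ^ k + k) ^ (k + k + 2)) ≤ 2 * P
  strategies = begin
    suc ((2 ^ k + k) ^ (k + k + 2))       ≤⟨ +-mono-≤ (≤-trans (≤-reflexive (sym (^-zeroˡ (2 * k + 2))))
        (^-monoˡ-≤ (2 * k + 2) (≤-trans (m^n>0 2 k) (m≤m+n _ k))))
                                            (≤-reflexive (cong ((2 ^ k + k) ^_) 2k≡)) ⟩
    P + P                       ≡⟨ cong (P +_) (+-identityʳ P) ⟨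
    2 * P                       ∎

  rounds : 2 + (k + k + 2) ≤ 2 * Q
  rounds = ≤-trans (≤-reflexive (solve 1 (λ k → con 2 :+ (k :+ k :+ con 2) := con 4 :+ con 2 :* k) refl k)) (rounds-bound k)

  size : suc (n + M) ≤ 2 * (n + m)
  size = begin
    1 + (n + M)          ≤⟨ +-mono-≤ 1≤n (+-monoʳ-≤ n M≤) ⟩
    n + (n + (m + m))    ≡⟨ solve 2 (λ n m → n :+ (n :+ (m :+ m)) := con 2 :* (n :+ m)) refl n m ⟩
    2 * (n + m)          ∎

-- The left side is at most `8 * (2 + n + m)`, and `8` is at most the cube of `2 + n + m`; hence the
-- exponent 4.
word-size : ∀ n m M → M ≤ m + m → 4 * (2 + n + M) ≤ (2 + n + m) ^ 4
word-size n m M M≤ = begin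
  4 * (2 + n + M)            ≤⟨ *-monoʳ-≤ 4 (+-mono-≤ (m≤m+n (2 + n) (2 + n)) M≤) ⟩
  4 * (2 + n + (2 + n) + (m + m))  ≡⟨ solve 2 (λ n m → con 4 :* (con 2 :+ n :+ (con 2 :+ n) :+ (m :+ m)) := (con 2 :+ n :+ m)
      :* con 8) refl n m ⟩
  (2 + n + m) * 8            ≤⟨ *-monoʳ-≤ (2 + n + m) (^-monoˡ-≤ 3 (s≤s (s≤s (z≤n {n + m})))) ⟩
  (2 + n + m) ^ 4            ∎
  where open ≤-Reasoning

-- The algorithm and its correctness

algorithm : Program
algorithm = list-arcs ⨾ classify ⨾ #T ≔ (reg #k ⊕ reg #k) ⊕ lit 2 ⨾ search ⨾ output

value-zero : ∀ {c} T {g} → (∀ i → g i ≡ 0) → value c T g ≡ 0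
value-zero zero    _  = refl
value-zero {c} (suc T) z = cong₂ _+_ (z 0) (trans (cong (c *_) (value-zero {c} T (z ∘ suc))) (*-zeroʳ c))

module Correctness
  (n : ℕ) (G : Graph n) (s : Fin n) (X : Subset n) (k : ℕ) (∣X∣≡k : ∣ X ∣ ≡ k) (th : Threshold G (∁ X))
  (nbrs : Fin n → List (Fin n)) (lists : AdjacencyLists G nbrs) (xs : List (Fin n)) (xs-X : Lists xs (_∈ X))
  (W M m : ℕ) (M≤ : M ≤ m + m) (M≡ : M ≡ length (concat (map nbrs (allFin n)))) (big : 4 * (2 + n + M) ≤ W) where

  open Graph G renaming (sym to ~-sym)

  rows : List (List (Fin n))
  rows = map nbrs (allFin n)

  σ₀ : Store
  σ₀ = input nbrs s xs

  off adj xsᴬ : ℕ → ℕ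
  off = arrs σ₀ $off
  adj = arrs σ₀ $adj
  xsᴬ = arrs σ₀ $xs

  row : ∀ v → At rows (toℕ v) (nbrs v)
  row v = subst (λ l → At l (toℕ v) (nbrs v)) (sym (map-tabulate id nbrs)) (At-tabulate nbrs v)

  off-offset : ∀ {i} → i ≤ n → off i ≡ offset rows i
  off-offset i≤n = at-map-upTo (offset rows) (s≤s i≤n)

  off-end : off n ≡ M
  off-end = trans (off-offset ≤-refl) (trans (cong (length ∘ concat)
      (take-all n rows (≤-reflexive (trans (length-map nbrs (allFin n)) (length-tabulate id))))) (sym M≡))

  off-mono : ∀ {i j} → i ≤ j → j ≤ n → off i ≤ off j
  off-mono i≤j j≤n = subst₂ _≤_ (sym (off-offset (≤-trans i≤j j≤n))) (sym (off-offset j≤n)) (offset-mono rows i≤j)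

  off-suc : ∀ v → off (suc (toℕ v)) ≡ off (toℕ v) + length (nbrs v)
  off-suc v = trans (off-offset (toℕ<n v)) (trans (offset-suc (row v))
      (cong (_+ length (nbrs v)) (sym (off-offset (<⇒≤ (toℕ<n v))))))

  off-deg : ∀ v → off (toℕ v + 1) ∸ off (toℕ v) ≡ length (nbrs v)
  off-deg v = trans (cong (λ z → off z ∸ off (toℕ v)) (+-comm (toℕ v) 1)) (trans (cong (_∸ off (toℕ v)) (off-suc v))
      (m+n∸m≡n (off (toℕ v)) _))

  adj-at : ∀ {v l x} → At (nbrs v) l x → adj (off (toℕ v) + l) ≡ toℕ x
  adj-at {v} {l} {x} a = trans (cong (λ z → adj (z + l)) (off-offset (<⇒≤ (toℕ<n v)))) (At-map (At-concat (row v) a))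

  open Arcs W n M big off refl off-end off-mono using (Listed; run-list-arcs)
  open Sizes W n M big using (L; 3n-fits)

  1≤n : 1 ≤ n
  1≤n = ≤-trans (s≤s z≤n) (toℕ<n s)

  length-xs : length xs ≡ k
  length-xs = trans (length≡∣∣ xs-X) ∣X∣≡k

  k≤n : k ≤ n
  k≤n = subst (_≤ n) ∣X∣≡k (∣p∣≤n X)

  module _ {src : ℕ → ℕ} (listed : Listed M src) where

    arc-sound : ∀ {j} → j < M → ∃ λ u → ∃ λ v → src j ≡ toℕ u × adj j ≡ toℕ v × u ~ v
    arc-sound {j} j<M with listed j<M
    ... | src<n , off≤j , j<off with vertex src<n
    ...   | u , u≡ with <-At (nbrs u) (j ∸ off (toℕ u)) within
      where
      within : j ∸ off (toℕ u) < length (nbrs u)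
      within = subst (j ∸ off (toℕ u) <_) (m+n∸m≡n (off (toℕ u)) _)
        (∸-monoˡ-< (subst (j <_) (trans (cong (off ∘ suc) (sym u≡)) (off-suc u)) j<off) (subst (λ z → off z ≤ j) (sym u≡)
            off≤j))
    ...     | v , a = u , v , sym u≡ ,
      trans (cong adj (sym (m+[n∸m]≡n (subst (λ z → off z ≤ j) (sym u≡) off≤j)))) (adj-at a) , to (proj₂ (lists u) v)
          (At-∈ a)

    arc-complete : ∀ {u v} → u ~ v → ∃ λ j → j < M × src j ≡ toℕ u × adj j ≡ toℕ v
    arc-complete {u} {v} u~v with ∈-At (from (proj₂ (lists u) v) u~v)
    ... | l , a = j , j<M , src≡u , adj-at a
      where
      j = off (toℕ u) + l

      j<next : j < off (suc (toℕ u))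
      j<next = subst (j <_) (sym (off-suc u)) (+-monoʳ-< (off (toℕ u)) (At-< a))

      j<M : j < M
      j<M = <-≤-trans j<next (subst (off (suc (toℕ u)) ≤_) off-end (off-mono (toℕ<n u) ≤-refl))

      -- Different vertices own disjoint ranges of positions, because the offsets are monotone.
      src≡u : src j ≡ toℕ u
      src≡u with listed j<M | <-cmp (src j) (toℕ u)
      ... | _ | tri≈ _ e _ = e
      ... | _ , _ , j<off | tri< lt _ _ = contradiction (≤-trans (off-mono lt (<⇒≤ (toℕ<n u))) (m≤m+n _ l)) (<⇒≱ j<off)
      ... | src<n , off≤j , _ | tri> _ _ gt = contradiction (≤-trans (off-mono gt (<⇒≤ src<n)) off≤j) (<⇒≱ j<next)

  xs-sound : ∀ {i} → i < k → ∃ λ x → x ∈ X × xsᴬ i ≡ toℕ x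
  xs-sound {i} i<k with <-At xs i (subst (i <_) (sym length-xs) i<k)
  ... | x , a = x , to (proj₂ xs-X x) (At-∈ a) , At-map a

  xs-complete : ∀ {x} → x ∈ X → ∃ λ i → i < k × xsᴬ i ≡ toℕ x
  xs-complete {x} x∈X with ∈-At (from (proj₂ xs-X x) x∈X)
  ... | i , a = i , subst (i <_) length-xs (At-< a) , At-map a

  T₀ : ℕ
  T₀ = k + k + 2

  T₀≤ : T₀ ≤ 2 + n + n
  T₀≤ = ≤-trans (≤-reflexive (+-comm (k + k) 2)) (s≤s (s≤s (+-mono-≤ k≤n k≤n)))

  stable-at : ∀ {t D B} → Layered G t D B → T₀ ≤ t → spread G D B ≡ B
  stable-at L le = Layered-stable G th L (≤-trans (≤-reflexive (trans (cong (λ x → 2 * x + 2) ∣X∣≡k)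
      (cong (λ x → k + x + 2) (+-identityʳ k)))) le)

  -- The number `c` of classes is known only after `classify` has run. In `Z` it is replaced by the
  -- bound `2 ^ k + k`, so that one scale can be fixed for the whole algorithm.
  V Z : ℕ
  V = (2 + T₀) * L
  Z = suc ((2 ^ k + k) ^ T₀) * V

  L≤Z : L ≤ Z
  L≤Z = ≤-trans (m≤m+n L _) (m≤m+n V _)

  nonZero-Z : NonZero Z
  nonZero-Z = m*n≢0 (suc ((2 ^ k + k) ^ T₀)) V

  Z-bound : ∀ a → Z * a ≤ (a * 8) * ((2 ^ (k + 1) + k) ^ (2 * k + 2) * (n + m))
  Z-bound a = total-bound a k n m M 1≤n M≤

  Solved : Store → Set
  Solved τ = ∃ λ vs → Outputs τ vs × Optimal G s vs

  remaining : Program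
  remaining = #T ≔ (reg #k ⊕ reg #k) ⊕ lit 2 ⨾ search ⨾ output

  module _ {τ₁ : Store} (f₁ : Frame list-arcs σ₀ τ₁) (m≡M : regs τ₁ #m ≡ M) (listed : Listed M (arrs τ₁ $src)) where

    open Classes W n M big G X k 1≤n k≤n (arrs τ₁ $src) adj xsᴬ
                 (arc-sound listed) (arc-complete listed) xs-sound xs-complete using (Classified; run-classify)

    k-value : regs τ₁ #k ≡ k
    k-value = trans (reg= f₁ #k) length-xs

    module _ {τ₂ : Store} (f₂ : Frame classify τ₁ τ₂) (classified : Classified τ₂) where

      c : ℕ
      c = regs τ₂ #c

      open Simulation W n M big G s T₀ c T₀≤ (3n-fits (proj₁ (proj₂ classified))) off adj (arrs τ₁ $src) (arrs τ₂ $cls)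
                      (length ∘ nbrs) (arc-sound listed) (arc-complete listed) off-deg
                          (λ v → Unique⇒length≤n (proj₁ (lists v))) stable-at
        using (State; κ; Burnt; Searched; run-search; run-output; T₀-fits)

      κ<c : ∀ v → κ v < c
      κ<c = proj₁ (proj₂ (proj₂ classified))

      κ-dominates : ∀ {v p} → κ v ≡ κ p → length (nbrs v) ≤ length (nbrs p) → v ≢ p → Dominates G p v
      κ-dominates same le v≢p with proj₂ (proj₂ (proj₂ classified)) same
      ... | inj₁ v≡p = contradiction v≡p v≢p
      ... | inj₂ (v∉X , p∉X , twins) = degree-dominates G th lists v∉X p∉X twins le

      T-value : regs τ₂ #k + regs τ₂ #k + 2 ≡ T₀
      T-value = cong (λ x → x + x + 2) (trans (reg= f₂ #k) k-value)

      τ₂′ : Store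
      τ₂′ = setReg τ₂ #T (regs τ₂ #k + regs τ₂ #k + 2)

      state : State τ₂′
      state = record
        { n≡ = trans (reg= f₂ #n) (reg= f₁ #n) ; s≡ = trans (reg= f₂ #s) (reg= f₁ #s) ; m≡ = trans (reg= f₂ #m) m≡M
        ; T≡ = T-value ; c≡ = refl ; off≡ = trans (arr= f₂ $off) (arr= f₁ $off) ; adj≡ = trans (arr= f₂ $adj) (arr= f₁ $adj)
        ; src≡ = arr= f₂ $src ; cls≡ = refl }

      dig≡0 : ∀ i → arrs τ₂ $dig i ≡ 0
      dig≡0 i = cong-app (trans (arr= f₂ $dig) (arr= f₁ $dig)) i

      -- A competitor `ws` is matched by some sequence of classes, and that sequence was tried with
      -- a play burning no fewer vertices than the best one. Burned and saved vertices add up to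
      -- `n`.
      optimal : ∀ {τ vs} → Searched τ → Valid G s vs → regs τ #best ≡ Burnt vs → Optimal G s vs
      optimal {τ} {vs} (_ , tried) valid best≡ = valid , λ ws valid′ →
        case classes-suffice G κ (length ∘ nbrs) κ<c (λ v → Unique⇒length≤n (proj₁ (lists v))) κ-dominates stable-at s ws valid′ of λ where
          (g , g<c , least) → case tried g (λ i _ → g<c i) (value-bound T₀ (λ i _ → g<c i)) of λ where
            (us , play , best≤) → subst₂ _≤_ (sym (∣∁p∣≡n∸∣p∣ (burnedFrom G ⊥ ⁅ s ⁆ ws)))
                (sym (∣∁p∣≡n∸∣p∣ (burnedFrom G ⊥ ⁅ s ⁆ vs)))
              (∸-monoʳ-≤ n (≤-trans (subst (_≤ Burnt us) best≡ best≤) (least play)))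

      run-remaining : Run W Z remaining τ₂ 5200 Solved
      run-remaining = weaken (≤-lit _ 5200) (λ _ → id)
        (run-≔⨾ {{nonZero-Z}} (T₀-fits (≤-reflexive T-value))
        (rescale (*-monoˡ-≤ V (s≤s (^-monoˡ-≤ T₀ (proj₁ classified))))
           (run-search state (λ i _ → subst (_< c) (sym (dig≡0 i)) (≤-<-trans z≤n (κ<c s))) (value-zero {c} T₀ dig≡0)) ⟫
               λ {τ₃} _ found →
         weaken ≤-refl (λ _ (vs , valid , best≡ , outputs) → vs , outputs , optimal {τ₃} found valid best≡)
           (rescale (m≤m+n V _) (run-output (proj₁ found)))))

    run-rest : Run W Z (classify ⨾ remaining) τ₁ 6300 Solved
    run-rest = weaken (≤-lit _ 6300) (λ _ → id)
      (rescale (≤-trans (*-monoˡ-≤ L (s≤s (≤-trans (m≤m+n k k) (≤-trans (m≤m+n (k + k) 2) (n≤1+n T₀))))) (m≤m+n V _))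
        (run-classify
          (record { n≡ = reg= f₁ #n ; k≡ = k-value ; m≡ = m≡M ; src≡ = refl ; adj≡ = arr= f₁ $adj ; xs≡ = arr= f₁ $xs })
          (cong-app (arr= f₁ $cls))) ⟫ λ f₂ → run-remaining f₂)

  run-algorithm : Run W Z algorithm σ₀ 7000 Solved
  run-algorithm = weaken (≤-lit _ 7000) (λ _ → id)
    (rescale L≤Z (run-list-arcs refl refl) ⟫ λ f₁ (m≡M , listed) → run-rest f₁ m≡M listed)

  solves : ∀ {a} → Run W Z algorithm σ₀ a Solved → ∃ λ τ → ∃ λ t → ∃ λ vs → (W ⊢ algorithm , σ₀ ⇓ τ , t)
    × t ≤ (a * 8) * ((2 ^ (k + 1) + k) ^ (2 * k + 2) * (n + m)) × Outputs τ vs × Optimal G s vs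
  solves {a} (run e t≤ (vs , outputs , optimal)) = _ , _ , vs , e , ≤-trans t≤ (Z-bound a) , outputs , optimal

theorem1 : ∃[ P ] ∃[ w ] ∃[ C ]
    (∀ (n : ℕ) (G : Graph n) → Connected G →
    ∀ (s : Fin n) (X : Subset n) (k : ℕ) → ∣ X ∣ ≡ k → Threshold G (∁ X) →
    ∀ (nbrs : Fin n → List (Fin n)) → AdjacencyLists G nbrs →
    ∀ (xs : List (Fin n)) → Lists xs (_∈ X) →
    ∃[ σ ] ∃[ t ] ∃[ S ]
    ((2 + n + edges G) ^ w ⊢ P , input nbrs s xs ⇓ σ , t)
    × t ≤ C * ((2 ^ (k + 1) + k) ^ (2 * k + 2) * (n + edges G))
    × Outputs σ S
    × Optimal G s S)
-- The exponent 4 comes from `word-size`, 7000 bounds the numerals accumulated in `run-algorithm`,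
-- and 8 comes from `total-bound`.
theorem1 = algorithm , 4 , 7000 * 8 , λ n G _ s X k ∣X∣≡k th nbrs lists xs xs-X →
  let M≤ = handshake G nbrs lists
      open Correctness n G s X k ∣X∣≡k th nbrs lists xs xs-X _ _ (edges G) M≤ refl (word-size n (edges G) _ M≤)
  in solves run-algorithm
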